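{- Let $\mathcal{L}: \sum_{i\in[k]} c_i x_i = 0$ be a homogeneous linear equation with $k\ge 3$ and $c_1,\dots,c_k\in\mathbb{Z}\setminus\{0\}$. Then the following are equivalent: (a) For every $\delta>0$ there exists $\varepsilon>0$ such that $d(\mathcal{L},\varepsilon)<\delta$; i.e., every solution-free set $A$ of $\mathcal{L}$ in $\mathbb{F}_p$ with $\alpha(\mathrm{Cay}_{\mathbb{F}_p}(A))=o(p)$ has size $o(p)$ (as $p\to\infty$ over primes). (b) There exists a non-empty set $S\subseteq[k]$ such that $\sum_{s\in S} c_s=0$.
   Context: For a prime $p$, a set $A\subseteq\mathbb{F}_p$ is solution-free for $\mathcal{L}$ if there is no $k$-tuple $(a_1,\dots,a_k)\in A^k$ of pairwise distinct elements with $\sum_i c_i a_i=0$ in $\mathbb{F}_p$. The Cayley graph $\mathrm{Cay}_{\mathbb{F}_p}(A)$ is the digraph on vertex set $\mathbb{F}_p$ with an arc $\vec{uv}$ iff $v-u\in A$. For a digraph $D$, $\alpha(D)$ denotes the independence number of its underlying undirected graph. For $\varepsilon>0$, $D(\mathcal{L},\varepsilon,p)$ is the maximum size of a solution-free set $A$ of $\mathcal{L}$ in $\mathbb{F}_p$ with $\alpha(\mathrm{Cay}_{\mathbb{F}_p}(A))\le\varepsilon p$, and $d(\mathcal{L},\varepsilon):=\limsup_{p\to\infty,\ p\text{ prime}} D(\mathcal{L},\varepsilon,p)/p$. -}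

module Defs where

open import Data.Nat as ℕ using (ℕ; zero; suc; _%_)
open import Data.Nat.Primality using (Prime)
open import Data.Integer as ℤ using (ℤ; +_)
open import Data.Integer.Divisibility using () renaming (_∣_ to _∣ℤ_)
open import Data.Fin using (Fin; toℕ)
import Data.Fin
open import Data.Fin.Subset using (Subset; _∈_; _∉_; ∣_∣; Nonempty)
open import Data.Vec using (lookup)
open import Data.Bool using (if_then_else_)
open import Data.Rational as ℚ using (ℚ; _/_; 0ℚ)
open import Data.Product using (Σ; ∃; ∃-syntax; _×_)
open import Data.Sum using (_⊎_)
open import Function.Definitions using (Injective)
open import Relation.Binary.PropositionalEquality using (_≡_; _≢_)
open import Relation.Nullary using (¬_)

sumFin : ∀ {k} → (Fin k → ℤ) → ℤ
sumFin {zero}  f = + 0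
sumFin {suc k} f = f Data.Fin.zero ℤ.+ sumFin (λ i → f (Data.Fin.suc i))

subsetSum : ∀ {k} → Subset k → (Fin k → ℤ) → ℤ
subsetSum S c = sumFin (λ i → if lookup S i then c i else + 0)

-- F_p is modelled as Fin p (residues 0..p-1).
-- A is solution-free for L : Σ c_i x_i = 0: no injective (pairwise distinct)
-- k-tuple from A solves the equation mod p.
SolutionFree : ∀ {k} (c : Fin k → ℤ) (p : ℕ) → Subset p → Set
SolutionFree {k} c p A =
  (a : Fin k → Fin p) → Injective _≡_ _≡_ a → (∀ i → a i ∈ A) →
  ¬ ((+ p) ∣ℤ sumFin (λ i → c i ℤ.* (+ toℕ (a i))))

-- Arc u → v in Cay_{F_p}(A): v - u ∈ A, i.e. u + a ≡ v (mod p) for some a ∈ A.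
Arc : (p : ℕ) → Subset p → Fin p → Fin p → Set
Arc p A u v = ∃[ a ] (a ∈ A × (+ p) ∣ℤ ((+ toℕ v) ℤ.- ((+ toℕ u) ℤ.+ (+ toℕ a))))

Adjacent : (p : ℕ) → Subset p → Fin p → Fin p → Set
Adjacent p A u v = Arc p A u v ⊎ Arc p A v u

Independent : (p : ℕ) → Subset p → Subset p → Set
Independent p A I = ∀ u v → u ∈ I → v ∈ I → u ≢ v → ¬ Adjacent p A u v

AlphaAtMost : (p : ℕ) → Subset p → ℚ → Set
AlphaAtMost p A ε = ∀ I → Independent p A I → (+ ∣ I ∣ / 1) ℚ.≤ ε ℚ.* (+ p / 1)

-- (a): for every δ > 0 there is ε > 0 with d(L, ε) < δ, where
-- d(L,ε) = limsup_p D(L,ε,p)/p; "limsup < δ" is unfolded as: there is δ' < δ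
-- and N such that for all primes p ≥ N, D(L,ε,p) ≤ δ' p, i.e. every
-- solution-free A ⊆ F_p with α(Cay(A)) ≤ εp has |A| ≤ δ' p.
ConditionA : ∀ {k} → (Fin k → ℤ) → Set
ConditionA c =
  ∀ (δ : ℚ) → 0ℚ ℚ.< δ →
  ∃[ ε ] (0ℚ ℚ.< ε × ∃[ δ′ ] (δ′ ℚ.< δ × ∃[ N ] (
    ∀ (p : ℕ) → Prime p → N ℕ.≤ p → (A : Subset p) →
      SolutionFree c p A → AlphaAtMost p A ε →
      (+ ∣ A ∣ / 1) ℚ.≤ δ′ ℚ.* (+ p / 1))))

ConditionB : ∀ {k} → (Fin k → ℤ) → Set
ConditionB {k} c = ∃[ S ] (Nonempty S × subsetSum S c ≡ + 0)

{-# OPTIONS --safe #-}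
module Submission where

-- Suppose that no set of coefficients sums to zero, and let M = 1 + Σ |cᵢ|. Take
-- for A the differences Mʲ − Mⁱ with i < j ≤ n, together with a short interval
-- just above p / M. The translates of an independent set by the powers Mⁱ are
-- disjoint, so the independence number is at most p / (n + 1). In a solution, the
-- coefficients of the terms in the interval sum to zero; if there are none, then
-- those at the largest power of M do.
--
-- Conversely, let σ be a zero-sum set of indices and A a dense set with small
-- independence number. Roth’s theorem, proved by Szemerédi’s density increment on
-- Hilbert cubes and applied repeatedly at growing scales, yields offsets τ that
-- are distinct on σ and solve the equation on σ, such that u + τᵢ ∈ A for a dense
-- set I of u. (If σ consists of two opposite coefficients, take τ = 0.) Call R
-- recurrent if every dense set contains two elements with difference in R; by
-- hypothesis A is recurrent. Recurrence is partition regular and a set with one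
-- nonzero element is not recurrent, so A contains many disjoint recurrent parts, and
-- the offsets can be found in a dense part disjoint from them. Walk from u ∈ I to
-- some v ∈ I with one step −cᵢxᵢ / c(s₀) for every i outside σ, each xᵢ from its
-- own part. Replacing u by v at the index s₀ ∈ σ turns the zero-sum solution
-- u + τ into a solution of the whole equation.

open import Defs
open import Data.Nat using (ℕ; zero; suc; _+_; _*_; _∸_; _^_; _≤_; _<_; z≤n; s≤s; _<ᵇ_; _≡ᵇ_; _!; NonZero; >-nonZero; >-nonZero⁻¹; ≢-nonZero; ≢-nonZero⁻¹)
open import Data.Nat.Properties hiding (_≟_; <⇒≢)
open import Data.Nat.Properties using () renaming (_≟_ to _≟ℕ_)
open import Data.Nat.DivMod hiding (result)
open import Data.Nat.Divisibility using (∣⇒≤; ∣m+n∣m⇒∣n; ∣1⇒≡1; m≤n⇒m!∣n!; ∣-trans; m∣m*n) renaming (_∣_ to _∣ℕ_)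
open import Data.Nat.Primality using (Prime; prime⇒nonZero; ¬prime[1])
open import Data.Nat.Primality.Factorisation using (PrimeFactorisation; factorise)
open import Data.Nat.Coprimality using (prime⇒coprime; coprime-Bézout)
open import Data.Nat.GCD using (module Bézout)
open import Data.Nat.ListAction using (product)
open import Data.Nat.Tactic.RingSolver using (solve-∀)
import Data.Integer as ℤ
open import Data.Integer using (ℤ; +_; -[1+_])
import Data.Integer.Properties as ℤₚ
import Data.Integer.DivMod as ℤ
import Data.Integer.Divisibility as ℤU
import Data.Integer.Divisibility.Signed as ℤS
import Data.Integer.Tactic.RingSolver as ℤR
import Data.Rational as ℚ
open import Data.Rational using (0ℚ)
import Data.Rational.Properties as ℚₚ
import Data.Rational.Unnormalised as ℚᵘ
import Data.Rational.Unnormalised.Properties as ℚᵘₚ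
import Data.Bool as Bool
open import Data.Bool using (Bool; true; false; _∧_; _∨_; not; if_then_else_)
open import Data.Bool.Properties using (¬-not; ∨-zeroʳ)
open import Data.Fin using (Fin; toℕ; fromℕ<; combine; _≟_)
open import Data.Fin.Properties using (any?; all?; pigeonhole; <⇒≢; combine-injective; toℕ-fromℕ<; toℕ-injective; toℕ<n)
open import Data.Fin.Permutation using (Permutation; permutation; _⟨$⟩ʳ_)
open import Data.Fin.Subset using (Subset; _∈_; ∣_∣)
open import Data.Fin.Subset.Properties using (anySubset?; nonempty?)
open import Data.Vec using (lookup; tabulate; []; _∷_)
open import Data.Vec.Properties using (lookup⇒[]=; []=⇒lookup; lookup∘tabulate)
open import Data.List using (List; []; _∷_; length) renaming (tabulate to tabulateL)
open import Data.List.Relation.Unary.All using (All; []; _∷_)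
open import Data.List.Relation.Unary.All.Properties using (tabulate⁺; tabulate⁻)
open import Algebra.Properties.CommutativeMonoid.Sum +-0-commutativeMonoid using (sum; sum-permute; sum-cong-≗)
open import Data.Product using (∃; _×_; _,_; proj₁; proj₂)
open import Data.Sum using (_⊎_; inj₁; inj₂)
open import Data.Empty using (⊥; ⊥-elim)
open import Function using (_∘_)
open import Function.Bundles using (_⇔_; mk⇔)
open import Relation.Nullary using (¬_; Dec; yes; no; does; _×-dec_)
open import Relation.Nullary.Decidable using (¬?; decidable-stable; dec-true; dec-false)
open import Relation.Binary using (tri<; tri≈; tri>)
open import Relation.Binary.PropositionalEquality

-- All constants must be fixed before the prime, because ε may depend only on δ and c; so every
-- density statement below is uniform in P. The obstacle to treating all zero-sum sets alike is a
-- pair of opposite coefficients: its equation forces equal entries, so nothing done inside the pair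
-- can make them distinct. Only the shift at s₀ separates them, which takes an index outside the
-- pair, and k ≥ 3 provides one. Without such a pair each r in σ has a partner q in σ with c r + c q
-- ≠ 0, and the solution built from r and q takes only three values; hence a pattern with three
-- terms suffices. Recurrence yields a step but no control over which one. Disjoint parts therefore
-- keep the step variables apart from one another and from the entries on σ, and a surplus of parts
-- for the last step keeps the shifted entry at s₀ off the others. In the example M exceeds the
-- absolute value of every sum of coefficients: this lets the top power dominate and forces the
-- multiple of p to vanish. The interval has a density fixed by c, while n, which controls the
-- independence number, is chosen after ε.

-- To derive a ≤ b from a combination x ≤ y of hypotheses it suffices to
-- check a semiring identity.
lin : ∀ {x y} a b t → x ≤ y → a + y + t ≡ b + x → a ≤ b
lin {x} {y} a b t h e = +-cancelʳ-≤ x a b (begin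
  a + x      ≤⟨ +-monoʳ-≤ a h ⟩
  a + y      ≤⟨ m≤m+n (a + y) t ⟩
  a + y + t  ≡⟨ e ⟩
  b + x      ∎)
  where open ≤-Reasoning

infixr 6 _⊕_
_⊕_ : ∀ {a b c d} → a ≤ b → c ≤ d → a + c ≤ b + d
_⊕_ = +-mono-≤

infixr 7 _⊗_
_⊗_ : ∀ k {a b} → a ≤ b → k * a ≤ k * b
k ⊗ h = *-monoʳ-≤ k h

-- Sums and counting

∑ : ℕ → (ℕ → ℕ) → ℕ
∑ zero    f = 0
∑ (suc n) f = f 0 + ∑ n (f ∘ suc)

bit : Bool → ℕ
bit true  = 1
bit false = 0

count : ℕ → (ℕ → Bool) → ℕ
count n f = ∑ n (bit ∘ f)

∑-mono : ∀ n {f g} → (∀ i → i < n → f i ≤ g i) → ∑ n f ≤ ∑ n g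
∑-mono zero    h = z≤n
∑-mono (suc n) h = h 0 (s≤s z≤n) ⊕ ∑-mono n (λ i i<n → h (suc i) (s≤s i<n))

∑-cong : ∀ n {f g} → (∀ i → i < n → f i ≡ g i) → ∑ n f ≡ ∑ n g
∑-cong zero    h = refl
∑-cong (suc n) h = cong₂ _+_ (h 0 (s≤s z≤n)) (∑-cong n (λ i i<n → h (suc i) (s≤s i<n)))

∑-+ : ∀ n f g → ∑ n (λ i → f i + g i) ≡ ∑ n f + ∑ n g
∑-+ zero    f g = refl
∑-+ (suc n) f g = trans (cong (λ z → f 0 + g 0 + z) (∑-+ n (f ∘ suc) (g ∘ suc))) (eq (f 0) (g 0) _ _)
  where
  eq : ∀ a b c d → a + b + (c + d) ≡ a + c + (b + d)
  eq = solve-∀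

∑-* : ∀ n k f → ∑ n (λ i → k * f i) ≡ k * ∑ n f
∑-* zero    k f = sym (*-zeroʳ k)
∑-* (suc n) k f = trans (cong (λ z → k * f 0 + z) (∑-* n k (f ∘ suc))) (sym (*-distribˡ-+ k (f 0) _))

∑-const : ∀ n k → ∑ n (λ _ → k) ≡ n * k
∑-const zero    k = refl
∑-const (suc n) k = cong (λ z → k + z) (∑-const n k)

∑-append : ∀ m n f → ∑ (m + n) f ≡ ∑ m f + ∑ n (λ i → f (m + i))
∑-append zero    n f = refl
∑-append (suc m) n f = trans (cong (λ z → f 0 + z) (∑-append m n (f ∘ suc))) (sym (+-assoc (f 0) _ _))

∑-snoc : ∀ n f → ∑ (suc n) f ≡ ∑ n f + f n
∑-snoc zero    f = +-identityʳ (f 0)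
∑-snoc (suc n) f = trans (cong (λ z → f 0 + z) (∑-snoc n (f ∘ suc))) (sym (+-assoc (f 0) _ _))

∑-swap : ∀ m n (f : ℕ → ℕ → ℕ) → ∑ m (λ i → ∑ n (f i)) ≡ ∑ n (λ j → ∑ m (λ i → f i j))
∑-swap zero    n f = sym (trans (∑-const n 0) (*-zeroʳ n))
∑-swap (suc m) n f = trans (cong (λ z → ∑ n (f 0) + z) (∑-swap m n (f ∘ suc)))
  (sym (∑-+ n (f 0) (λ j → ∑ m (λ i → f (suc i) j))))

∑-reverse : ∀ n f → ∑ n (λ i → f (n ∸ suc i)) ≡ ∑ n f
∑-reverse zero    f = refl
∑-reverse (suc n) f = trans (cong (λ z → f n + z) (∑-reverse n f))
    (trans (+-comm (f n) _) (sym (∑-snoc n f)))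

∑-blocks : ∀ ℓ D f → ∑ (ℓ * D) f ≡ ∑ ℓ (λ i → ∑ D (λ j → f (i * D + j)))
∑-blocks zero    D f = refl
∑-blocks (suc ℓ) D f = trans (∑-append D (ℓ * D) f) (cong (λ z → ∑ D f + z)
  (trans (∑-blocks ℓ D (λ i → f (D + i)))
    (∑-cong ℓ (λ i _ → ∑-cong D (λ j _ → cong f (sym (+-assoc D (i * D) j)))))))

∑-classes : ∀ ℓ D f → ∑ (ℓ * D) f ≡ ∑ D (λ j → ∑ ℓ (λ i → f (i * D + j)))
∑-classes ℓ D f = trans (∑-blocks ℓ D f) (∑-swap ℓ D _)

∑-≤-bound : ∀ n {f k} → (∀ i → i < n → f i ≤ k) → ∑ n f ≤ n * k
∑-≤-bound n {f} {k} h = ≤-trans (∑-mono n h) (≤-reflexive (∑-const n k))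

∑-monoˡ : ∀ {m n} f → m ≤ n → ∑ m f ≤ ∑ n f
∑-monoˡ f z≤n     = z≤n
∑-monoˡ f (s≤s h) = +-monoʳ-≤ (f 0) (∑-monoˡ (f ∘ suc) h)

∑-pigeonhole : ∀ n f → 1 ≤ n → ∃ λ i → i < n × ∑ n f ≤ n * f i
∑-pigeonhole (suc zero)    f _ = 0 , s≤s z≤n , ≤-reflexive refl
∑-pigeonhole (suc (suc n)) f _ with ∑-pigeonhole (suc n) (f ∘ suc) (s≤s z≤n)
... | i , i<n , h with ≤-total (f (suc i)) (f 0)
...   | inj₁ le = 0 , s≤s z≤n , +-monoʳ-≤ (f 0) (≤-trans h (suc n ⊗ le))
...   | inj₂ le = suc i , s≤s i<n , le ⊕ h

bit≤1 : ∀ b → bit b ≤ 1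
bit≤1 true  = ≤-refl
bit≤1 false = z≤n

bit-mono : ∀ {a b} → (a ≡ true → b ≡ true) → bit a ≤ bit b
bit-mono {false} h = z≤n
bit-mono {true}  h = ≤-reflexive (cong bit (sym (h refl)))

bit-split : ∀ a b → bit a ≡ bit (a ∧ b) + bit (a ∧ not b)
bit-split false b     = refl
bit-split true  true  = refl
bit-split true  false = refl

count≤ : ∀ n f → count n f ≤ n
count≤ n f = ≤-trans (∑-≤-bound n {bit ∘ f} (λ i _ → bit≤1 (f i))) (≤-reflexive (*-identityʳ n))

count-mono : ∀ n {f g} → (∀ i → i < n → f i ≡ true → g i ≡ true) → count n f ≤ count n g
count-mono n {f} {g} h = ∑-mono n {bit ∘ f} {bit ∘ g} (λ i i<n → bit-mono (h i i<n))

count-split : ∀ n (f g : ℕ → Bool) → count n f ≡ count n (λ i → f i ∧ g i) + count n (λ i → f i ∧ not (g i))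
count-split n f g = trans (∑-cong n {bit ∘ f} {λ i → bit (f i ∧ g i) + bit (f i ∧ not (g i))}
    (λ i _ → bit-split (f i) (g i)))
  (∑-+ n (λ i → bit (f i ∧ g i)) (λ i → bit (f i ∧ not (g i))))

count-witness : ∀ n f → 1 ≤ count n f → ∃ λ i → i < n × f i ≡ true
count-witness (suc n) f h with f 0 in eq
... | true  = 0 , s≤s z≤n , eq
... | false with count-witness n (f ∘ suc) h
...   | i , i<n , e = suc i , s≤s i<n , e

∑-zero : ∀ n f → ∑ n f ≡ 0 → ∀ i → i < n → f i ≡ 0
∑-zero (suc n) f h zero    _         = m+n≡0⇒m≡0 (f 0) h
∑-zero (suc n) f h (suc i) (s≤s i<n) = ∑-zero n (f ∘ suc) (m+n≡0⇒n≡0 (f 0) h) i i<n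

≤-∑ : ∀ n f i → i < n → f i ≤ ∑ n f
≤-∑ (suc n) f zero    _         = m≤m+n (f 0) _
≤-∑ (suc n) f (suc i) (s≤s i<n) = ≤-trans (≤-∑ n (f ∘ suc) i i<n) (m≤n+m _ (f 0))

∧-true : ∀ {a b} → a ∧ b ≡ true → a ≡ true × b ≡ true
∧-true {true} h = refl , h

∧-intro : ∀ {a b} → a ≡ true → b ≡ true → a ∧ b ≡ true
∧-intro refl refl = refl

-- Hilbert cubes

Cube : (ℕ → Bool) → ℕ → List ℕ → Set
Cube E a []       = E a ≡ true
Cube E a (h ∷ hs) = Cube E a hs × Cube E (a + suc h) hs

Cube-∧ : ∀ E h a hs → Cube (λ x → E x ∧ E (x + h)) a hs → Cube E a hs × Cube E (a + h) hs
Cube-∧ E h a []        c         = ∧-true c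
Cube-∧ E h a (h′ ∷ hs) (c₁ , c₂) with Cube-∧ E h a hs c₁ | Cube-∧ E h (a + suc h′) hs c₂
... | p₁ , p₂ | q₁ , q₂ = (p₁ , q₁) , (p₂ , subst (λ z → Cube E z hs) (eq a (suc h′) h) q₂)
  where
  eq : ∀ a b c → a + b + c ≡ a + c + b
  eq = solve-∀

span : List ℕ → ℕ
span []       = 0
span (h ∷ hs) = suc h + span hs

closePairs : ℕ → (ℕ → Bool) → ℕ → ℕ
closePairs H E x = ∑ H (λ h → bit (E x ∧ E (x + suc h)))

-- Every element of E in the window except the last has a later one within distance H, hence a close
-- pair of its own.
count-short : ∀ H E b → b ≤ suc H → count b E ≤ 1 + ∑ b (closePairs H E)
count-short H E zero    _ = z≤n
count-short H E (suc b) (s≤s b≤H) with count b (E ∘ suc) in eq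
... | zero  = ≤-trans (bit≤1 (E 0) ⊕ ≤-refl {0}) (s≤s z≤n)
... | suc c = begin
  bit (E 0) + suc c                                        ≡⟨ cong (λ z → bit (E 0) + z) (sym eq) ⟩
  bit (E 0) + count b (E ∘ suc)                            ≤⟨ first ⊕ count-short H (E ∘ suc) b
      (≤-trans b≤H (n≤1+n H)) ⟩
  closePairs H E 0 + (1 + ∑ b (closePairs H (E ∘ suc)))    ≡⟨ +-suc (closePairs H E 0) _ ⟩
  1 + (closePairs H E 0 + ∑ b (closePairs H E ∘ suc))      ∎
  where
  open ≤-Reasoning
  first : bit (E 0) ≤ closePairs H E 0
  first with count-witness b (E ∘ suc) (subst (1 ≤_) (sym eq) (s≤s z≤n))
  ... | i , i<b , Ei = ≤-trans (bit-mono (λ e → ∧-intro e Ei)) (≤-∑ H _ i (≤-trans i<b b≤H))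

count-chunks : ∀ H E m → count (m * suc H) E ≤ m + ∑ (m * suc H) (closePairs H E)
count-chunks H E zero    = z≤n
count-chunks H E (suc m) = begin
  count (B + m * B) E
    ≡⟨ ∑-append B (m * B) (bit ∘ E) ⟩
  count B E + count (m * B) (λ i → E (B + i))
    ≤⟨ count-short H E B ≤-refl ⊕ count-chunks H (λ i → E (B + i)) m ⟩
  (1 + ∑ B (closePairs H E)) + (m + ∑ (m * B) (λ x → closePairs H (λ i → E (B + i)) x))
    ≡⟨ cong (λ z → (1 + ∑ B (closePairs H E)) + (m + z))
         (∑-cong (m * B) (λ x _ → ∑-cong H (λ h _ →
           cong (λ z → bit (E (B + x) ∧ E z)) (sym (+-assoc B x (suc h)))))) ⟩
  (1 + ∑ B (closePairs H E)) + (m + ∑ (m * B) (λ x → closePairs H E (B + x)))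
    ≡⟨ eq (∑ B (closePairs H E)) m (∑ (m * B) (λ x → closePairs H E (B + x))) ⟩
  suc m + (∑ B (closePairs H E) + ∑ (m * B) (λ x → closePairs H E (B + x)))
    ≡⟨ cong (λ z → suc m + z) (sym (∑-append B (m * B) (closePairs H E))) ⟩
  suc m + ∑ (B + m * B) (closePairs H E) ∎
  where
  open ≤-Reasoning
  B = suc H
  eq : ∀ a b c → (1 + a) + (b + c) ≡ 1 + b + (a + c)
  eq = solve-∀

DenseStep : ℕ → ℕ → ℕ → ℕ → ℕ → Set
DenseStep e C H e′ C′ = ∀ E n → n ≤ e * count n E + C →
  ∃ λ h → h < H × n ≤ e′ * count n (λ x → E x ∧ E (x + suc h)) + C′

-- Windows of length B = 2e + 2 cost one element each, which uses up at most half of the density 1 /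
-- e. So close pairs are still dense, and the commonest of the H differences is kept. The additive
-- constants absorb the incomplete last window.
dense-step : ∀ e C → ∃ λ H → ∃ λ e′ → ∃ λ C′ → DenseStep e C H e′ C′
dense-step e C = H , 2 * e * H , 2 * e * B + 2 * C , step
 where
 H = suc (e + e)
 B = suc H
 step : ∀ E n → n ≤ e * count n E + C →
   ∃ λ h → h < H × n ≤ 2 * e * H * count n (λ x → E x ∧ E (x + suc h)) + (2 * e * B + 2 * C)
 step E n dense = h , h<H , goal
  where
  m = n / B
  r = n % B
  P = ∑ n (closePairs H E)
  pair : ℕ → ℕ
  pair h = count n (λ x → E x ∧ E (x + suc h))
  n≡ : n ≡ m * B + r
  n≡ = trans (m≡m%n+[m/n]*n n B) (+-comm r (m * B))
  count-n : count n E ≤ m + P + r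
  count-n = begin
    count n E                                        ≡⟨ cong (λ z → count z E) n≡ ⟩
    count (m * B + r) E                              ≡⟨ ∑-append (m * B) r (bit ∘ E) ⟩
    count (m * B) E + count r (λ i → E (m * B + i))  ≤⟨ (count-chunks H E m) ⊕ count≤ r _ ⟩
    m + ∑ (m * B) (closePairs H E) + r               ≤⟨ +-monoˡ-≤ r
        (+-monoʳ-≤ m (∑-monoˡ (closePairs H E) (≤-trans (m≤m+n (m * B) r) (≤-reflexive (sym n≡))))) ⟩
    m + P + r                                        ∎
    where open ≤-Reasoning
  pigeon : ∃ λ h → h < H × ∑ H pair ≤ H * pair h
  pigeon = ∑-pigeonhole H pair (s≤s z≤n)
  h = proj₁ pigeon
  h<H = proj₁ (proj₂ pigeon)
  P≤ : P ≤ H * pair h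
  P≤ = ≤-trans (≤-reflexive (∑-swap n H (λ x h → bit (E x ∧ E (x + suc h))))) (proj₂ (proj₂ pigeon))
  goal : n ≤ (2 * e * H) * pair h + (2 * e * suc H + 2 * C)
  goal = lin n _ (m + m + r)
    (2 ⊗ dense ⊕ (2 * e) ⊗ count-n ⊕ (2 * e) ⊗ P≤ ⊕ (2 * e) ⊗ <⇒≤ (m%n<n n B) ⊕ ≤-reflexive (sym n≡))
    (eq n e C (count n E) m P r (pair h))
    where
    eq : ∀ n e C c m P r p → let H = suc (e + e) in
      n + (2 * (e * c + C) + (2 * e * (m + P + r) + (2 * e * (H * p) + (2 * e * suc H + n)))) + (m + m + r)
      ≡ 2 * e * H * p + (2 * e * suc H + 2 * C)
          + (2 * n + (2 * e * c + (2 * e * P + (2 * e * r + (m * suc H + r)))))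
    eq = solve-∀

HilbertBound : ℕ → ℕ → ℕ → ℕ → Set
HilbertBound k e C K = ∀ E n → n ≤ e * count n E + C → K < n →
  ∃ λ a → ∃ λ hs → a < n × length hs ≡ k × span hs ≤ K × Cube E a hs

-- A cube among the x with both x and x + suc h in E is a pair of translated cubes in E, hence a
-- cube with the additional step suc h.
Hilbert-suc : ∀ {k e C H e′ C′ K} → DenseStep e C H e′ C′ → HilbertBound k e′ C′ K → HilbertBound
    (suc k) e C (H + K)
Hilbert-suc {H = H} {K = K} dense-E IH E n dense big with dense-E E n dense
... | h , h<H , dense′ with IH _ n dense′ (≤-<-trans (m≤n+m K H) big)
...   | a , hs , a<n , len , sum≤ , cube =
  a , h ∷ hs , a<n , cong suc len , h<H ⊕ sum≤ , Cube-∧ E (suc h) a hs cube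

Hilbert : ∀ k e C → ∃ (HilbertBound k e C)
Hilbert zero e C = C , λ E n dense C<n → base E n dense C<n (count n E) refl
  where
  base : ∀ E n → n ≤ e * count n E + C → C < n → ∀ c → count n E ≡ c →
    ∃ λ a → ∃ λ hs → a < n × length hs ≡ 0 × span hs ≤ C × Cube E a hs
  base E n dense C<n zero eq = ⊥-elim (<⇒≱ C<n (≤-trans dense (≤-reflexive
    (cong (_+ C) (trans (cong (e *_) eq) (*-zeroʳ (e)))))))
  base E n dense C<n (suc c) eq with count-witness n E (subst (1 ≤_) (sym eq) (s≤s z≤n))
  ... | a , a<n , Ea = a , [] , a<n , refl , z≤n , Ea
Hilbert (suc k) e C =
  let H , e′ , C′ , dense-E = dense-step e C
      K , IH = Hilbert k e′ C′
  in H + K , Hilbert-suc {k} {e} {C} {H} {e′} {C′} {K} dense-E IH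

-- Roth’s theorem for the pattern x, x + αd, x + (α + β)d

∨-true : ∀ a {b} → a ∨ b ≡ true → a ≡ true ⊎ b ≡ true
∨-true true  _ = inj₁ refl
∨-true false e = inj₂ e

not-true : ∀ {b} → (b ≡ true → ⊥) → not b ≡ true
not-true {true}  h = ⊥-elim (h refl)
not-true {false} h = refl

¬-∧-not : ∀ {a b} → a ≡ true → not (a ∧ not b) ≡ true → b ≡ true
¬-∧-not {true} {true} _ _ = refl

<⇒<ᵇ-true : ∀ {m n} → m < n → (m <ᵇ n) ≡ true
<⇒<ᵇ-true {zero}  (s≤s _) = refl
<⇒<ᵇ-true {suc m} (s≤s h) = <⇒<ᵇ-true h

<ᵇ-true⇒< : ∀ {m n} → (m <ᵇ n) ≡ true → m < n
<ᵇ-true⇒< {zero}  {suc n} _ = s≤s z≤n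
<ᵇ-true⇒< {suc m} {suc n} e = s≤s (<ᵇ-true⇒< {m} e)

≥⇒<ᵇ-false : ∀ {m n} → n ≤ m → (m <ᵇ n) ≡ false
≥⇒<ᵇ-false z≤n     = refl
≥⇒<ᵇ-false (s≤s h) = ≥⇒<ᵇ-false h

count-prefix : ∀ N n f → (∀ z → N ≤ z → f z ≡ false) → count n f ≤ count N f
count-prefix N n f vanish with ≤-total n N
... | inj₁ n≤N = ∑-monoˡ (bit ∘ f) n≤N
... | inj₂ N≤n = ≤-reflexive (begin
  count n f                                        ≡⟨ cong (λ z → count z f) (sym (m+[n∸m]≡n N≤n)) ⟩
  count (N + (n ∸ N)) f                            ≡⟨ ∑-append N (n ∸ N) (bit ∘ f) ⟩
  count N f + count (n ∸ N) (λ i → f (N + i))      ≡⟨ cong (λ z → count N f + z)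
      (∑-cong (n ∸ N) (λ i _ → cong bit (vanish (N + i) (m≤m+n N i)))) ⟩
  count N f + ∑ (n ∸ N) (λ _ → 0)                  ≡⟨ cong (λ z → count N f + z)
      (trans (∑-const (n ∸ N) 0) (*-zeroʳ (n ∸ N))) ⟩
  count N f + 0                                    ≡⟨ +-identityʳ _ ⟩
  count N f                                        ∎)
  where open ≡-Reasoning

-- `prev` stands for the value of Y just before position 0, so that a run already in progress is not
-- counted again.
starts : Bool → (ℕ → Bool) → ℕ → ℕ
starts prev Y zero    = 0
starts prev Y (suc n) = bit (Y 0 ∧ not prev) + starts (Y 0) (Y ∘ suc) n

starts-count : ∀ Y n → starts (Y 0) (Y ∘ suc) n ≡ count n (λ i → Y (suc i) ∧ not (Y i))
starts-count Y zero    = refl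
starts-count Y (suc n) = cong (λ z → bit (Y 1 ∧ not (Y 0)) + z) (starts-count (Y ∘ suc) n)

starts≤ : ∀ Y n → starts false Y n ≤ 1 + count n (λ i → Y (suc i) ∧ not (Y i))
starts≤ Y zero    = z≤n
starts≤ Y (suc n) = bit≤1 _ ⊕ ≤-trans (≤-reflexive (starts-count Y n)) (∑-monoˡ _ (n≤1+n n))

module Roth (α′ β′ : ℕ) where

  α = suc α′
  β = suc β′

  Free : (ℕ → Bool) → Set
  Free A = ∀ x d → A x ≡ true → A (x + α * suc d) ≡ true → A (x + (α + β) * suc d) ≡ true → ⊥

  Free-affine : ∀ {A} → Free A → ∀ D a → Free (λ i → A (i * suc D + a))
  Free-affine {A} free D a x d p q r = free (x * suc D + a) (D + d * suc D) p
    (subst (λ z → A z ≡ true) (eq x α (suc d) (suc D) a) q)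
    (subst (λ z → A z ≡ true) (eq x (α + β) (suc d) (suc D) a) r)
    where
    eq : ∀ x α d D a → (x + α * d) * D + a ≡ x * D + a + α * (d * D)
    eq = solve-∀

  Free-shift : ∀ {A} → Free A → ∀ a → Free (λ i → A (a + i))
  Free-shift {A} free a x d p q r = free (a + x) d p
    (subst (λ z → A z ≡ true) (sym (+-assoc a x _)) q)
    (subst (λ z → A z ≡ true) (sym (+-assoc a x _)) r)

  -- An upper density s / Q for all free sets at once, with n₀ for short intervals. Freeness
  -- survives affine substitution, so the same bound holds along every progression, and this is what
  -- the density increment exploits.
  Bound : ℕ → ℕ → ℕ → Set
  Bound s Q n₀ = ∀ A → Free A → ∀ n → Q * count n A ≤ s * n + n₀

  module _ {s Q n₀ : ℕ} (bound : Bound s Q n₀) where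

    -- On each run of Y the set B is again a free set on an interval, so `bound` charges n₀ once per
    -- run. In `runs-in` the first r positions of the current run have been read, and B still starts
    -- where the run starts.
    runs-out : ∀ n B Y → Free B →
      Q * count n (λ i → B i ∧ Y i) ≤ s * count n Y + n₀ * starts false Y n
    runs-in : ∀ r n B Y → Free B →
      Q * (count r B + count n (λ i → B (r + i) ∧ Y i)) ≤ s * (r + count n Y) + n₀ * (1 + starts true Y n)

    runs-out zero    B Y free = ≤-trans (≤-reflexive (*-zeroʳ Q)) z≤n
    runs-out (suc n) B Y free with Y 0 | runs-in 1 n B (Y ∘ suc) free | runs-out n (B ∘ suc) (Y ∘ suc) (Free-shift free 1)
    ... | true  | inside | _ = ≤-trans (≤-reflexive (cong (Q *_) (eq (B 0)))) inside
      where
      eq : ∀ b → bit (b ∧ true) + count n (λ i → B (suc i) ∧ Y (suc i))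
               ≡ (bit b + 0) + count n (λ i → B (suc i) ∧ Y (suc i))
      eq true  = refl
      eq false = refl
    ... | false | _ | out with B 0
    ...   | true  = out
    ...   | false = out

    runs-in r zero B Y free = ≤-trans (≤-reflexive (cong (Q *_) (+-identityʳ (count r B))))
      (≤-trans (bound B free r) (≤-reflexive (cong₂ _+_ (cong (s *_) (sym (+-identityʳ r)))
          (sym (*-identityʳ n₀)))))
    runs-in r (suc n) B Y free with Y 0 | runs-in (suc r) n B (Y ∘ suc) free | runs-out n (λ i → B (suc r + i)) (Y ∘ suc) (Free-shift free (suc r))
    ... | true | inside | _ = ≤-trans (≤-reflexive (cong (Q *_) left))
        (≤-trans inside (≤-reflexive (cong (λ z → s * z + n₀ * suc (starts true (Y ∘ suc) n))
        (sym (+-suc r _)))))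
      where
      open ≡-Reasoning
      ∧-true-r : ∀ b → b ∧ true ≡ b
      ∧-true-r true  = refl
      ∧-true-r false = refl
      left : count r B + (bit (B (r + 0) ∧ true) + count n (λ i → B (r + suc i) ∧ Y (suc i)))
           ≡ count (suc r) B + count n (λ i → B (suc (r + i)) ∧ Y (suc i))
      left = begin
        count r B + (bit (B (r + 0) ∧ true) + count n (λ i → B (r + suc i) ∧ Y (suc i)))
          ≡⟨ cong₂ (λ u v → count r B + (bit u + v)) (trans (∧-true-r _) (cong B (+-identityʳ r)))
               (∑-cong n (λ i _ → cong (λ z → bit (B z ∧ Y (suc i))) (+-suc r i))) ⟩
        count r B + (bit (B r) + count n (λ i → B (suc (r + i)) ∧ Y (suc i)))
          ≡⟨ sym (+-assoc (count r B) _ _) ⟩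
        count r B + bit (B r) + count n (λ i → B (suc (r + i)) ∧ Y (suc i))
          ≡⟨ cong (_+ count n (λ i → B (suc (r + i)) ∧ Y (suc i))) (sym (∑-snoc r (bit ∘ B))) ⟩
        count (suc r) B + count n (λ i → B (suc (r + i)) ∧ Y (suc i)) ∎
    ... | false | _ | out = begin
      Q * (count r B + (bit (B (r + 0) ∧ false) + count n (λ i → B (r + suc i) ∧ Y (suc i))))
        ≡⟨ cong (λ z → Q * (count r B + z)) (cong₂ _+_ (cong bit (∧-false-r (B (r + 0))))
             (∑-cong n (λ i _ → cong (λ z → bit (B z ∧ Y (suc i))) (+-suc r i)))) ⟩
      Q * (count r B + count n (λ i → B (suc (r + i)) ∧ Y (suc i)))
        ≡⟨ *-distribˡ-+ Q (count r B) _ ⟩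
      Q * count r B + Q * count n (λ i → B (suc (r + i)) ∧ Y (suc i))
        ≤⟨ bound B free r ⊕ out ⟩
      (s * r + n₀) + (s * count n (Y ∘ suc) + n₀ * starts false (Y ∘ suc) n)
        ≡⟨ eq s r n₀ _ _ ⟩
      s * (r + count n (Y ∘ suc)) + n₀ * (1 + starts false (Y ∘ suc) n) ∎
      where
      open ≤-Reasoning
      ∧-false-r : ∀ b → b ∧ false ≡ false
      ∧-false-r true  = refl
      ∧-false-r false = refl
      eq : ∀ s r n c t → (s * r + n) + (s * c + n * t) ≡ s * (r + c) + n * (1 + t)
      eq = solve-∀

    -- The complement of a set that is nearly invariant under translation by D
    -- is a union of few progressions of difference D.
    runs-AP : ∀ B → Free B → ∀ D′ N Y → (∀ z → N ≤ z → Y z ≡ false) → let D = suc D′ in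
      Q * count N (λ z → B z ∧ Y z) ≤ s * count N Y + n₀ * (D + count N (λ z → Y (z + D) ∧ not (Y z)))
    runs-AP B free D′ N Y vanish = begin
      Q * count N BY
        ≤⟨ Q ⊗ ∑-monoˡ (bit ∘ BY) (m≤m*n N D) ⟩
      Q * count (N * D) BY
        ≡⟨ cong (Q *_) (∑-classes N D (bit ∘ BY)) ⟩
      Q * ∑ D cBY
        ≡⟨ sym (∑-* D Q cBY) ⟩
      ∑ D (λ j → Q * cBY j)
        ≤⟨ ∑-mono D (λ j _ → class j) ⟩
      ∑ D (λ j → s * cY j + n₀ * (1 + cW j))
        ≡⟨ ∑-+ D (λ j → s * cY j) (λ j → n₀ * (1 + cW j)) ⟩
      ∑ D (λ j → s * cY j) + ∑ D (λ j → n₀ * (1 + cW j))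
        ≡⟨ cong₂ _+_ (∑-* D s cY) (trans (∑-* D n₀ (λ j → 1 + cW j))
            (cong (n₀ *_) (trans (∑-+ D (λ _ → 1) cW)
            (cong (_+ ∑ D cW) (trans (∑-const D 1) (*-identityʳ D)))))) ⟩
      s * ∑ D cY + n₀ * (D + ∑ D cW)
        ≡⟨ sym (cong₂ (λ u v → s * u + n₀ * (D + v)) (∑-classes N D (bit ∘ Y)) (∑-classes N D (bit ∘ W))) ⟩
      s * count (N * D) Y + n₀ * (D + count (N * D) W)
        ≤⟨ (s ⊗ count-prefix N (N * D) Y vanish) ⊕ (n₀ ⊗ (≤-refl {D} ⊕ count-prefix N (N * D) W vanishW)) ⟩
      s * count N Y + n₀ * (D + count N W) ∎
      where
      open ≤-Reasoning
      D = suc D′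
      BY W : ℕ → Bool
      BY z = B z ∧ Y z
      W z = Y (z + D) ∧ not (Y z)
      cBY cY cW : ℕ → ℕ
      cBY j = count N (λ i → BY (i * D + j))
      cY j = count N (λ i → Y (i * D + j))
      cW j = count N (λ i → W (i * D + j))
      vanishW : ∀ z → N ≤ z → W z ≡ false
      vanishW z N≤z = cong (_∧ not (Y z)) (vanish (z + D) (≤-trans N≤z (m≤m+n z D)))
      class : ∀ j → Q * cBY j ≤ s * cY j + n₀ * (1 + cW j)
      class j = ≤-trans (runs-out N (λ i → B (i * D + j)) (λ i → Y (i * D + j)) (Free-affine free D′ j))
        (+-monoʳ-≤ _ (n₀ ⊗ ≤-trans (starts≤ (λ i → Y (i * D + j)) N)
          (≤-reflexive (cong suc (∑-cong N (λ i _ → cong (λ z → bit (Y z ∧ not (Y (i * D + j))))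
              (eq i D j)))))))
        where
        eq : ∀ i D j → D + i * D + j ≡ i * D + j + D
        eq = solve-∀

    -- The rest of [0, n) consists of a prefix, D′ parallel progressions and a suffix, and `bound`
    -- caps A on each of these D′ + 2 pieces. Whatever density A has overall must therefore show up
    -- in the window.
    window : ∀ A → Free A → ∀ n a ℓ D′ → let D = suc D′ in a + ℓ * D ≤ n →
      Q * count n A + s * ℓ ≤ Q * count ℓ (λ i → A (i * D + a)) + s * n + n₀ * suc D
    window A free n a ℓ D′ fits = lin (Q * count n A + s * ℓ) _ 0
      (Q ⊗ ≤-reflexive total ⊕ bound A free a ⊕ others ⊕ bound _ (Free-shift free (a + ℓ * D)) r ⊕
          s ⊗ ≤-reflexive (sym n≡))
      (eq Q s n₀ a ℓ D′ r n (count n A) _ _ _ _)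
      where
      D = suc D′
      r = n ∸ (a + ℓ * D)
      n≡ : n ≡ a + ℓ * D + r
      n≡ = sym (m+[n∸m]≡n fits)
      w : ℕ → ℕ
      w j = count ℓ (λ i → A (i * D + (a + j)))
      total : count n A ≡ (count a A + (count ℓ (λ i → A (i * D + a)) + ∑ D′ (w ∘ suc))) + count r
          (λ i → A (a + ℓ * D + i))
      total = begin
        count n A ≡⟨ cong (λ z → count z A) n≡ ⟩
        count (a + ℓ * D + r) A ≡⟨ ∑-append (a + ℓ * D) r (bit ∘ A) ⟩
        count (a + ℓ * D) A + R ≡⟨ cong (_+ R) (∑-append a (ℓ * D) (bit ∘ A)) ⟩
        count a A + count (ℓ * D) (λ i → A (a + i)) + R
          ≡⟨ cong (λ z → count a A + z + R) (∑-classes ℓ D (λ i → bit (A (a + i)))) ⟩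
        count a A + ∑ D (λ j → count ℓ (λ i → A (a + (i * D + j)))) + R
          ≡⟨ cong (λ z → count a A + z + R)
              (∑-cong D (λ j _ → ∑-cong ℓ (λ i _ → cong (bit ∘ A) (eq′ a (i * D) j)))) ⟩
        count a A + (w 0 + ∑ D′ (w ∘ suc)) + R
          ≡⟨ cong (λ z → count a A + (z + ∑ D′ (w ∘ suc)) + R)
              (∑-cong ℓ (λ i _ → cong (λ z → bit (A (i * D + z))) (+-identityʳ a))) ⟩
        count a A + (count ℓ (λ i → A (i * D + a)) + ∑ D′ (w ∘ suc)) + R ∎
        where
        open ≡-Reasoning
        R = count r (λ i → A (a + ℓ * D + i))
        eq′ : ∀ a b c → a + (b + c) ≡ b + (a + c)
        eq′ = solve-∀
      others : Q * ∑ D′ (w ∘ suc) ≤ D′ * (s * ℓ + n₀)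
      others = ≤-trans (≤-reflexive (sym (∑-* D′ Q (w ∘ suc))))
        (∑-≤-bound D′ (λ j _ → bound _ (Free-affine free D′ (a + suc j)) ℓ))
      eq : ∀ Q s n₀ a ℓ D′ r n c ca cw co cr → Q * c + s * ℓ +
        (Q * (ca + (cw + co) + cr) + ((s * a + n₀) + (D′ * (s * ℓ + n₀) + ((s * r + n₀) + s * n)))) + 0
        ≡ Q * cw + s * n + n₀ * suc
            (suc D′) + (Q * c + (Q * ca + (Q * co + (Q * cr + s * (a + ℓ * suc D′ + r)))))
      eq = solve-∀

  shift : ℕ → (ℕ → Bool) → ℕ → Bool
  shift zero    f z       = f z
  shift (suc D) f zero    = false
  shift (suc D) f (suc z) = shift D f z

  shift-true : ∀ D f z → shift D f z ≡ true → ∃ λ y → z ≡ D + y × f y ≡ true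
  shift-true zero    f z       e = z , refl , e
  shift-true (suc D) f (suc z) e with shift-true D f z e
  ... | y , z≡ , fy = y , cong suc z≡ , fy

  shift-+ : ∀ D f z → shift D f (D + z) ≡ f z
  shift-+ zero    f z = refl
  shift-+ (suc D) f z = shift-+ D f z

  κ = α + β

  -- This is X₀ + κ · (subset sums of the steps); κ converts a move of the middle term of the
  -- pattern into the matching move of the third.
  sums : (ℕ → Bool) → List ℕ → ℕ → Bool
  sums X₀ []       z = X₀ z
  sums X₀ (h ∷ hs) z = sums X₀ hs z ∨ shift (κ * suc h) (sums X₀ hs) z

  sums-⊇ : ∀ X₀ hs z → X₀ z ≡ true → sums X₀ hs z ≡ true
  sums-⊇ X₀ []       z e = e
  sums-⊇ X₀ (h ∷ hs) z e = cong (_∨ shift (κ * suc h) (sums X₀ hs) z) (sums-⊇ X₀ hs z e)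

  sums-cube : ∀ X₀ hs E a z → sums X₀ hs z ≡ true → Cube E a hs →
    ∃ λ x → ∃ λ h → z ≡ x + κ * h × X₀ x ≡ true × E (a + h) ≡ true
  sums-cube X₀ [] E a z e Ea =
    z , 0 , sym (trans (cong (λ t → z + t) (*-zeroʳ κ)) (+-identityʳ z)) , e , subst (λ y → E y ≡ true)
        (sym (+-identityʳ a)) Ea
  sums-cube X₀ (h ∷ hs) E a z e (c₁ , c₂) with ∨-true (sums X₀ hs z) e
  ... | inj₁ e₁ = sums-cube X₀ hs E a z e₁ c₁
  ... | inj₂ e₂ with shift-true (κ * suc h) (sums X₀ hs) z e₂
  ...   | y , z≡ , ey with sums-cube X₀ hs E (a + suc h) y ey c₂
  ...     | x , h′ , y≡ , Xx , Eh =
    x , suc h + h′ , trans z≡ (trans (cong (λ z → κ * suc h + z) y≡) (eq κ (suc h) x h′)) , Xx ,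
    subst (λ y → E y ≡ true) (+-assoc a (suc h) h′) Eh
    where
    eq : ∀ κ h x h′ → κ * h + (x + κ * h′) ≡ x + κ * (h + h′)
    eq = solve-∀

  module _ {s Q n₀ : ℕ} (bound : Bound s Q n₀) {T : ℕ → Bool} (freeT : Free T)
           {N g : ℕ} (dense : s * N ≤ Q * count N T + g) where

    -- T lies in the complement Y of X. If adding the translate hardly enlarges X, then Y has few
    -- runs along step D, and `runs-AP` bounds T by about s / Q times |Y|; as T has almost density s
    -- / Q on all of [0, N), X must be small. A run start counted by W is a new element of X′,
    -- shifted back by D.
    growth : ∀ X D′ → (∀ z → X z ≡ true → T z ≡ true → ⊥) →
      s * count N X + n₀ * count N X ≤ g + n₀ * suc D′ + n₀ * count N (λ z → X z ∨ shift (suc D′) X z)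
    growth X D′ disjoint = lin _ (g + n₀ * D + n₀ * count N X′) 0
      (dense ⊕ ≤-trans (Q ⊗ T⊆Y) (runs-AP {s} {Q} {n₀} bound T freeT D′ N Y vanish) ⊕ s ⊗ X+Y ⊕ n₀ ⊗ W+X)
      (eq s n₀ g (Q * count N T) (count N X) (count N Y) (count N W) (count N X′) D N)
      where
      D = suc D′
      X′ Y W V : ℕ → Bool
      X′ z = X z ∨ shift D X z
      Y z = (z <ᵇ N) ∧ not (X z)
      W z = Y (z + D) ∧ not (Y z)
      V z = (z <ᵇ N) ∧ (X′ z ∧ not (X z))
      vanish : ∀ z → N ≤ z → Y z ≡ false
      vanish z N≤z = cong (_∧ not (X z)) (≥⇒<ᵇ-false N≤z)
      vanishV : ∀ z → N ≤ z → V z ≡ false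
      vanishV z N≤z = cong (_∧ (X′ z ∧ not (X z))) (≥⇒<ᵇ-false N≤z)
      T⊆Y : count N T ≤ count N (λ z → T z ∧ Y z)
      T⊆Y = count-mono N (λ z z<N Tz → ∧-intro Tz
          (∧-intro (<⇒<ᵇ-true z<N) (not-true (λ Xz → disjoint z Xz Tz))))
      X+Y : count N X + count N Y ≤ N
      X+Y = begin
        count N X + count N Y ≤⟨ +-monoʳ-≤ (count N X) (count-mono N (λ z _ e → proj₂ (∧-true e))) ⟩
        count N X + count N (not ∘ X) ≡⟨ sym (count-split N (λ _ → true) X) ⟩
        count N (λ _ → true) ≤⟨ count≤ N (λ _ → true) ⟩
        N ∎
        where open ≤-Reasoning
      W⇒V : ∀ z → z < N → W z ≡ true → V (D + z) ≡ true
      W⇒V z z<N Wz with ∧-true {Y (z + D)} Wz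
      ... | Y+ , ¬Y with ∧-true {(z + D) <ᵇ N} Y+
      ...   | z+D<N , ¬X+ = subst (λ y → V y ≡ true) (+-comm z D)
        (∧-intro z+D<N (∧-intro (trans (cong (λ b → X (z + D) ∨ b) (trans (cong (shift D X) (+-comm z D))
            (trans (shift-+ D X z) Xz))) (∨-true-r (X (z + D)))) ¬X+))
        where
        ∨-true-r : ∀ b → b ∨ true ≡ true
        ∨-true-r true  = refl
        ∨-true-r false = refl
        Xz : X z ≡ true
        Xz = ¬-∧-not (<⇒<ᵇ-true z<N) ¬Y
      W+X : count N W + count N X ≤ count N X′
      W+X = begin
        count N W + count N X
          ≤⟨ count-mono N W⇒V ⊕ count-mono N {X} {λ z → X′ z ∧ X z}
              (λ z _ Xz → ∧-intro (cong (_∨ shift D X z) Xz) Xz) ⟩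
        count N (λ z → V (D + z)) + count N (λ z → X′ z ∧ X z)
          ≤⟨ +-monoˡ-≤ _ (m≤n+m _ (count D V)) ⟩
        count D V + count N (λ z → V (D + z)) + count N (λ z → X′ z ∧ X z)
          ≡⟨ cong (_+ count N (λ z → X′ z ∧ X z)) (sym (∑-append D N (bit ∘ V))) ⟩
        count (D + N) V + count N (λ z → X′ z ∧ X z)
          ≤⟨ +-monoˡ-≤ _ (≤-trans (count-prefix N (D + N) V vanishV)
              (count-mono N (λ z _ e → proj₂ (∧-true {z <ᵇ N} e)))) ⟩
        count N (λ z → X′ z ∧ not (X z)) + count N (λ z → X′ z ∧ X z)
          ≡⟨ +-comm _ (count N (λ z → X′ z ∧ X z)) ⟩
        count N (λ z → X′ z ∧ X z) + count N (λ z → X′ z ∧ not (X z))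
          ≡⟨ sym (count-split N X′ X) ⟩
        count N X′ ∎
        where open ≤-Reasoning
      eq : ∀ s n₀ g t x y w x′ D N → s * x + n₀ * x +
        ((t + g) + ((s * y + n₀ * (D + w)) + (s * N + n₀ * x′))) + 0
        ≡ g + n₀ * D + n₀ * x′ + (s * N + (t + (s * (x + y) + n₀ * (w + x))))
      eq = solve-∀

    -- Each partial set `sums X₀ hs` avoids T and contains X₀, so at every step of the cube n₀ times
    -- the growth is at least about s |X₀|. Only N positions are counted, so a long cube makes X₀
    -- small.
    growth-cube : ∀ {K E a} X₀ hs → (∀ x h → X₀ x ≡ true → E (a + h) ≡ true → T (x + κ * h) ≡ true → ⊥) →
      κ * span hs ≤ K → Cube E a hs →
      length hs * (s * count N X₀) + n₀ * count N X₀ ≤ length hs * (g + n₀ * K) + n₀ * count N (sums X₀ hs)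
    growth-cube X₀ [] hit small cube = ≤-refl
    growth-cube {K} {E} {a} X₀ (h ∷ hs) hit small (cube , _) = lin _ _ 0
      (growth-cube X₀ hs hit smaller cube ⊕ growth (sums X₀ hs) _ disjoint
        ⊕ s ⊗ count-mono N {X₀} {sums X₀ hs} (λ z _ → sums-⊇ X₀ hs z)
        ⊕ n₀ ⊗ ≤-trans (κ ⊗ m≤m+n (suc h) (span hs)) small)
      (eq (length hs) s n₀ g K (κ * suc h) (count N X₀) (count N (sums X₀ hs)) _)
      where
      smaller : κ * span hs ≤ K
      smaller = ≤-trans (κ ⊗ m≤n+m (span hs) (suc h)) small
      disjoint : ∀ z → sums X₀ hs z ≡ true → T z ≡ true → ⊥
      disjoint z Xz Tz with sums-cube X₀ hs E a z Xz cube
      ... | x , h′ , z≡ , Xx , Eh = hit x h′ Xx Eh (subst (λ y → T y ≡ true) z≡ Tz)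
      eq : ∀ l s n₀ g K D x c c′ → suc l * (s * x) + n₀ * x +
        ((l * (g + n₀ * K) + n₀ * c) + ((g + n₀ * D + n₀ * c′) + (s * c + n₀ * K))) + 0
        ≡ suc l * (g + n₀ * K) + n₀ * c′ + ((l * (s * x) + n₀ * x) + ((s * c + n₀ * c) + (s * x + n₀ * D)))
      eq = solve-∀

  -- Bounds, in units of L, the right ends of the three progressions in `Step`: `F` needs α, `E`
  -- needs α + αβ, and `T` at most α + (α + β)β + 3β.
  G = α + α * β + (α + β) * β + 3 * β

  -- If A beats density s / Q on [0, n), it has nearly density S / Q on the progressions F, E and T.
  -- A cube in E turns F into many translates that miss T, so F is sparse by `growth-cube`.
  -- Comparing the two gives S² L ≤ ((2G + 2)Q + 2GS) L, which `large` forbids.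
  module Step (s Q n₀ K₀ : ℕ) (hilbert : HilbertBound (suc (2 * n₀)) Q 0 K₀)
              (large : (2 * G + 2) * Q + 2 * G * suc s < suc s * suc s) (bound : Bound (suc s) Q n₀) where
    S = suc s
    k = suc (2 * n₀)
    K = κ * K₀
    -- Large enough for L to dominate K₀, K and n₀ * K.
    Lmin = 1 + K₀ + K + n₀ * K
    -- M bounds suc D for the three differences αβ, α and β; n₁ forces n ≥ G * Lmin and absorbs the
    -- term n₀ * suc D of `window`.
    M = 2 + α * β + α + β
    n₁ = Q * (G * Lmin) + n₀ * M

    module _ (A : ℕ → Bool) (free : Free A) (n : ℕ) (big : s * n + n₁ < Q * count n A) where
      n-large : G * Lmin ≤ n
      n-large = ≮⇒≥ λ n< → <-irrefl refl (begin-strict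
        Q * count n A                      ≤⟨ Q ⊗ count≤ n A ⟩
        Q * n                              ≤⟨ Q ⊗ <⇒≤ n< ⟩
        Q * (G * Lmin)                     ≤⟨ m≤m+n _ (n₀ * M) ⟩
        n₁                                 ≤⟨ m≤n+m n₁ (s * n) ⟩
        s * n + n₁                         <⟨ big ⟩
        Q * count n A                      ∎)
        where open ≤-Reasoning

      L = n / G
      Lmin≤L : Lmin ≤ L
      Lmin≤L = ≤-trans (≤-reflexive (sym (m*n/n≡m Lmin G)))
          (/-monoˡ-≤ G (≤-trans (≤-reflexive (*-comm Lmin G)) n-large))
      1≤L : 1 ≤ L
      1≤L = ≤-trans (s≤s z≤n) Lmin≤L
      K₀<L : K₀ < L
      K₀<L = ≤-trans (m≤m+n (suc K₀) K) (≤-trans (m≤m+n _ (n₀ * K)) Lmin≤L)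
      K≤L : K ≤ L
      K≤L = ≤-trans (m≤n+m K (suc K₀)) (≤-trans (m≤m+n _ (n₀ * K)) Lmin≤L)
      nK≤L : n₀ * K ≤ L
      nK≤L = ≤-trans (m≤n+m (n₀ * K) _) Lmin≤L
      GL≤n : G * L ≤ n
      GL≤n = ≤-trans (≤-reflexive (*-comm G L)) (m/n*n≤m n G)
      g = 2 * (G * L)
      n≤g : n ≤ g
      n≤g = begin
        n                ≡⟨ m≡m%n+[m/n]*n n G ⟩
        n % G + L * G    ≤⟨ ≤-trans (<⇒≤ (m%n<n n G)) (≤-trans (≤-reflexive (sym (*-identityʳ G)))
            (G ⊗ 1≤L)) ⊕ ≤-reflexive (*-comm L G) ⟩
        G * L + G * L    ≡⟨ cong (λ z → G * L + z) (sym (+-identityʳ (G * L))) ⟩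
        g                ∎
        where open ≤-Reasoning

      -- Up to constants, A falls short of density S / Q on [0, n) by at most S n - s n = n; g is
      -- this deficit rounded up to a multiple of L.
      window-dense : ∀ a ℓ D′ → a + ℓ * suc D′ ≤ n → suc (suc D′) ≤ M →
        S * ℓ ≤ Q * count ℓ (λ i → A (i * suc D′ + a)) + g
      window-dense a ℓ D′ fits D≤ = lin _ _ (Q * (G * Lmin))
        (window {S} {Q} {n₀} bound A free n a ℓ D′ fits ⊕ <⇒≤ big ⊕ n₀ ⊗ D≤ ⊕ n≤g)
        (eq Q s n₀ n (S * ℓ) (Q * count n A) _ (suc (suc D′)) (G * Lmin) M g)
        where
        eq : ∀ Q s n₀ n t c w D z M g → t + ((Q * w + suc s * n + n₀ * D) + (c + (n₀ * M + g))) + Q * z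
          ≡ Q * w + g + ((c + t) + ((s * n + (Q * z + n₀ * M)) + (n₀ * D + n)))
        eq = solve-∀

      E : ℕ → Bool
      E j = A (j * (α * β) + α * L)
      E-dense : S * L ≤ Q * count L E + g
      E-dense = window-dense (α * L) L (β′ + α′ * β)
          (≤-trans (m≤m+n _ _) (≤-trans (≤-reflexive (eq α β L)) GL≤n))
          (s≤s (≤-trans (m≤m+n _ _) (≤-trans (m≤m+n _ _) (n≤1+n _))))
        where
        eq : ∀ α β L → α * L + L * (α * β) + ((α + β) * β + 3 * β) * L ≡ (α + α * β + (α + β) * β + 3 * β)
            * L
        eq = solve-∀
      2G<S : 2 * G < S
      2G<S = *-cancelʳ-< S (2 * G) S (≤-<-trans (m≤n+m _ _) large)
      E-dense′ : L ≤ Q * count L E + 0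
      E-dense′ = lin _ _ 0 (E-dense ⊕ *-monoˡ-≤ L 2G<S) (eq S L (Q * count L E) G)
        where
        eq : ∀ S L c G → L + ((c + 2 * (G * L)) + S * L) + 0 ≡ c + 0 + (S * L + suc (2 * G) * L)
        eq = solve-∀

      module _ (j₀ : ℕ) (hs : List ℕ) (j₀<L : j₀ < L) (len : length hs ≡ k) (span≤ : span hs ≤ K₀) (cube : Cube E j₀ hs) where
        N = L + K
        -- For x + x′ + 1 = L the entries of F at x′, of E at j₀ + h and of T at
        -- x + κh are the three terms of the pattern.
        t₀ = α * L + (α + β) * β * j₀ + β
        T X₀ F : ℕ → Bool
        T z = A (z * β + t₀)
        F x = A (x * α + 0)
        X₀ x = (x <ᵇ L) ∧ F (L ∸ suc x)
        F-dense : S * L ≤ Q * count L F + g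
        F-dense = window-dense 0 L α′ (≤-trans (m≤m+n _ _) (≤-trans (≤-reflexive (eq α β L)) GL≤n))
            (s≤s (s≤s (≤-trans (n≤1+n α′) (≤-trans (m≤n+m α (α * β)) (m≤m+n (α * β + α) β)))))
          where
          eq : ∀ α β L → L * α + (α * β + (α + β) * β + 3 * β) * L ≡ (α + α * β + (α + β) * β + 3 * β) * L
          eq = solve-∀
        T-dense : S * N ≤ Q * count N T + g
        T-dense = window-dense t₀ N β′ (lin _ _ (α * β * L) (((α + β) * β) ⊗ <⇒≤ j₀<L ⊕ β ⊗ 1≤L ⊕ β ⊗ K≤L ⊕
            GL≤n) (eq α β L K j₀ n)) (s≤s (≤-trans (m≤n+m β (α * β + α)) (n≤1+n _)))
          where
          eq : ∀ α β L K j n → α * L + (α + β) * β * j + β + (L + K) * β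
            + ((α + β) * β * L + (β * L + (β * L + n))) + α * β * L
            ≡ n + ((α + β) * β * j + (β * 1 + (β * K + (α + α * β + (α + β) * β + 3 * β) * L)))
          eq = solve-∀
        F≤X₀ : count L F ≤ count N X₀
        F≤X₀ = begin
          count L F                    ≡⟨ sym (∑-reverse L (bit ∘ F)) ⟩
          count L (λ x → F (L ∸ suc x)) ≤⟨ count-mono L (λ x x<L e → ∧-intro (<⇒<ᵇ-true x<L) e) ⟩
          count L X₀                   ≤⟨ ∑-monoˡ (bit ∘ X₀) (m≤m+n L K) ⟩
          count N X₀                   ∎
          where open ≤-Reasoning
        -- Reversing F in X₀ removes x from the middle term, so a single point of E serves every x,
        -- and x reappears only in the third term. The common difference is β(j₀ + h) + x + 1.
        hit : ∀ x h → X₀ x ≡ true → E (j₀ + h) ≡ true → T (x + κ * h) ≡ true → ⊥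
        hit x h Xx Eh Tz with ∧-true {x <ᵇ L} Xx
        ... | x<L , Fx = free (x′ * α + 0) (β * (j₀ + h) + x) Fx
              (subst (λ z → A z ≡ true) (trans (cong (λ ℓ → (j₀ + h) * (α * β) + α * ℓ) (sym x+x′))
                  (eq₁ α β x x′ j₀ h)) Eh)
              (subst (λ z → A z ≡ true) (trans
                  (cong (λ ℓ → (x + κ * h) * β + (α * ℓ + (α + β) * β * j₀ + β)) (sym x+x′))
                  (eq₂ α β x x′ j₀ h)) Tz)
          where
          x′ = L ∸ suc x
          x+x′ : suc x + x′ ≡ L
          x+x′ = m+[n∸m]≡n (<ᵇ-true⇒< {x} x<L)
          eq₁ : ∀ α β x x′ j h → (j + h) * (α * β) + α * (suc x + x′) ≡ x′ * α + 0 + α * suc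
              (β * (j + h) + x)
          eq₁ = solve-∀
          eq₂ : ∀ α β x x′ j h → (x + (α + β) * h) * β + (α * (suc x + x′) + (α + β) * β * j + β)
            ≡ x′ * α + 0 + (α + β) * suc (β * (j + h) + x)
          eq₂ = solve-∀
        chain : k * (S * count N X₀) + n₀ * count N X₀ ≤ k * (g + n₀ * K) + n₀ * count N (sums X₀ hs)
        chain = subst (λ k → k * (S * count N X₀) + n₀ * count N X₀ ≤ k * (g + n₀ * K) + n₀ * count N
            (sums X₀ hs)) len
          (growth-cube {S} {Q} {n₀} bound (Free-affine free β′ t₀) T-dense {K} {E} {j₀} X₀ hs hit
              (κ ⊗ span≤) cube)
        -- Since k = 2n₀ + 1, the total room n₀ * (L + L) for growth is at most k * L.
        SX₀≤ : S * count N X₀ ≤ g + 2 * L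
        SX₀≤ = *-cancelˡ-≤ k (begin
          k * (S * count N X₀)                            ≤⟨ m≤m+n _ (n₀ * count N X₀) ⟩
          k * (S * count N X₀) + n₀ * count N X₀          ≤⟨ chain ⟩
          k * (g + n₀ * K) + n₀ * count N (sums X₀ hs)    ≤⟨ (k ⊗ (≤-refl {g} ⊕ nK≤L)) ⊕
              (n₀ ⊗ ≤-trans (count≤ N (sums X₀ hs)) (+-monoʳ-≤ L K≤L)) ⟩
          k * (g + L) + n₀ * (L + L)                      ≤⟨ m≤m+n _ L ⟩
          k * (g + L) + n₀ * (L + L) + L                  ≡⟨ eq n₀ g L ⟩
          k * (g + 2 * L)                                 ∎)
          where
          open ≤-Reasoning
          eq : ∀ n g L → suc (2 * n) * (g + L) + n * (L + L) + L ≡ suc (2 * n) * (g + 2 * L)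
          eq = solve-∀
        S²L≤ : S * S * L ≤ ((2 * G + 2) * Q + 2 * G * S) * L
        S²L≤ = begin
          S * S * L                              ≡⟨ *-assoc S S L ⟩
          S * (S * L)                            ≤⟨ S ⊗ ≤-trans F-dense (+-monoˡ-≤ g (Q ⊗ F≤X₀)) ⟩
          S * (Q * count N X₀ + g)               ≡⟨ eq₁ S Q (count N X₀) g ⟩
          Q * (S * count N X₀) + S * g           ≤⟨ +-monoˡ-≤ (S * g) (Q ⊗ SX₀≤) ⟩
          Q * (g + 2 * L) + S * g                ≡⟨ eq₂ S Q L G ⟩
          ((2 * G + 2) * Q + 2 * G * S) * L      ∎
          where
          open ≤-Reasoning
          eq₁ : ∀ S Q x g → S * (Q * x + g) ≡ Q * (S * x) + S * g
          eq₁ = solve-∀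
          eq₂ : ∀ S Q L G → Q * (2 * (G * L) + 2 * L) + S * (2 * (G * L)) ≡ ((2 * G + 2) * Q + 2 * G * S)
              * L
          eq₂ = solve-∀

        cube-contradiction : ⊥
        cube-contradiction = <-irrefl refl (<-≤-trans (*-monoˡ-< L {{>-nonZero 1≤L}} large) S²L≤)

      contradiction : ⊥
      contradiction = let j₀ , hs , j₀<L , len , span≤ , cube = hilbert E L E-dense′ K₀<L in
        cube-contradiction j₀ hs j₀<L len span≤ cube

    result : Bound s Q n₁
    result A free n with Q * count n A ≤? s * n + n₁
    ... | yes h = h
    ... | no ¬h = ⊥-elim (contradiction A free n (≰⇒> ¬h))

  step : ∀ s Q n₀ → (2 * G + 2) * Q + 2 * G * suc s < suc s * suc s → Bound (suc s) Q n₀ → ∃ (Bound s Q)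
  step s Q n₀ large bound = let K₀ , hilbert = Hilbert (suc (2 * n₀)) Q 0 in
    Step.n₁ s Q n₀ K₀ hilbert large bound , Step.result s Q n₀ K₀ hilbert large bound

  -- With s = (4G + 4)e and Q = s e the target s / Q is 1 / e, and s² = (4G + 4)Q is large enough
  -- for `step` at every stage from S = Q, where the bound is trivial, down to s.
  density : ∀ e′ → let e = suc e′ ; s = (4 * G + 4) * e in ∃ (Bound s (s * e))
  density e′ = iterate (s * e′) 0 (λ A _ n → ≤-trans (≤-reflexive (cong (_* count n A) Q≡))
      (≤-trans ((s * e′ + s) ⊗ count≤ n A) (m≤m+n _ 0)))
    where
    e = suc e′
    s = (4 * G + 4) * e
    1≤s : 1 ≤ s
    1≤s = ≤-trans (≤-trans (s≤s z≤n) (m≤n+m 4 (4 * G))) (m≤m*n (4 * G + 4) e)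
    Q≡ : s * e ≡ s * e′ + s
    Q≡ = trans (*-suc s e′) (+-comm s (s * e′))
    large : ∀ j → (2 * G + 2) * (s * e) + 2 * G * (j + s) < (j + s) * (j + s)
    large j = *-cancelˡ-≤ 2 (lin _ _ 2
      (*-mono-≤ s≤ s≤ ⊕ *-monoˡ-≤ (j + s) (≤-trans (m≤m*n (4 * G + 4) e) s≤) ⊕ 4 ⊗ ≤-trans 1≤s s≤)
      (eq G e (j + s)))
      where
      s≤ : s ≤ j + s
      s≤ = m≤n+m s j
      eq : ∀ G e t → let s = (4 * G + 4) * e in
        2 * suc ((2 * G + 2) * (s * e) + 2 * G * t) + (t * t + (t * t + 4 * t)) + 2
        ≡ 2 * (t * t) + (s * s + ((4 * G + 4) * t + 4 * 1))
      eq = solve-∀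
    iterate : ∀ j n₀ → Bound (j + s) (s * e) n₀ → ∃ (Bound s (s * e))
    iterate zero    n₀ bound = n₀ , bound
    iterate (suc j) n₀ bound = let n₁ , bound′ = step (j + s) (s * e) n₀ (large (suc j)) bound in iterate j n₁ bound′

  -- An interval longer than the additive constant lets the error at most double the density.
  roth : ∀ e′ → ∃ λ W → 1 ≤ W × (∀ A → Free A → suc e′ * count W A ≤ 2 * W)
  roth e′ = suc W , s≤s z≤n , λ A free → *-cancelˡ-≤ s {{>-nonZero 1≤s}}
    (lin _ _ s (proj₂ (density e′) A free (suc W) ⊕ *-monoˡ-≤ W 1≤s) (eq s (suc e′) (count (suc W) A) W))
    where
    s = (4 * G + 4) * suc e′
    W = proj₁ (density e′)
    1≤s : 1 ≤ s
    1≤s = ≤-trans (≤-trans (s≤s z≤n) (m≤n+m 4 (4 * G))) (m≤m*n (4 * G + 4) (suc e′))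
    eq : ∀ s e c W → s * (e * c) + ((s * suc W + W) + s * W) + s ≡ s * (2 * suc W) + (s * e * c + 1 * W)
    eq = solve-∀

-- Periodic sets

∑-Fin : ∀ n f → ∑ n f ≡ sum {n} (f ∘ toℕ)
∑-Fin zero    f = refl
∑-Fin (suc n) f = cong (λ z → f 0 + z) (∑-Fin n (f ∘ suc))

-- A subset of ℤ/P is represented by a P-periodic predicate on ℕ.
module Mod (P : ℕ) {{_ : NonZero P}} where

  infix 4 _≈_
  _≈_ : ℕ → ℕ → Set
  x ≈ y = x % P ≡ y % P

  Periodic : ∀ {A : Set} → (ℕ → A) → Set
  Periodic f = ∀ {x y} → x ≈ y → f x ≡ f y

  +-≈ : ∀ {x y u v} → x ≈ y → u ≈ v → x + u ≈ y + v
  +-≈ {x} {y} {u} {v} h k = trans (%-distribˡ-+ x u P) (trans (cong₂ (λ a b → (a + b) % P) h k)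
      (sym (%-distribˡ-+ y v P)))

  *-≈ : ∀ {x y u v} → x ≈ y → u ≈ v → x * u ≈ y * v
  *-≈ {x} {y} {u} {v} h k = trans (%-distribˡ-* x u P) (trans (cong₂ (λ a b → (a * b) % P) h k)
      (sym (%-distribˡ-* y v P)))

  %-≈ : ∀ x → x % P ≈ x
  %-≈ x = m%n%n≡m%n x P

  +-multiple-≈ : ∀ x k → x + k * P ≈ x
  +-multiple-≈ x k = [m+kn]%n≡m%n x k P

  ≈⇒≡ : ∀ {x y} → x < P → y < P → x ≈ y → x ≡ y
  ≈⇒≡ x<P y<P h = trans (sym (m<n⇒m%n≡m x<P)) (trans h (m<n⇒m%n≡m y<P))

  +-cancelˡ-≈ : ∀ u {x y} → u + x ≈ u + y → x ≈ y
  +-cancelˡ-≈ u {x} {y} h = trans (sym (lemma x)) (trans (+-≈ {(P ∸ 1) * u} refl h) (lemma y))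
    where
    lemma : ∀ x → (P ∸ 1) * u + (u + x) ≈ x
    lemma x = trans (cong (_% P)
        (trans (eq (P ∸ 1) u x) (cong (λ z → x + u * z) (m+[n∸m]≡n (>-nonZero⁻¹ P))))) (+-multiple-≈ x u)
      where
      eq : ∀ q u x → q * u + (u + x) ≡ x + u * (1 + q)
      eq = solve-∀

  *-cancelˡ-≈ : ∀ {l m x y} → m * l ≈ 1 → l * x ≈ l * y → x ≈ y
  *-cancelˡ-≈ {l} {m} {x} {y} inv h = trans (sym (lemma x)) (trans (*-≈ {m} refl h) (lemma y))
    where
    lemma : ∀ x → m * (l * x) ≈ x
    lemma x = trans (cong (_% P) (sym (*-assoc m l x))) (trans (*-≈ inv (refl {x = x % P}))
        (cong (_% P) (*-identityˡ x)))

  ∑-shift : ∀ {F : ℕ → ℕ} → Periodic F → ∀ t → ∑ P (λ u → F (u + t)) ≡ ∑ P F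
  ∑-shift {F} per zero    = ∑-cong P (λ i _ → cong F (+-identityʳ i))
  ∑-shift {F} per (suc t) = trans (+-cancelˡ-≡ (F t) _ _ (begin
    F t + ∑ P (λ u → F (u + suc t))  ≡⟨ cong (λ z → F t + z) (∑-cong P (λ i _ → cong F (+-suc i t))) ⟩
    ∑ (suc P) (λ u → F (u + t))      ≡⟨ ∑-snoc P (λ u → F (u + t)) ⟩
    ∑ P (λ u → F (u + t)) + F (P + t) ≡⟨ cong (λ z → ∑ P (λ u → F (u + t)) + z)
        (per (trans (cong (_% P) (+-comm P t)) ([m+n]%n≡m%n t P))) ⟩
    ∑ P (λ u → F (u + t)) + F t      ≡⟨ +-comm _ (F t) ⟩
    F t + ∑ P (λ u → F (u + t))      ∎)) (∑-shift per t)
    where open ≡-Reasoning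

  count-shift : ∀ {f} → Periodic f → ∀ t → count P (λ u → f (u + t)) ≡ count P f
  count-shift per = ∑-shift (λ h → cong bit (per h))

  ∑-dilate : ∀ {F : ℕ → ℕ} → Periodic F → ∀ {l m} → l * m ≈ 1 → ∑ P (λ u → F (l * u)) ≡ ∑ P F
  ∑-dilate {F} per {l} {m} inv = begin
    ∑ P (λ u → F (l * u))                  ≡⟨ ∑-Fin P (λ u → F (l * u)) ⟩
    sum {P} (λ i → F (l * toℕ i))              ≡⟨ sum-cong-≗ {P}
        (λ i → per (sym (trans (cong (_% P) (toℕ-residue (l * toℕ i))) (%-≈ (l * toℕ i))))) ⟩
    sum {P} (λ i → F (toℕ (π ⟨$⟩ʳ i)))         ≡⟨ sym (sum-permute (F ∘ toℕ) π) ⟩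
    sum {P} (F ∘ toℕ)                      ≡⟨ sym (∑-Fin P F) ⟩
    ∑ P F                                  ∎
    where
    open ≡-Reasoning
    residue : ℕ → Fin P
    residue x = fromℕ< (m%n<n x P)
    toℕ-residue : ∀ x → toℕ (residue x) ≡ x % P
    toℕ-residue x = toℕ-fromℕ< (m%n<n x P)
    cancel : ∀ l m i → l * m ≈ 1 → residue (l * toℕ (residue (m * toℕ i))) ≡ i
    cancel l m i inv = toℕ-injective (begin
      toℕ (residue (l * toℕ (residue (m * toℕ i)))) ≡⟨ toℕ-residue _ ⟩
      (l * toℕ (residue (m * toℕ i))) % P           ≡⟨ cong (λ z → (l * z) % P) (toℕ-residue (m * toℕ i)) ⟩
      (l * ((m * toℕ i) % P)) % P                   ≡⟨ *-≈ {l} refl (%-≈ (m * toℕ i)) ⟩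
      (l * (m * toℕ i)) % P                         ≡⟨ cong (_% P) (sym (*-assoc l m (toℕ i))) ⟩
      (l * m * toℕ i) % P                           ≡⟨ *-≈ inv (refl {x = toℕ i % P}) ⟩
      (1 * toℕ i) % P                               ≡⟨ cong (_% P) (*-identityˡ (toℕ i)) ⟩
      toℕ i % P                                     ≡⟨ m<n⇒m%n≡m (toℕ<n i) ⟩
      toℕ i                                         ∎)
    π : Permutation P P
    π = permutation (λ i → residue (l * toℕ i)) (λ i → residue (m * toℕ i))
      (λ i → cancel l m i inv) (λ i → cancel m l i (trans (cong (_% P) (*-comm m l)) inv))

  count-dilate : ∀ {f} → Periodic f → ∀ {l m} → l * m ≈ 1 → count P (λ u → f (l * u)) ≡ count P f
  count-dilate {f} per {l} {m} = ∑-dilate {bit ∘ f} (λ h → cong bit (per h)) {l} {m}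

  Periodic-shift : ∀ {A : Set} {f : ℕ → A} → Periodic f → ∀ t → Periodic (λ u → f (u + t))
  Periodic-shift per t h = per (+-≈ h refl)

  Periodic-∧ : ∀ {f g : ℕ → Bool} → Periodic f → Periodic g → Periodic (λ u → f u ∧ g u)
  Periodic-∧ pf pg h = cong₂ _∧_ (pf h) (pg h)

-- Popular differences: a positive proportion of patterns in ℤ/P

module Popular (α′ β′ : ℕ) where
  open Roth α′ β′

  pattern3 : (ℕ → Bool) → ℕ → ℕ → ℕ → Bool
  pattern3 f Q d u = f u ∧ (f (u + Q * (α * suc d)) ∧ f (u + Q * ((α + β) * suc d)))

  module _ (e W Q : ℕ) (1≤W : 1 ≤ W) (sparse : ∀ A → Free A → 2 * e * count W A ≤ W) where
    module _ (P : ℕ) {{_ : NonZero P}} (f : ℕ → Bool) (per : Mod.Periodic P f) (dense : P ≤ e * count P f) where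
      open Mod P
      B : ℕ → ℕ → Bool
      B u t = (t <ᵇ W) ∧ f (u + Q * t)
      pairs : ℕ → ℕ
      pairs u = ∑ W (λ a → ∑ W (λ d → bit (pattern3 f Q d (u + Q * a))))
      free : ∀ u → pairs u ≡ 0 → Free (B u)
      free u none x d p q r with ∧-true {x <ᵇ W} p | ∧-true {(x + α * suc d) <ᵇ W} q | ∧-true {(x + (α + β) * suc d) <ᵇ W} r
      ... | x<W , fx | y<W , fy | z<W ,
          fz = 1≢0 (trans (sym (cong bit holds)) (∑-zero W (λ d → bit (pattern3 f Q d (u + Q * x)))
              (∑-zero W (λ a → ∑ W (λ d → bit (pattern3 f Q d (u + Q * a)))) none x (<ᵇ-true⇒< {x} x<W)) d
                  d<W))
        where
        1≢0 : ¬ 1 ≡ 0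
        1≢0 ()
        d<W : d < W
        d<W = ≤-<-trans (≤-trans (n≤1+n d) (≤-trans (m≤n*m (suc d) α) (m≤n+m (α * suc d) x)))
            (<ᵇ-true⇒< {x + α * suc d} y<W)
        assoc : ∀ y → u + Q * (x + y) ≡ u + Q * x + Q * y
        assoc y = trans (cong (λ z → u + z) (*-distribˡ-+ Q x y)) (sym (+-assoc u (Q * x) (Q * y)))
        holds : pattern3 f Q d (u + Q * x) ≡ true
        holds = ∧-intro fx (∧-intro (subst (λ z → f z ≡ true) (assoc (α * suc d)) fy)
            (subst (λ z → f z ≡ true) (assoc ((α + β) * suc d)) fz))
      pointwise : ∀ u → 2 * e * count W (B u) ≤ W + 2 * e * W * pairs u
      pointwise u with pairs u in eq
      ... | zero  = ≤-trans (sparse (B u) (free u eq)) (m≤m+n W _)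
      ... | suc m = ≤-trans ((2 * e) ⊗ count≤ W (B u)) (≤-trans (m≤m*n (2 * e * W) (suc m)) (m≤n+m _ W))
      c : ℕ → ℕ
      c d = count P (pattern3 f Q d)
      per3 : ∀ d → Periodic (pattern3 f Q d)
      per3 d = Periodic-∧ per (Periodic-∧ (Periodic-shift per _) (Periodic-shift per _))
      ∑B : ∑ P (λ u → count W (B u)) ≡ W * count P f
      ∑B = begin
        ∑ P (λ u → count W (B u)) ≡⟨ ∑-swap P W (λ u t → bit (B u t)) ⟩
        ∑ W (λ t → count P (λ u → B u t)) ≡⟨ ∑-cong W
            (λ t t<W → trans (∑-cong P (λ u _ → cong (λ b → bit (b ∧ f (u + Q * t))) (<⇒<ᵇ-true t<W)))
            (count-shift per (Q * t))) ⟩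
        ∑ W (λ _ → count P f) ≡⟨ ∑-const W (count P f) ⟩
        W * count P f ∎
        where open ≡-Reasoning
      ∑pairs : ∑ P pairs ≡ W * ∑ W c
      ∑pairs = begin
        ∑ P pairs ≡⟨ ∑-swap P W (λ u a → ∑ W (λ d → bit (pattern3 f Q d (u + Q * a)))) ⟩
        ∑ W (λ a → ∑ P (λ u → ∑ W (λ d → bit (pattern3 f Q d (u + Q * a)))))
          ≡⟨ ∑-cong W (λ a _ → trans (∑-swap P W (λ u d → bit (pattern3 f Q d (u + Q * a))))
              (∑-cong W (λ d _ → count-shift (per3 d) (Q * a)))) ⟩
        ∑ W (λ _ → ∑ W c) ≡⟨ ∑-const W (∑ W c) ⟩
        W * ∑ W c ∎
        where open ≡-Reasoning
      total : 2 * e * (W * count P f) ≤ P * W + 2 * e * W * (W * ∑ W c)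
      total = begin
        2 * e * (W * count P f) ≡⟨ cong (2 * e *_) (sym ∑B) ⟩
        2 * e * ∑ P (λ u → count W (B u)) ≡⟨ sym (∑-* P (2 * e) (λ u → count W (B u))) ⟩
        ∑ P (λ u → 2 * e * count W (B u)) ≤⟨ ∑-mono P (λ u _ → pointwise u) ⟩
        ∑ P (λ u → W + 2 * e * W * pairs u) ≡⟨ ∑-+ P (λ _ → W) (λ u → 2 * e * W * pairs u) ⟩
        ∑ P (λ _ → W) + ∑ P (λ u → 2 * e * W * pairs u) ≡⟨ cong₂ _+_ (∑-const P W)
            (trans (∑-* P (2 * e * W) pairs) (cong (2 * e * W *_) ∑pairs)) ⟩
        P * W + 2 * e * W * (W * ∑ W c) ∎
        where open ≤-Reasoning
      popular-d : ∃ λ d → d < W × P ≤ 2 * e * W * W * c d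
      popular-d with ∑-pigeonhole W c 1≤W
      ... | d , d<W , le = d , d<W , *-cancelˡ-≤ W {{>-nonZero 1≤W}} (lin _ _ 0
        (total ⊕ (2 * W) ⊗ dense ⊕ (2 * e * W * W) ⊗ le) (eq W P e (count P f) (∑ W c) (c d)))
        where
        eq : ∀ W P e f s c → W * P + (P * W + 2 * e * W * (W * s) + (2 * W * (e * f) + 2 * e * W * W
            * (W * c))) + 0
          ≡ W * (2 * e * W * W * c) + (2 * e * (W * f) + (2 * W * P + 2 * e * W * W * s))
        eq = solve-∀

  -- Varnavides' averaging over the windows u + Q t with t < W. A window without a pattern meets f
  -- in at most half of the average, so windows with a pattern supply the rest, and one of the W
  -- differences receives a share independent of P. The dilation Q leaves the low digits to offsets
  -- chosen earlier.
  popular : ∀ e′ Q → ∃ λ W → ∃ λ E → ∀ P {{_ : NonZero P}} f → Mod.Periodic P f → P ≤ suc e′ * count P f →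
    ∃ λ d → d < W × P ≤ E * count P (pattern3 f Q d)
  -- The argument makes `roth` work at 4e with e = suc e′: one factor 2 cancels the 2 in its
  -- conclusion, the other pushes windows without a pattern below half of the average.
  popular e′ Q = let W , 1≤W , sparse = roth (e′ + 3 * suc e′) in
    W , 2 * suc e′ * W * W ,
    λ P f per dense → popular-d (suc e′) W Q 1≤W
      (λ A free → *-cancelˡ-≤ 2 (≤-trans (≤-reflexive (eq (suc e′) (count W A))) (sparse A free))) P f per
          dense
    where
    eq : ∀ e c → 2 * (2 * e * c) ≡ (e + 3 * e) * c
    eq = solve-∀

-- Offset vectors assembled from three-term patterns

digits-injective : ∀ {Q a b x y} → a < Q → b < Q → a + Q * x ≡ b + Q * y → a ≡ b × x ≡ y
digits-injective {Q} {a} {b} {x} {y} a<Q b<Q h = a≡b ,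
    *-cancelˡ-≡ x y Q (+-cancelˡ-≡ b _ _ (trans (cong (_+ Q * x) (sym a≡b)) h))
  where
  instance
    Q≢0 : NonZero Q
    Q≢0 = >-nonZero (≤-<-trans z≤n a<Q)
  mod : ∀ a x → a < Q → (a + Q * x) % Q ≡ a
  mod a x a<Q = trans (cong (λ z → (a + z) % Q) (*-comm Q x)) (trans ([m+kn]%n≡m%n a x Q) (m<n⇒m%n≡m a<Q))
  a≡b : a ≡ b
  a≡b = trans (sym (mod a x a<Q)) (trans (cong (_% Q) h) (mod b y b<Q))

ThreeValued : ∀ {k} → (Fin k → ℕ) → Set
ThreeValued o = ∃ λ α′ → ∃ λ β′ → ∀ i → o i ≡ 0 ⊎ (o i ≡ suc α′ ⊎ o i ≡ suc α′ + suc β′)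

module _ {k : ℕ} (L : (Fin k → ℕ) → Set) (L-zero : L (λ _ → 0))
         (L-closed : ∀ {τ o} m → L τ → L o → L (λ i → τ i + m * o i)) where

  -- B and E are fixed before P, so for P > B different offsets stay different modulo P. L abstracts
  -- the integer solutions of the equation on σ, and `os` will contain a vector for each index that
  -- has to be separated.
  Configuration : List (Fin k → ℕ) → ℕ → ℕ → ℕ → Set
  Configuration os e′ B E = ∀ P {{_ : NonZero P}} f → Mod.Periodic P f → P ≤ suc e′ * count P f →
    ∃ λ (τ : Fin k → ℕ) → ∃ λ I →
      (∀ i → τ i ≤ B) × L τ × (∀ i j → τ i ≡ τ j → All (λ o → o i ≡ o j) os) ×
      Mod.Periodic P I × (∀ u → I u ≡ true → ∀ i → f (u + τ i) ≡ true) × P ≤ suc E * count P I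

  -- The new offset is scaled by a multiple of suc B, so that the old and the new
  -- offsets can both be read off modulo suc B.
  configuration-∷ : ∀ {os e′ B E W E′} o (three : ThreeValued o) → L o → Configuration os e′ B E →
    (let α′ , β′ , _ = three in
     ∀ P {{_ : NonZero P}} f → Mod.Periodic P f → P ≤ suc E * count P f →
     ∃ λ d → d < W × P ≤ E′ * count P (Popular.pattern3 α′ β′ f (suc B) d)) →
    Configuration (o ∷ os) e′ (B + suc B * (W * (suc (proj₁ three) + suc (proj₁ (proj₂ three))))) E′
  configuration-∷ {os} {e′} {B} {E} {W} {E′} o (α′ , β′ , values) Lo config pop P f per dense
    with config P f per dense
  ... | τ , I , τ≤ , Lτ , sep , perI , shifts , denseI with pop P I perI denseI
  ...   | d , d<W , dense′ =
    τ′ , pattern3 I Q d , bounded , L-closed (Q * suc d) Lτ Lo , separated ,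
    Periodic-∧ perI (Periodic-∧ (Periodic-shift perI _) (Periodic-shift perI _)) , shifts′ ,
    ≤-trans dense′ (*-monoˡ-≤ (count P (pattern3 I Q d)) (n≤1+n E′))
    where
    open Mod P
    open Popular α′ β′ using (pattern3)
    α = suc α′
    β = suc β′
    Q = suc B
    τ′ : Fin k → ℕ
    τ′ i = τ i + Q * suc d * o i
    o≤ : ∀ i → o i ≤ α + β
    o≤ i with values i
    ... | inj₁ e        = subst (_≤ α + β) (sym e) z≤n
    ... | inj₂ (inj₁ e) = subst (_≤ α + β) (sym e) (m≤m+n α β)
    ... | inj₂ (inj₂ e) = ≤-reflexive e
    bounded : ∀ i → τ′ i ≤ B + Q * (W * (α + β))
    bounded i = τ≤ i ⊕ ≤-trans (≤-reflexive (*-assoc Q (suc d) (o i))) (Q ⊗ *-mono-≤ d<W (o≤ i))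
    separated : ∀ i j → τ′ i ≡ τ′ j → All (λ o → o i ≡ o j) (o ∷ os)
    separated i j h with digits-injective {Q} {τ i} {τ j} {suc d * o i} {suc d * o j} (s≤s (τ≤ i)) (s≤s (τ≤ j))
      (trans (cong (λ z → τ i + z) (sym (*-assoc Q (suc d) (o i))))
          (trans h (cong (λ z → τ j + z) (*-assoc Q (suc d) (o j)))))
    ... | τ≡ , do≡ = *-cancelˡ-≡ (o i) (o j) (suc d) do≡ ∷ sep i j τ≡
    shifts′ : ∀ u → pattern3 I Q d u ≡ true → ∀ i → f (u + τ′ i) ≡ true
    shifts′ u h i with ∧-true {I u} h
    ... | I₀ , h′ with ∧-true {I (u + Q * (α * suc d))} h′ | values i
    ...   | I₁ , I₂ | inj₁ e        = subst (λ z → f z ≡ true) (trans (eq u (τ i) (Q * suc d))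
        (cong (λ z → u + (τ i + Q * suc d * z)) (sym e))) (shifts u I₀ i)
      where
      eq : ∀ u t q → u + t ≡ u + (t + q * 0)
      eq = solve-∀
    ...   | I₁ , I₂ | inj₂ (inj₁ e) = subst (λ z → f z ≡ true) (trans (eq u (τ i) Q (suc d) α)
        (cong (λ z → u + (τ i + Q * suc d * z)) (sym e))) (shifts _ I₁ i)
      where
      eq : ∀ u t Q d a → u + Q * (a * d) + t ≡ u + (t + Q * d * a)
      eq = solve-∀
    ...   | I₁ , I₂ | inj₂ (inj₂ e) = subst (λ z → f z ≡ true) (trans (eq u (τ i) Q (suc d) (α + β))
        (cong (λ z → u + (τ i + Q * suc d * z)) (sym e))) (shifts _ I₂ i)
      where
      eq : ∀ u t Q d a → u + Q * (a * d) + t ≡ u + (t + Q * d * a)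
      eq = solve-∀

  configuration : ∀ os → All (λ o → ThreeValued o × L o) os → ∀ e′ → ∃ λ B → ∃ λ E → Configuration os e′ B E
  configuration [] [] e′ = 0 , e′ , λ P f per dense →
    (λ _ → 0) , f , (λ _ → z≤n) , L-zero , (λ _ _ _ → []) , per ,
    (λ u fu i → subst (λ z → f z ≡ true) (sym (+-identityʳ u)) fu) , dense
  configuration (o ∷ os) ((three , Lo) ∷ rest) e′ =
    let B , E , config = configuration os rest e′
        W , E′ , pop = Popular.popular (proj₁ three) (proj₁ (proj₂ three)) E (suc B)
    in B + suc B * (W * (suc (proj₁ three) + suc (proj₁ (proj₂ three)))) , E′ , configuration-∷ {os} {e′} {B} {E} {W} {E′} o three Lo config (λ P {{nz}} f per dense → pop P {{nz}} f per dense)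

-- Recurrent sets

open import Data.Fin using (zero; suc)

bit-∧ : ∀ a b → bit (a ∧ b) ≡ bit a * bit b
bit-∧ true  b = sym (+-identityʳ (bit b))
bit-∧ false b = refl

true⊎not : ∀ b → b ≡ true ⊎ not b ≡ true
true⊎not true  = inj₁ refl
true⊎not false = inj₂ refl

not-true⇒¬ : ∀ {b} → not b ≡ true → ¬ b ≡ true
not-true⇒¬ {true} ()

false≢true : ¬ false ≡ true
false≢true ()

≡ᵇ-true⇒≡ : ∀ m n → (m ≡ᵇ n) ≡ true → m ≡ n
≡ᵇ-true⇒≡ zero    zero    _ = refl
≡ᵇ-true⇒≡ (suc m) (suc n) e = cong suc (≡ᵇ-true⇒≡ m n e)

≡⇒≡ᵇ-true : ∀ {m n} → m ≡ n → (m ≡ᵇ n) ≡ true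
≡⇒≡ᵇ-true {zero}  refl = refl
≡⇒≡ᵇ-true {suc m} refl = ≡⇒≡ᵇ-true {m} refl

even : ℕ → Bool
even zero    = true
even (suc n) = not (even n)

count-even : ∀ n → n ≤ 2 * count n even
count-even zero          = z≤n
count-even (suc zero)    = s≤s z≤n
count-even (suc (suc n)) = lin (2 + n) _ 0
  (count-even n ⊕ 2 ⊗ ≤-reflexive (∑-cong n {bit ∘ even} {bit ∘ not ∘ not ∘ even}
      (λ i _ → cong bit (sym (nn (even i))))))
  (eq n (count n even) (count n (not ∘ not ∘ even)))
  where
  nn : ∀ b → not (not b) ≡ b
  nn true  = refl
  nn false = refl
  eq : ∀ n c c′ → 2 + n + (2 * c + 2 * c′) + 0 ≡ 2 * (1 + (0 + c′)) + (n + 2 * c)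
  eq = solve-∀

_⊆_ : (ℕ → Bool) → (ℕ → Bool) → Set
f ⊆ g = ∀ x → f x ≡ true → g x ≡ true

-- The recurrence needed to split off n parts: each part costs a factor N, and the point at the cut
-- between it and the remainder a factor 4.
size : ℕ → ℕ → ℕ
size N zero    = 1
size N (suc n) = N * (4 * size N n)

1≤size : ∀ N n → 2 ≤ N → 1 ≤ size N n
1≤size N zero    2≤N = s≤s z≤n
1≤size N (suc n) 2≤N = *-mono-≤ {1} {N} {1} (≤-trans (s≤s z≤n) 2≤N) (*-mono-≤ {1} {4} {1} (s≤s z≤n)
    (1≤size N n 2≤N))

module Recurrence (P : ℕ) {{_ : NonZero P}} where
  open Mod P

  Avoids : (ℕ → Bool) → (ℕ → Bool) → Set
  Avoids g R = ∀ u x → g u ≡ true → R x ≡ true → g (u + x) ≡ true → ⊥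

  -- The quantitative form of recurrence, stronger for larger N. For the nonzero elements of A it
  -- says that independent sets have at most P / N elements.
  Rec : ℕ → (ℕ → Bool) → Set
  Rec N R = ∀ g → Periodic g → Avoids g R → N * count P g ≤ P

  ∑-correlation : ∀ {f g} → Periodic g →
    ∑ P (λ t → count P (λ u → f u ∧ g (u + t))) ≡ count P f * count P g
  ∑-correlation {f} {g} per = begin
    ∑ P (λ t → count P (λ u → f u ∧ g (u + t)))    ≡⟨ ∑-swap P P (λ t u → bit (f u ∧ g (u + t))) ⟩
    ∑ P (λ u → ∑ P (λ t → bit (f u ∧ g (u + t))))  ≡⟨ ∑-cong P (λ u _ → inner u) ⟩
    ∑ P (λ u → count P g * bit (f u))              ≡⟨ ∑-* P (count P g) (bit ∘ f) ⟩
    count P g * count P f                          ≡⟨ *-comm (count P g) _ ⟩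
    count P f * count P g                          ∎
    where
    open ≡-Reasoning
    inner : ∀ u → ∑ P (λ t → bit (f u ∧ g (u + t))) ≡ count P g * bit (f u)
    inner u = begin
      ∑ P (λ t → bit (f u ∧ g (u + t)))    ≡⟨ ∑-cong P (λ t _ → trans (bit-∧ (f u) _)
          (cong (λ z → bit (f u) * bit (g z)) (+-comm u t))) ⟩
      ∑ P (λ t → bit (f u) * bit (g (t + u))) ≡⟨ ∑-* P (bit (f u)) (λ t → bit (g (t + u))) ⟩
      bit (f u) * count P (λ t → g (t + u))   ≡⟨ cong (bit (f u) *_) (count-shift per u) ⟩
      bit (f u) * count P g                   ≡⟨ *-comm (bit (f u)) _ ⟩
      count P g * bit (f u)                   ∎

  -- Partition regularity: intersecting a set that avoids R₁ with the best
  -- translate of a set that avoids R₂ gives a set that avoids R₁ ∪ R₂.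
  Rec-remove : ∀ {N₁ N₂ R R₁ R₂ g₁} → Rec (N₁ * N₂) R → (∀ x → R x ≡ true → R₁ x ≡ true ⊎ R₂ x ≡ true) →
    Periodic g₁ → Avoids g₁ R₁ → P < N₁ * count P g₁ → Rec N₂ R₂
  Rec-remove {N₁} {N₂} {R} {R₁} {R₂} {g₁} rec cover per₁ av₁ large₁ g₂ per₂ av₂ = ≮⇒≥ λ large₂ →
      <-irrefl refl (begin-strict
    P * P                                                     <⟨ *-mono-< large₁ large₂ ⟩
    (N₁ * count P g₁) * (N₂ * count P g₂)                     ≡⟨ eq N₁ N₂ (count P g₁) (count P g₂) ⟩
    N₁ * N₂ * (count P g₁ * count P g₂)                       ≡⟨ cong (N₁ * N₂ *_)
        (sym (∑-correlation {g₁} per₂)) ⟩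
    N₁ * N₂ * ∑ P (λ t → count P (g t))                       ≡⟨ sym (∑-* P (N₁ * N₂) (λ t → count P (g t)))
        ⟩
    ∑ P (λ t → N₁ * N₂ * count P (g t))                       ≤⟨ ∑-≤-bound P
        (λ t _ → rec (g t) (per t) (avoid t)) ⟩
    P * P                                                     ∎)
    where
    open ≤-Reasoning
    g : ℕ → ℕ → Bool
    g t u = g₁ u ∧ g₂ (u + t)
    per : ∀ t → Periodic (g t)
    per t = Periodic-∧ per₁ (Periodic-shift per₂ t)
    avoid : ∀ t → Avoids (g t) R
    avoid t u x p r q with ∧-true {g₁ u} p | ∧-true {g₁ (u + x)} q | cover x r
    ... | a , b | c , d | inj₁ r₁ = av₁ u x a r₁ c
    ... | a , b | c , d | inj₂ r₂ = av₂ (u + t) x b r₂ (subst (λ z → g₂ z ≡ true) (swap u x t) d)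
      where
      swap : ∀ u x t → u + x + t ≡ u + t + x
      swap = solve-∀
    eq : ∀ a b c d → (a * c) * (b * d) ≡ a * b * (c * d)
    eq = solve-∀

  -- Even residues avoid the difference 1 except across the wrap from P - 1 to 0. For odd P both of
  -- these are even, so P - 1 is left out.
  stripes : ℕ → Bool
  stripes w = even (w % P) ∧ (suc (w % P) <ᵇ P)

  stripes-avoid-1 : ∀ w → stripes w ≡ true → stripes (w + 1) ≡ true → ⊥
  stripes-avoid-1 w p q with ∧-true {even (w % P)} p | ∧-true {even ((w + 1) % P)} q
  ... | ev , small | ev′ , _ = not-true⇒¬ (subst (λ z → even z ≡ true) next ev′) ev
    where
    next : (w + 1) % P ≡ suc (w % P)
    next = trans (sym (+-≈ (%-≈ w) (refl {x = 1 % P}))) (trans (cong (_% P) (+-comm (w % P) 1))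
        (m<n⇒m%n≡m (<ᵇ-true⇒< {suc (w % P)} small)))

  count-stripes : 3 ≤ P → P < 4 * count P stripes
  count-stripes 3≤P = lin (suc P) _ 0
    (≤-reflexive P≡ ⊕ ≤-reflexive P≡ ⊕ 2 ⊗ count-even q ⊕ 4 ⊗ evens ⊕ 3≤P)
        (eq P q (count q even) (count P stripes))
    where
    q = P ∸ 1
    P≡ : P ≡ suc q
    P≡ = sym (m+[n∸m]≡n (>-nonZero⁻¹ P))
    evens : count q even ≤ count P stripes
    evens = begin
      count q even     ≤⟨ count-mono q (λ i i<q e → let i<P = <-≤-trans (s≤s i<q) (≤-reflexive (sym P≡)) in
                            subst (λ z → (even z ∧ (suc z <ᵇ P)) ≡ true)
                                (sym (m<n⇒m%n≡m (<-trans (n<1+n i) i<P))) (∧-intro e (<⇒<ᵇ-true i<P))) ⟩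
      count q stripes  ≤⟨ ∑-monoˡ (bit ∘ stripes) (m∸n≤m P 1) ⟩
      count P stripes  ∎
      where open ≤-Reasoning
    eq : ∀ P q c s → suc P + (suc q + (suc q + (2 * (2 * c) + (4 * s + P)))) + 0 ≡ 4 * s
        + (P + (P + (2 * q + (4 * c + 3))))
    eq = solve-∀

  -- Walks with steps in recurrent sets

  reach : ℕ → (ℕ → Bool) → (ℕ → Bool) → ℕ → Bool
  reach l J R u = 0 <ᵇ count P (λ x → R x ∧ J (u + l * x))

  reach-true : ∀ l J R u → reach l J R u ≡ true → ∃ λ x → R x ≡ true × J (u + l * x) ≡ true
  reach-true l J R u e with count-witness P (λ x → R x ∧ J (u + l * x)) (<ᵇ-true⇒< {0} e)
  ... | x , _ , h = x , ∧-true h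

  reach-intro : ∀ {l J R u x} → Periodic J → Periodic R → R x ≡ true → J (u + l * x) ≡ true →
      reach l J R u ≡ true
  reach-intro {l} {J} {R} {u} {x} perJ perR Rx Jx = <⇒<ᵇ-true (≤-trans
    (≤-reflexive (cong bit (sym (∧-intro (trans (perR (%-≈ x)) Rx)
        (trans (perJ (+-≈ {u} refl (*-≈ {l} refl (%-≈ x)))) Jx)))))
    (≤-∑ P (λ x → bit (R x ∧ J (u + l * x))) (x % P) (m%n<n x P)))

  Periodic-reach : ∀ {l J R} → Periodic J → Periodic (reach l J R)
  Periodic-reach {l} {J} {R} perJ h = cong (0 <ᵇ_)
      (∑-cong P (λ x _ → cong (λ b → bit (R x ∧ b)) (perJ (+-≈ h refl))))

  -- The elements of J with no step into J form a set that avoids l · R.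
  count-stuck : ∀ {N l m J R} → Periodic J → Periodic R → Rec N R → l * m ≈ 1 →
    N * count P (λ u → J u ∧ not (reach l J R u)) ≤ P
  count-stuck {N} {l} {m} {J} {R} perJ perR rec inv = ≤-trans
    (≤-reflexive (cong (N *_) (sym (count-dilate {stuck} perS {l} {m} inv))))
    (rec (λ u → stuck (l * u)) (λ h → perS (*-≈ {l} refl h)) avoid)
    where
    stuck : ℕ → Bool
    stuck u = J u ∧ not (reach l J R u)
    perS : Periodic stuck
    perS h = cong₂ (λ a b → a ∧ not b) (perJ h) (Periodic-reach {l} {J} {R} perJ h)
    avoid : Avoids (λ u → stuck (l * u)) R
    avoid u x p r q = not-true⇒¬ (proj₂ (∧-true {J (l * u)} p))
      (reach-intro {l} {J} {R} {l * u} {x} perJ perR r (subst (λ z → J z ≡ true) (*-distribˡ-+ l u x)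
          (proj₁ (∧-true {J (l * (u + x))} q))))

  stage : ℕ → (ℕ → Bool) → ∀ K → (Fin K → ℕ → Bool) → ℕ → Bool
  stage l J zero    R u = J u
  stage l J (suc K) R u = stage l J K (R ∘ suc) u ∧ reach l J (R zero) u

  stage-⊆ : ∀ l J K R → stage l J K R ⊆ J
  stage-⊆ l J zero    R u e = e
  stage-⊆ l J (suc K) R u e = stage-⊆ l J K (R ∘ suc) u (proj₁ (∧-true e))

  stage-step : ∀ l J K R u → stage l J K R u ≡ true → ∀ j → ∃ λ x → R j x ≡ true × J (u + l * x) ≡ true
  stage-step l J (suc K) R u e zero    = reach-true l J (R zero) u
      (proj₂ (∧-true {stage l J K (R ∘ suc) u} e))
  stage-step l J (suc K) R u e (suc j) = stage-step l J K (R ∘ suc) u (proj₁ (∧-true e)) j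

  Periodic-stage : ∀ {l J} K {R} → Periodic J → Periodic (stage l J K R)
  Periodic-stage zero            perJ = perJ
  Periodic-stage {l} {J} (suc K) {R} perJ = Periodic-∧ (Periodic-stage {l} {J} K {R ∘ suc} perJ)
      (Periodic-reach {l} {J} {R zero} perJ)

  -- A point is lost at part j only if it has no step into J along l · R j, and `count-stuck` allows
  -- at most P / N such points.
  count-stage : ∀ {N l m J} K R → Periodic J → (∀ j → Periodic (R j)) → (∀ j → Rec N (R j)) → l * m ≈ 1 →
    N * count P J ≤ N * count P (stage l J K R) + K * P
  count-stage zero    R perJ perR rec inv = m≤m+n _ 0
  count-stage {N} {l} {m} {J} (suc K) R perJ perR rec inv = lin (N * count P J) _ 0
    (count-stage {N} {l} {m} {J} K (R ∘ suc) perJ (perR ∘ suc) (rec ∘ suc) inv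
      ⊕ N ⊗ ≤-reflexive (count-split P S r)
      ⊕ N ⊗ count-mono P (λ u _ e → ∧-intro (stage-⊆ l J K (R ∘ suc) u (proj₁ (∧-true {S u} e)))
          (proj₂ (∧-true {S u} e)))
      ⊕ count-stuck {N} {l} {m} {J} perJ (perR zero) (rec zero) inv)
    (eq N K P (count P J) (count P S) (count P (λ u → S u ∧ r u)) (count P (λ u → S u ∧ not (r u)))
        (count P (λ u → J u ∧ not (r u))))
    where
    S r : ℕ → Bool
    S = stage l J K (R ∘ suc)
    r = reach l J (R zero)
    eq : ∀ N K P j s a b c → N * j + ((N * s + K * P) + (N * (a + b) + (N * c + P))) + 0
      ≡ N * a + suc K * P + (N * j + (N * s + (N * b + N * c)))
    eq = solve-∀

  -- Built from the end of the walk: every point has a step for the first active index into the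
  -- chain of the remaining indices, so a walk never gets stuck before it reaches J.
  chain : (ℕ → Bool) → ∀ n K → (Fin n → Bool) → (Fin n → ℕ) → (Fin n → Fin K → ℕ → Bool) → ℕ → Bool
  chain J zero    K act l R = J
  chain J (suc n) K act l R = if act zero then stage (l zero) C K (R zero) else C
    where C = chain J n K (act ∘ suc) (l ∘ suc) (R ∘ suc)

  Periodic-chain : ∀ {J} n K act l R → Periodic J → Periodic (chain J n K act l R)
  Periodic-chain zero    K act l R perJ = perJ
  Periodic-chain (suc n) K act l R perJ with act zero
  ... | true  = Periodic-stage K (Periodic-chain n K (act ∘ suc) (l ∘ suc) (R ∘ suc) perJ)
  ... | false = Periodic-chain n K (act ∘ suc) (l ∘ suc) (R ∘ suc) perJ

  chain-⊆ : ∀ J n K act l R → chain J n K act l R ⊆ J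
  chain-⊆ J zero    K act l R u e = e
  chain-⊆ J (suc n) K act l R u e with act zero
  ... | true  = chain-⊆ J n K (act ∘ suc) (l ∘ suc) (R ∘ suc) u (stage-⊆ (l zero) _ K (R zero) u e)
  ... | false = chain-⊆ J n K (act ∘ suc) (l ∘ suc) (R ∘ suc) u e

  count-chain : ∀ {N J} n K act l R → Periodic J → (∀ i j → Periodic (R i j)) → (∀ i j → Rec N (R i j)) →
    (∀ i → ∃ λ m → l i * m ≈ 1) → N * count P J ≤ N * count P (chain J n K act l R) + n * (K * P)
  count-chain zero K act l R perJ perR rec inv = m≤m+n _ 0
  count-chain {N} {J} (suc n) K act l R perJ perR rec inv
    with act zero | count-chain {N} {J} n K (act ∘ suc) (l ∘ suc) (R ∘ suc) perJ (perR ∘ suc) (rec ∘ suc) (inv ∘ suc)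
  ... | false | ih = ≤-trans ih (+-monoʳ-≤ _ (m≤n+m (n * (K * P)) (K * P)))
  ... | true  | ih = ≤-trans ih (≤-trans (+-monoˡ-≤ (n * (K * P))
      (count-stage {N} {l zero} {proj₁ (inv zero)} K (R zero) (Periodic-chain n K (act ∘ suc) (l ∘ suc)
          (R ∘ suc) perJ) (perR zero) (rec zero) (proj₂ (inv zero))))
    (≤-reflexive (+-assoc _ (K * P) (n * (K * P)))))

  displacement : ∀ {n} → (Fin n → Bool) → (Fin n → ℕ) → (Fin n → ℕ) → ℕ
  displacement act l x = sum (λ i → if act i then l i * x i else 0)

  chain-walk : ∀ J n K act l (R : Fin n → Fin (suc K) → ℕ → Bool) u → chain J n (suc K) act l R u ≡ true →
    ∃ λ x → (∀ i → act i ≡ true → R i zero (x i) ≡ true) × J (u + displacement act l x) ≡ true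
  chain-walk J zero    K act l R u e = (λ ()) , (λ ()) , subst (λ z → J z ≡ true) (sym (+-identityʳ u)) e
  chain-walk J (suc n) K act l R u e = by-cases (act zero) refl e
    where
    C = chain J n (suc K) (act ∘ suc) (l ∘ suc) (R ∘ suc)
    by-cases : ∀ b → act zero ≡ b → (if b then stage (l zero) C (suc K) (R zero) else C) u ≡ true →
      ∃ λ x → (∀ i → act i ≡ true → R i zero (x i) ≡ true) × J (u + displacement act l x) ≡ true
    by-cases true eq e with stage-step (l zero) C (suc K) (R zero) u e zero
    ... | x₀ , Rx₀ , Cu with chain-walk J n K (act ∘ suc) (l ∘ suc) (R ∘ suc) (u + l zero * x₀) Cu
    ...   | x , Rx , Jv = x′ , Rx′ , subst (λ z → J z ≡ true)
            (trans (+-assoc u (l zero * x₀) _)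
                (cong (λ b → u + ((if b then l zero * x₀ else 0) + displacement (act ∘ suc) (l ∘ suc) x))
                (sym eq))) Jv
      where
      x′ : Fin (suc n) → ℕ
      x′ zero    = x₀
      x′ (suc i) = x i
      Rx′ : ∀ i → act i ≡ true → R i zero (x′ i) ≡ true
      Rx′ zero    _ = Rx₀
      Rx′ (suc i) a = Rx i a
    by-cases false eq e with chain-walk J n K (act ∘ suc) (l ∘ suc) (R ∘ suc) u e
    ... | x , Rx , Jv = x′ , Rx′ , subst (λ z → J z ≡ true)
            (cong (λ b → u + ((if b then l zero * 0 else 0) + displacement (act ∘ suc) (l ∘ suc) x))
                (sym eq)) Jv
      where
      x′ : Fin (suc n) → ℕ
      x′ zero    = 0
      x′ (suc i) = x i
      Rx′ : ∀ i → act i ≡ true → R i zero (x′ i) ≡ true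
      Rx′ zero    a = ⊥-elim (false≢true (trans (sym eq) a))
      Rx′ (suc i) a = Rx i a

  -- Disjoint recurrent parts

  module Splitting (3≤P : 3 ≤ P) (inverse : ∀ x → ¬ x ≈ 0 → ∃ λ m → x * m ≈ 1) where

    -- Dilation by the inverse of x turns the difference x into 1, which the stripes avoid.
    avoid-point : ∀ x → ¬ x ≈ 0 → ∃ λ g → Periodic g × Avoids g (λ y → y % P ≡ᵇ x % P) × P < 4 * count P g
    avoid-point x x≉0 with inverse x x≉0
    ... | m , inv = (λ u → stripes (m * u)) , (λ h → cong stripes′ (*-≈ {m} refl h)) , avoid ,
        ≤-trans (count-stripes 3≤P)
            (≤-reflexive (cong (4 *_) (sym (count-dilate {stripes} (cong stripes′) {m} {x}
            (trans (cong (_% P) (*-comm m x)) inv)))))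
      where
      stripes′ : ℕ → Bool
      stripes′ r = even r ∧ (suc r <ᵇ P)
      avoid : Avoids (λ u → stripes (m * u)) (λ y → y % P ≡ᵇ x % P)
      avoid u y p e q = stripes-avoid-1 (m * u) p (trans (cong stripes′ same) q)
        where
        same : m * u + 1 ≈ m * (u + y)
        same = sym (trans (cong (_% P) (*-distribˡ-+ m u y)) (+-≈ {m * u} refl
          (trans (*-≈ {m} refl (≡ᵇ-true⇒≡ (y % P) (x % P) e)) (trans (cong (_% P) (*-comm m x)) inv))))

    below above : ℕ → (ℕ → Bool) → ℕ → Bool
    below j R x = R x ∧ (x % P <ᵇ j)
    above j R x = R x ∧ not (x % P <ᵇ j)

    -- Raise the cut j until `below j R` first becomes recurrent. Just before that a large set
    -- avoids it, so `Rec-remove` leaves `above j R` recurrent, and a second removal takes out the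
    -- point j. At cut 0 the full set is such a large set, as N ≥ 2. The search runs under double
    -- negation because `Large` quantifies over predicates.
    split : ∀ N N′ R → 2 ≤ N → 1 ≤ N′ → Periodic R → (∀ x → R x ≡ true → ¬ x ≈ 0) → Rec (N * (4 * N′)) R →
      (∀ j → Rec N (below j R) → Rec N′ (above j R) → ⊥) → ⊥
    split N N′ R 2≤N 1≤N′ perR R≉0 rec k = large P ≤-refl λ (g , per , av , big) →
      <-irrefl refl (<-≤-trans big
          (≤-trans (≤-trans (m≤m*n (N * count P g)
          (4 * N′) {{>-nonZero (*-mono-≤ {1} {4} {1} (s≤s z≤n) 1≤N′)}})
        (≤-reflexive (swap N (count P g) (4 * N′))))
            (rec g per (λ u x p r → av u x p (∧-intro r (<⇒<ᵇ-true (m%n<n x P)))))))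
      where
      swap : ∀ a b c → a * b * c ≡ a * c * b
      swap = solve-∀
      Large : ℕ → Set
      Large j = ∃ λ g → Periodic g × Avoids g (below j R) × P < N * count P g
      above-suc : ∀ j x → j < P → above j R x ≡ true → (x % P ≡ᵇ j % P) ≡ true ⊎ above (suc j) R x ≡ true
      above-suc j x j<P a with ∧-true {R x} a
      ... | r , h with true⊎not (x % P <ᵇ suc j)
      ...   | inj₂ e = inj₂ (∧-intro r e)
      ...   | inj₁ e = inj₁ (≡⇒≡ᵇ-true
          (trans (≤-antisym (≤-pred (<ᵇ-true⇒< {x % P} e)) (≮⇒≥ λ lt → not-true⇒¬ h (<⇒<ᵇ-true lt)))
          (sym (m<n⇒m%n≡m j<P))))
      rest : ∀ j → j < P → Large j → Rec N′ (above (suc j) R)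
      rest j j<P (g , per , av , big) = by-cases (R j) refl
        where
        cover : ∀ x → R x ≡ true → below j R x ≡ true ⊎ above j R x ≡ true
        cover x r with true⊎not (x % P <ᵇ j)
        ... | inj₁ e = inj₁ (∧-intro r e)
        ... | inj₂ e = inj₂ (∧-intro r e)
        rec′ : Rec (4 * N′) (above j R)
        rec′ = Rec-remove {N} {4 * N′} {R} {below j R} {above j R} rec cover per av big
        by-cases : ∀ b → R j ≡ b → Rec N′ (above (suc j) R)
        by-cases true eq with avoid-point j (R≉0 j eq)
        ... | g′ , per′ , av′ , big′ =
          Rec-remove {4} {N′} {above j R} {λ y → y % P ≡ᵇ j % P} {above (suc j) R} rec′
              (λ x → above-suc j x j<P) per′ av′ big′
        by-cases false eq g′ per′ av′ = ≤-trans (*-monoˡ-≤ (count P g′) (m≤n*m N′ 4)) (rec′ g′ per′ avoid)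
          where
          avoid : Avoids g′ (above j R)
          avoid u x p a q with above-suc j x j<P a
          ... | inj₂ a′ = av′ u x p a′ q
          ... | inj₁ e  = false≢true (trans (sym eq) (trans (sym (perR (≡ᵇ-true⇒≡ (x % P) (j % P) e)))
              (proj₁ (∧-true {R x} a))))
      large : ∀ j → j ≤ P → ¬ ¬ Large j
      large zero    _   ¬L = ¬L ((λ _ → true) , (λ _ → refl) ,
          (λ u x _ r _ → false≢true (proj₂ (∧-true {R x} r))) ,
        <-≤-trans (m<m+n P (>-nonZero⁻¹ P))
            (≤-trans (≤-reflexive (trans (cong (λ z → P + z) (sym (+-identityʳ P)))
            (cong (2 *_) (sym (trans (∑-const P 1) (*-identityʳ P))))))
            (*-monoˡ-≤ (count P (λ _ → true)) 2≤N)))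
      large (suc j) j<P ¬L = large j (<⇒≤ j<P) λ Lj → k (suc j)
        (λ g per av → ≮⇒≥ λ big → ¬L (g , per , av , big)) (rest j j<P Lj)

    DisjointParts : ∀ {n} → (ℕ → Bool) → (Fin n → ℕ → Bool) → Set
    DisjointParts R part = (∀ i → Periodic (part i)) × (∀ i → part i ⊆ R) ×
      (∀ i j x → part i x ≡ true → part j x ≡ true → i ≡ j)

    parts : ∀ N n R → 2 ≤ N → Periodic R → (∀ x → R x ≡ true → ¬ x ≈ 0) → Rec (size N n) R →
      (∀ (part : Fin n → ℕ → Bool) → DisjointParts R part → (∀ i → Rec N (part i)) → ⊥) → ⊥
    parts N zero    R 2≤N perR R≉0 rec k = k (λ ()) ((λ ()) , (λ ()) , (λ ())) (λ ())
    parts N (suc n) R 2≤N perR R≉0 rec k = split N (size N n) R 2≤N (1≤size N n 2≤N) perR R≉0 rec λ j rec₁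
        rec₂ →
      parts N n (above j R) 2≤N (λ {x} {y} h → cong₂ _∧_ (perR h) (cong (λ r → not (r <ᵇ j)) h))
          (λ x a → R≉0 x (proj₁ (∧-true {R x} a))) rec₂
        λ part (per , sub , disj) recs → k (extend j part)
          ( extend-∀ j part Periodic (λ h → cong₂ _∧_ (perR h) (cong (_<ᵇ j) h)) per
          , extend-∀ j part (_⊆ R) (λ x e → proj₁ (∧-true {R x} e))
              (λ i x e → proj₁ (∧-true {R x} (sub i x e)))
          , disjoint j part sub disj )
          (extend-∀ j part (Rec N) rec₁ recs)
      where
      extend : ℕ → (Fin n → ℕ → Bool) → Fin (suc n) → ℕ → Bool
      extend j part zero    = below j R
      extend j part (suc i) = part i
      extend-∀ : ∀ j part (Q : (ℕ → Bool) → Set) → Q (below j R) → (∀ i → Q (part i)) → ∀ i → Q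
          (extend j part i)
      extend-∀ j part Q q₀ q zero    = q₀
      extend-∀ j part Q q₀ q (suc i) = q i
      disjoint : ∀ j part → (∀ i → part i ⊆ above j R) → (∀ i i′ x → part i x ≡ true → part i′ x ≡ true →
          i ≡ i′) →
        ∀ i i′ x → extend j part i x ≡ true → extend j part i′ x ≡ true → i ≡ i′
      disjoint j part sub disj zero    zero     x e e′ = refl
      disjoint j part sub disj (suc i) (suc i′) x e e′ = cong suc (disj i i′ x e e′)
      disjoint j part sub disj zero    (suc i′) x e e′ = ⊥-elim
          (not-true⇒¬ (proj₂ (∧-true {R x} (sub i′ x e′))) (proj₂ (∧-true {R x} e)))
      disjoint j part sub disj (suc i) zero     x e e′ = ⊥-elim
          (not-true⇒¬ (proj₂ (∧-true {R x} (sub i x e))) (proj₂ (∧-true {R x} e′)))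

-- Sums of integers

sumFin-cong : ∀ {k} {f g : Fin k → ℤ} → (∀ i → f i ≡ g i) → sumFin f ≡ sumFin g
sumFin-cong {zero}  h = refl
sumFin-cong {suc k} h = cong₂ ℤ._+_ (h zero) (sumFin-cong (h ∘ suc))

sumFin-+ : ∀ {k} (f g : Fin k → ℤ) → sumFin (λ i → f i ℤ.+ g i) ≡ sumFin f ℤ.+ sumFin g
sumFin-+ {zero}  f g = refl
sumFin-+ {suc k} f g = trans (cong (λ t → f zero ℤ.+ g zero ℤ.+ t) (sumFin-+ (f ∘ suc) (g ∘ suc)))
    (eq (f zero) (g zero) _ _)
  where
  eq : ∀ a b c d → a ℤ.+ b ℤ.+ (c ℤ.+ d) ≡ a ℤ.+ c ℤ.+ (b ℤ.+ d)
  eq = ℤR.solve-∀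

sumFin-* : ∀ {k} (f : Fin k → ℤ) a → sumFin (λ i → f i ℤ.* a) ≡ sumFin f ℤ.* a
sumFin-* {zero}  f a = refl
sumFin-* {suc k} f a = trans (cong (λ t → f zero ℤ.* a ℤ.+ t) (sumFin-* (f ∘ suc) a))
    (sym (ℤₚ.*-distribʳ-+ a (f zero) _))

sumFin-zero : ∀ {k} {f : Fin k → ℤ} → (∀ i → f i ≡ + 0) → sumFin f ≡ + 0
sumFin-zero {zero}  h = refl
sumFin-zero {suc k} h = cong₂ ℤ._+_ (h zero) (sumFin-zero (h ∘ suc))

sumFin-delta : ∀ {k} (f : Fin k → ℤ) j → sumFin (λ i → if does (i ≟ j) then f i else + 0) ≡ f j
sumFin-delta {suc k} f zero    = trans (cong (λ t → f zero ℤ.+ t) (sumFin-zero {k} (λ _ → refl)))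
    (ℤₚ.+-identityʳ (f zero))
sumFin-delta {suc k} f (suc j) = trans (ℤₚ.+-identityˡ _) (sumFin-delta (f ∘ suc) j)

restrict : ∀ {k} → (Fin k → Bool) → (Fin k → ℤ) → Fin k → ℤ
restrict σ c i = if σ i then c i else + 0

restrict-inside : ∀ {k} (σ : Fin k → Bool) (c : Fin k → ℤ) i → σ i ≡ true → restrict σ c i ≡ c i
restrict-inside σ c i e = cong (λ b → if b then c i else + 0) e

Balanced : ∀ {k} → (Fin k → ℤ) → (Fin k → ℕ) → Set
Balanced a τ = sumFin (λ i → a i ℤ.* + τ i) ≡ + 0

Balanced-zero : ∀ {k} (a : Fin k → ℤ) → Balanced a (λ _ → 0)
Balanced-zero a = sumFin-zero (λ i → ℤₚ.*-zeroʳ (a i))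

Balanced-closed : ∀ {k} (a : Fin k → ℤ) {τ o} m → Balanced a τ → Balanced a o → Balanced a
    (λ i → τ i + m * o i)
Balanced-closed a {τ} {o} m bτ bo = begin
  sumFin (λ i → a i ℤ.* + (τ i + m * o i))
    ≡⟨ sumFin-cong (λ i → trans (cong (a i ℤ.*_) (trans (ℤₚ.pos-+ (τ i) (m * o i))
        (cong (λ t → + τ i ℤ.+ t) (ℤₚ.pos-* m (o i))))) (eq (a i) (+ τ i) (+ m) (+ o i))) ⟩
  sumFin (λ i → a i ℤ.* + τ i ℤ.+ a i ℤ.* + o i ℤ.* + m)
    ≡⟨ sumFin-+ (λ i → a i ℤ.* + τ i) (λ i → a i ℤ.* + o i ℤ.* + m) ⟩
  sumFin (λ i → a i ℤ.* + τ i) ℤ.+ sumFin (λ i → a i ℤ.* + o i ℤ.* + m)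
    ≡⟨ cong₂ ℤ._+_ bτ (trans (sumFin-* (λ i → a i ℤ.* + o i) (+ m)) (cong (ℤ._* + m) bo)) ⟩
  + 0 ℤ.+ + 0 ℤ.* + m ≡⟨⟩
  + 0 ∎
  where
  open ≡-Reasoning
  eq : ∀ a t m o → a ℤ.* (t ℤ.+ m ℤ.* o) ≡ a ℤ.* t ℤ.+ a ℤ.* o ℤ.* m
  eq = ℤR.solve-∀

<⇒+suc : ∀ {x y} → x ℤ.< y → ∃ λ n → y ≡ x ℤ.+ + suc n
<⇒+suc {x} {y} x<y with y ℤ.- ℤ.suc x in eq | ℤₚ.i≤j⇒0≤j-i (ℤₚ.i<j⇒suc[i]≤j x<y)
... | + n | _ = n , trans (lemma x y) (trans (cong (ℤ._+ (+ 1 ℤ.+ x)) eq) (lemma′ x (+ n)))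
  where
  lemma : ∀ x y → y ≡ y ℤ.- (+ 1 ℤ.+ x) ℤ.+ (+ 1 ℤ.+ x)
  lemma = ℤR.solve-∀
  lemma′ : ∀ x n → n ℤ.+ (+ 1 ℤ.+ x) ≡ x ℤ.+ (+ 1 ℤ.+ n)
  lemma′ = ℤR.solve-∀

OneOf : ℤ → ℕ → ℕ → ℤ → Set
OneOf m α′ β′ t = t ≡ m ⊎ (t ≡ m ℤ.+ + suc α′ ⊎ t ≡ m ℤ.+ + (suc α′ + suc β′))

sorted3 : ∀ {x y z} → x ℤ.< y → y ℤ.< z → ∃ λ m → ∃ λ α′ → ∃ λ β′ → OneOf m α′ β′ x × OneOf m α′ β′ y
    × OneOf m α′ β′ z
sorted3 {x} x<y y<z with <⇒+suc x<y | <⇒+suc y<z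
... | α′ , refl | β′ , refl = x , α′ , β′ , inj₁ refl , inj₂ (inj₁ refl) ,
  inj₂ (inj₂ (trans (ℤₚ.+-assoc x _ _) (cong (λ t → x ℤ.+ t) (sym (ℤₚ.pos-+ (suc α′) (suc β′))))))

≢⇒<⊎> : ∀ {x y} → ¬ x ≡ y → x ℤ.< y ⊎ y ℤ.< x
≢⇒<⊎> {x} {y} x≢y with ℤₚ.<-cmp x y
... | tri< x<y _ _ = inj₁ x<y
... | tri≈ _ x≡y _ = ⊥-elim (x≢y x≡y)
... | tri> _ _ y<x = inj₂ y<x

sort3 : ∀ x y z → ¬ x ≡ y → ¬ x ≡ z → ¬ y ≡ z → ∃ λ m → ∃ λ α′ → ∃ λ β′ → OneOf m α′ β′ x × OneOf m α′ β′ y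
    × OneOf m α′ β′ z
sort3 x y z x≢y x≢z y≢z with ≢⇒<⊎> x≢y | ≢⇒<⊎> y≢z | ≢⇒<⊎> x≢z
... | inj₁ x<y | inj₁ y<z | _        = sorted3 x<y y<z
... | inj₁ x<y | inj₂ z<y | inj₁ x<z = let m , a , b , p , q , r = sorted3 x<z z<y in m , a , b , p , r , q
... | inj₁ x<y | inj₂ z<y | inj₂ z<x = let m , a , b , p , q , r = sorted3 z<x x<y in m , a , b , q , r , p
... | inj₂ y<x | inj₁ y<z | inj₁ x<z = let m , a , b , p , q , r = sorted3 y<x x<z in m , a , b , q , p , r
... | inj₂ y<x | inj₁ y<z | inj₂ z<x = let m , a , b , p , q , r = sorted3 y<z z<x in m , a , b , r , p , q
... | inj₂ y<x | inj₂ z<y | _        = let m , a , b , p , q , r = sorted3 z<y y<x in m , a , b , r , q , p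

offset : ∀ {m α′ β′ t} → OneOf m α′ β′ t → ∃ λ (o : ℕ) → (o ≡ 0 ⊎ (o ≡ suc α′ ⊎ o ≡ suc α′ + suc β′))
    × t ≡ m ℤ.+ + o
offset {m} (inj₁ refl)                 = 0 , inj₁ refl , sym (ℤₚ.+-identityʳ m)
offset {α′ = α′} (inj₂ (inj₁ e))       = suc α′ , inj₂ (inj₁ refl) , e
offset {α′ = α′} {β′} (inj₂ (inj₂ e))  = suc α′ + suc β′ , inj₂ (inj₂ refl) , e

-- The integer solution (c q at r, −c r at q, 0 elsewhere) separates r from
-- every other index.
separating-offset : ∀ {k} (σ : Fin k → Bool) (c : Fin k → ℤ) → (∀ i → ¬ c i ≡ + 0) → sumFin
    (restrict σ c) ≡ + 0 →
  ∀ r q → σ r ≡ true → σ q ≡ true → ¬ q ≡ r → ¬ c r ℤ.+ c q ≡ + 0 →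
  ∃ λ o → ThreeValued o × Balanced (restrict σ c) o × (∀ j → o r ≡ o j → r ≡ j)
separating-offset {k} σ c c≢0 Σσ≡0 r q σr σq q≢r r+q≢0 = o ,
    (α′ , β′ , λ i → proj₁ (proj₂ (offset (oneOf i)))) , balanced , separates
  where
  val : Fin k → ℤ
  val i = if does (i ≟ r) then c q else (if does (i ≟ q) then ℤ.- c r else + 0)
  three = sort3 (c q) (ℤ.- c r) (+ 0) (λ e → r+q≢0 (trans (cong (λ z → c r ℤ.+ z) e) (ℤₚ.+-inverseʳ (c r))))
      (c≢0 q)
    (λ e → c≢0 r (trans (sym (ℤₚ.neg-involutive (c r))) (cong ℤ.-_ e)))
  m = proj₁ three
  α′ = proj₁ (proj₂ three)
  β′ = proj₁ (proj₂ (proj₂ three))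
  oneOf : ∀ i → OneOf m α′ β′ (val i)
  oneOf i with does (i ≟ r) | does (i ≟ q)
  ... | true  | _     = proj₁ (proj₂ (proj₂ (proj₂ three)))
  ... | false | true  = proj₁ (proj₂ (proj₂ (proj₂ (proj₂ three))))
  ... | false | false = proj₂ (proj₂ (proj₂ (proj₂ (proj₂ three))))
  o : Fin k → ℕ
  o i = proj₁ (offset (oneOf i))
  val≡ : ∀ i → val i ≡ m ℤ.+ + o i
  val≡ i = proj₂ (proj₂ (offset (oneOf i)))
  a : Fin k → ℤ
  a = restrict σ c
  δ : Fin k → ℤ → Fin k → ℤ
  δ j z i = if does (i ≟ j) then a i ℤ.* z else + 0
  val-r : val r ≡ c q
  val-r = cong (λ b → if b then c q else (if does (r ≟ q) then ℤ.- c r else + 0)) (dec-true (r ≟ r) refl)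
  -- The coefficients on σ sum to zero, so subtracting m from all entries preserves the equation and
  -- makes them natural numbers.
  pointwise : ∀ i → a i ℤ.* + o i ≡ (δ r (c q) i ℤ.+ δ q (ℤ.- c r) i) ℤ.+ a i ℤ.* (ℤ.- m)
  pointwise i = trans (eq (a i) m (+ o i))
      (cong (ℤ._+ a i ℤ.* (ℤ.- m)) (trans (cong (a i ℤ.*_) (sym (val≡ i))) (by-cases (i ≟ r) (i ≟ q))))
    where
    eq : ∀ a m o → a ℤ.* o ≡ a ℤ.* (m ℤ.+ o) ℤ.+ a ℤ.* (ℤ.- m)
    eq = ℤR.solve-∀
    by-cases : (d : Dec (i ≡ r)) (d′ : Dec (i ≡ q)) →
      a i ℤ.* (if does d then c q else (if does d′ then ℤ.- c r else + 0)) ≡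
      (if does d then a i ℤ.* c q else + 0) ℤ.+ (if does d′ then a i ℤ.* (ℤ.- c r) else + 0)
    by-cases (yes i≡r) (yes i≡q) = ⊥-elim (q≢r (trans (sym i≡q) i≡r))
    by-cases (yes i≡r) (no _)    = sym (ℤₚ.+-identityʳ _)
    by-cases (no _)    (yes _)   = sym (ℤₚ.+-identityˡ _)
    by-cases (no _)    (no _)    = ℤₚ.*-zeroʳ (a i)
  balanced : Balanced a o
  balanced = begin
    sumFin (λ i → a i ℤ.* + o i) ≡⟨ sumFin-cong pointwise ⟩
    sumFin (λ i → (δ r (c q) i ℤ.+ δ q (ℤ.- c r) i) ℤ.+ a i ℤ.* (ℤ.- m))
      ≡⟨ trans (sumFin-+ (λ i → δ r (c q) i ℤ.+ δ q (ℤ.- c r) i) (λ i → a i ℤ.* (ℤ.- m)))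
          (cong (ℤ._+ sumFin (λ i → a i ℤ.* (ℤ.- m))) (sumFin-+ (δ r (c q)) (δ q (ℤ.- c r)))) ⟩
    (sumFin (δ r (c q)) ℤ.+ sumFin (δ q (ℤ.- c r))) ℤ.+ sumFin (λ i → a i ℤ.* (ℤ.- m))
      ≡⟨ cong₂ ℤ._+_ (cong₂ ℤ._+_ (trans (sumFin-delta (λ i → a i ℤ.* c q) r)
          (cong (ℤ._* c q) (restrict-inside σ c r σr)))
           (trans (sumFin-delta (λ i → a i ℤ.* (ℤ.- c r)) q)
               (cong (ℤ._* (ℤ.- c r)) (restrict-inside σ c q σq))))
           (trans (sumFin-* a (ℤ.- m)) (cong (ℤ._* (ℤ.- m)) Σσ≡0)) ⟩
    (c r ℤ.* c q ℤ.+ c q ℤ.* (ℤ.- c r)) ℤ.+ + 0 ℤ.* (ℤ.- m) ≡⟨ eq (c r) (c q) m ⟩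
    + 0 ∎
    where
    open ≡-Reasoning
    eq : ∀ x y m → (x ℤ.* y ℤ.+ y ℤ.* (ℤ.- x)) ℤ.+ + 0 ℤ.* (ℤ.- m) ≡ + 0
    eq = ℤR.solve-∀
  separates : ∀ j → o r ≡ o j → r ≡ j
  separates j e with j ≟ r | trans (sym val-r) (trans (val≡ r) (trans (cong (λ t → m ℤ.+ + t) e) (sym (val≡ j))))
  ... | yes j≡r | _ = sym j≡r
  ... | no _    | h with j ≟ q
  ...   | yes _ = ⊥-elim (r+q≢0 (trans (cong (λ z → c r ℤ.+ z) h) (ℤₚ.+-inverseʳ (c r))))
  ...   | no _  = ⊥-elim (c≢0 q h)

-- Integers modulo P

module Congruence (P : ℕ) {{nz : NonZero P}} where
  open Mod P

  infix 4 _≅_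
  -- A data type rather than an existential, so that both sides can be inferred from the type of a
  -- proof.
  data _≅_ (a b : ℤ) : Set where
    by : ∀ q → a ≡ b ℤ.+ q ℤ.* + P → a ≅ b

  ≡⇒≅ : ∀ {a b} → a ≡ b → a ≅ b
  ≡⇒≅ {a} refl = by (+ 0) ( sym (ℤₚ.+-identityʳ a))

  ≅-sym : ∀ {a b} → a ≅ b → b ≅ a
  ≅-sym {a} {b} (by q refl) = by (ℤ.- q) (eq b q (+ P))
    where
    eq : ∀ b q P → b ≡ b ℤ.+ q ℤ.* P ℤ.+ (ℤ.- q) ℤ.* P
    eq = ℤR.solve-∀

  ≅-trans : ∀ {a b c} → a ≅ b → b ≅ c → a ≅ c
  ≅-trans {c = c} (by q refl) (by r refl) = by (r ℤ.+ q) (eq c q r (+ P))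
    where
    eq : ∀ c q r P → c ℤ.+ r ℤ.* P ℤ.+ q ℤ.* P ≡ c ℤ.+ (r ℤ.+ q) ℤ.* P
    eq = ℤR.solve-∀

  ≅-+ : ∀ {a b c d} → a ≅ b → c ≅ d → a ℤ.+ c ≅ b ℤ.+ d
  ≅-+ {b = b} {d = d} (by q refl) (by r refl) = by (q ℤ.+ r) (eq b d q r (+ P))
    where
    eq : ∀ b d q r P → b ℤ.+ q ℤ.* P ℤ.+ (d ℤ.+ r ℤ.* P) ≡ b ℤ.+ d ℤ.+ (q ℤ.+ r) ℤ.* P
    eq = ℤR.solve-∀

  ≅-* : ∀ a {b c} → b ≅ c → a ℤ.* b ≅ a ℤ.* c
  ≅-* a {c = c} (by q refl) = by (a ℤ.* q) (eq a c q (+ P))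
    where
    eq : ∀ a c q P → a ℤ.* (c ℤ.+ q ℤ.* P) ≡ a ℤ.* c ℤ.+ a ℤ.* q ℤ.* P
    eq = ℤR.solve-∀

  sumFin-≅ : ∀ {k} {f g : Fin k → ℤ} → (∀ i → f i ≅ g i) → sumFin f ≅ sumFin g
  sumFin-≅ {zero}  h = ≡⇒≅ refl
  sumFin-≅ {suc k} h = ≅-+ (h zero) (sumFin-≅ (h ∘ suc))

  +%≅ : ∀ x → + x ≅ + (x % P)
  +%≅ x = by (+ (x / P)) (trans (cong +_ (m≡m%n+[m/n]*n x P))
      (trans (ℤₚ.pos-+ (x % P) _) (cong (λ t → + (x % P) ℤ.+ t) (ℤₚ.pos-* (x / P) P))))

  ≈⇒≅ : ∀ {x y} → x ≈ y → + x ≅ + y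
  ≈⇒≅ {x} {y} h = ≅-trans (+%≅ x) (≅-trans (≡⇒≅ (cong +_ h)) (≅-sym (+%≅ y)))

  ≅⇒≈ : ∀ {x y} → + x ≅ + y → x ≈ y
  ≅⇒≈ {x} {y} (by (+ n) e) =
      trans (cong (_% P) (ℤₚ.+-injective
      (trans e (sym (trans (ℤₚ.pos-+ y (n * P)) (cong (λ t → + y ℤ.+ t) (ℤₚ.pos-* n P)))))))
      (+-multiple-≈ y n)
  ≅⇒≈ {x} {y} (by -[1+ n ] e) =
      sym (≅⇒≈ {y} {x} (by (+ suc n) (trans (eq (+ y) -[1+ n ] (+ P))
      (cong (ℤ._+ + suc n ℤ.* + P) (sym e)))))
    where
    eq : ∀ y q P → y ≡ y ℤ.+ q ℤ.* P ℤ.+ (ℤ.- q) ℤ.* P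
    eq = ℤR.solve-∀

  ∣⇒≅0 : ∀ {z} → + P ℤU.∣ z → z ≅ + 0
  ∣⇒≅0 h with ℤS.∣ᵤ⇒∣ h
  ... | ℤS.divides q e = by q (trans e (sym (ℤₚ.+-identityˡ _)))

  ≅0⇒∣ : ∀ {z} → z ≅ + 0 → + P ℤU.∣ z
  ≅0⇒∣ (by q e) = ℤS.∣⇒∣ᵤ (ℤS.divides q (trans e (ℤₚ.+-identityˡ _)))

  residue : ℤ → ℕ
  residue z = z ℤ.%ℕ P

  residue-≅ : ∀ z → z ≅ + residue z
  residue-≅ z = by (z ℤ./ℕ P) (ℤ.a≡a%ℕn+[a/ℕn]*n z P)

  residue≉0 : ∀ z → ¬ z ≡ + 0 → ℤ.∣ z ∣ < P → ¬ residue z ≈ 0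
  residue≉0 z z≢0 small h = <⇒≱ small (∣⇒≤ {{≢-nonZero (λ e → z≢0 (ℤₚ.∣i∣≡0⇒i≡0 e))}}
      (≅0⇒∣ (≅-trans (residue-≅ z) (≈⇒≅ h))))

  displacement-≅ : ∀ {n} c₀ (c : Fin n → ℤ) act l x → (∀ i → c₀ ℤ.* + l i ≅ ℤ.- c i) →
    c₀ ℤ.* + Recurrence.displacement P act l x ≅ ℤ.- sumFin (λ i → restrict act c i ℤ.* + x i)
  displacement-≅ {zero}  c₀ c act l x h = ≡⇒≅ (ℤₚ.*-zeroʳ c₀)
  displacement-≅ {suc n} c₀ c act l x h = by-cases (act zero) (displacement-≅ c₀ (c ∘ suc) (act ∘ suc)
      (l ∘ suc) (x ∘ suc) (h ∘ suc))
    where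
    D = Recurrence.displacement P (act ∘ suc) (l ∘ suc) (x ∘ suc)
    S = sumFin (λ i → restrict (act ∘ suc) (c ∘ suc) i ℤ.* + x (suc i))
    by-cases : ∀ b → c₀ ℤ.* + D ≅ ℤ.- S →
      c₀ ℤ.* + ((if b then l zero * x zero else 0) + D) ≅ ℤ.-
          ((if b then c zero else + 0) ℤ.* + x zero ℤ.+ S)
    by-cases true ih = ≅-trans
        (≡⇒≅ (trans (cong (c₀ ℤ.*_) (trans (ℤₚ.pos-+ (l zero * x zero) D)
        (cong (ℤ._+ + D) (ℤₚ.pos-* (l zero) (x zero))))) (eq₁ c₀ (+ l zero) (+ x zero) (+ D))))
      (≅-trans (≅-+ (≅-* (+ x zero) (h zero)) ih) (≡⇒≅ (eq₂ (+ x zero) (c zero) S)))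
      where
      eq₁ : ∀ c l x D → c ℤ.* (l ℤ.* x ℤ.+ D) ≡ x ℤ.* (c ℤ.* l) ℤ.+ c ℤ.* D
      eq₁ = ℤR.solve-∀
      eq₂ : ∀ x c S → x ℤ.* (ℤ.- c) ℤ.+ (ℤ.- S) ≡ ℤ.- (c ℤ.* x ℤ.+ S)
      eq₂ = ℤR.solve-∀
    by-cases false ih = ≅-trans ih (≡⇒≅ (cong ℤ.-_ (eq (+ x zero) S)))
      where
      eq : ∀ x S → S ≡ + 0 ℤ.* x ℤ.+ S
      eq = ℤR.solve-∀

  solution : ∀ {k} → (Fin k → Bool) → Fin k → ℕ → ℕ → (Fin k → ℕ) → (Fin k → ℕ) → Fin k → ℕ
  solution σ s₀ u w τ x i = if σ i then u + τ i + (if does (i ≟ s₀) then w else 0) else x i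

  -- On σ the translation u disappears because the coefficients sum to zero, and τ because it is
  -- balanced. What remains is the shift w at s₀, chosen to cancel the entries outside σ.
  solution-solves : ∀ {k} (c : Fin k → ℤ) σ s₀ u w τ x → σ s₀ ≡ true → sumFin (restrict σ c) ≡ + 0 →
      Balanced (restrict σ c) τ →
    c s₀ ℤ.* + w ≅ ℤ.- sumFin (λ i → restrict (not ∘ σ) c i ℤ.* + x i) →
    sumFin (λ i → c i ℤ.* + solution σ s₀ u w τ x i) ≅ + 0
  solution-solves c σ s₀ u w τ x σs₀ Σσ≡0 bal h = ≅-trans (≡⇒≅ sum≡)
    (≅-trans (≅-+ (≡⇒≅ (refl {x = + 0})) (≅-+ h (≡⇒≅ (refl {x = N})))) (≡⇒≅ (eq N)))
    where
    a = restrict σ c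
    N = sumFin (λ i → restrict (not ∘ σ) c i ℤ.* + x i)
    δ : _ → ℤ
    δ i = if does (i ≟ s₀) then a i ℤ.* + w else + 0
    eq : ∀ N → + 0 ℤ.+ (ℤ.- N ℤ.+ N) ≡ + 0
    eq = ℤR.solve-∀
    pointwise : ∀ i → c i ℤ.* + solution σ s₀ u w τ x i ≡ (a i ℤ.* + u ℤ.+ a i ℤ.* + τ i)
        ℤ.+ (δ i ℤ.+ restrict (not ∘ σ) c i ℤ.* + x i)
    pointwise i with σ i | does (i ≟ s₀)
    ... | true  | true  = trans (cong (c i ℤ.*_)
        (trans (ℤₚ.pos-+ (u + τ i) w) (cong (ℤ._+ + w) (ℤₚ.pos-+ u (τ i))))) (eq′ (c i) (+ u) (+ τ i) (+ w)
        (+ x i))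
      where
      eq′ : ∀ c u t w x → c ℤ.* (u ℤ.+ t ℤ.+ w) ≡ c ℤ.* u ℤ.+ c ℤ.* t ℤ.+ (c ℤ.* w ℤ.+ + 0 ℤ.* x)
      eq′ = ℤR.solve-∀
    ... | true  | false = trans (cong (c i ℤ.*_)
        (trans (ℤₚ.pos-+ (u + τ i) 0) (cong (ℤ._+ + 0) (ℤₚ.pos-+ u (τ i)))))
        (eq′ (c i) (+ u) (+ τ i) (+ x i))
      where
      eq′ : ∀ c u t x → c ℤ.* (u ℤ.+ t ℤ.+ + 0) ≡ c ℤ.* u ℤ.+ c ℤ.* t ℤ.+ (+ 0 ℤ.+ + 0 ℤ.* x)
      eq′ = ℤR.solve-∀
    ... | false | true  = eq′ (c i) (+ u) (+ τ i) (+ w) (+ x i)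
      where
      eq′ : ∀ c u t w x → c ℤ.* x ≡ + 0 ℤ.* u ℤ.+ + 0 ℤ.* t ℤ.+ (+ 0 ℤ.* w ℤ.+ c ℤ.* x)
      eq′ = ℤR.solve-∀
    ... | false | false = eq′ (c i) (+ u) (+ τ i) (+ x i)
      where
      eq′ : ∀ c u t x → c ℤ.* x ≡ + 0 ℤ.* u ℤ.+ + 0 ℤ.* t ℤ.+ (+ 0 ℤ.+ c ℤ.* x)
      eq′ = ℤR.solve-∀
    sum≡ : sumFin (λ i → c i ℤ.* + solution σ s₀ u w τ x i) ≡ + 0 ℤ.+ (c s₀ ℤ.* + w ℤ.+ N)
    sum≡ = begin
      sumFin (λ i → c i ℤ.* + solution σ s₀ u w τ x i)
        ≡⟨ trans (sumFin-cong pointwise) (sumFin-+ (λ i → a i ℤ.* + u ℤ.+ a i ℤ.* + τ i)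
            (λ i → δ i ℤ.+ restrict (not ∘ σ) c i ℤ.* + x i)) ⟩
      sumFin (λ i → a i ℤ.* + u ℤ.+ a i ℤ.* + τ i) ℤ.+ sumFin (λ i → δ i ℤ.+ restrict (not ∘ σ) c i ℤ.* + x
          i)
        ≡⟨ cong₂ ℤ._+_ (sumFin-+ (λ i → a i ℤ.* + u) (λ i → a i ℤ.* + τ i))
            (sumFin-+ δ (λ i → restrict (not ∘ σ) c i ℤ.* + x i)) ⟩
      (sumFin (λ i → a i ℤ.* + u) ℤ.+ sumFin (λ i → a i ℤ.* + τ i)) ℤ.+ (sumFin δ ℤ.+ N)
        ≡⟨ cong₂ (λ s t → s ℤ.+ (t ℤ.+ N)) (cong₂ ℤ._+_ (trans (sumFin-* a (+ u)) (cong (ℤ._* + u) Σσ≡0))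
            bal)
             (trans (sumFin-delta (λ i → a i ℤ.* + w) s₀) (cong (ℤ._* + w) (restrict-inside σ c s₀ σs₀))) ⟩
      (+ 0 ℤ.* + u ℤ.+ + 0) ℤ.+ (c s₀ ℤ.* + w ℤ.+ N) ≡⟨⟩
      + 0 ℤ.+ (c s₀ ℤ.* + w ℤ.+ N) ∎
      where open ≡-Reasoning

  module Units (prime : Prime P) where

    inverse : ∀ x → ¬ x ≈ 0 → ∃ λ m → x * m ≈ 1
    inverse x x≉0 with coprime-Bézout (prime⇒coprime prime {{≢-nonZero (λ e → x≉0 (trans e (sym (m<n⇒m%n≡m (>-nonZero⁻¹ P)))))}} (m%n<n x P))
    ... | Bézout.-+ s t e = t , trans (*-≈ {x} {x % P} {t} (sym (%-≈ x)) refl)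
        (trans (cong (_% P) (trans (*-comm (x % P) t) (sym e))) (+-multiple-≈ 1 s))
    -- Here t * x is -1 modulo P, and P ∸ 1 supplies the missing sign.
    ... | Bézout.+- s t e = (P ∸ 1) * t , trans (*-≈ {x} {x % P} {(P ∸ 1) * t} (sym (%-≈ x)) refl)
        (+-cancelˡ-≈ (t * (x % P)) {(x % P) * ((P ∸ 1) * t)} {1}
      (trans (cong (_% P) (trans (eq t (x % P) (P ∸ 1)) (cong (λ z → 0 + t * (x % P) * z)
          (m+[n∸m]≡n (>-nonZero⁻¹ P)))))
        (trans (+-multiple-≈ 0 (t * (x % P))) (trans (sym (+-multiple-≈ 0 s))
            (cong (_% P) (trans (sym e) (+-comm 1 _)))))))
      where
      eq : ∀ t r q → t * r + r * (q * t) ≡ 0 + t * r * (1 + q)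
      eq = solve-∀

    ratio : ∀ a b → ¬ a ≡ + 0 → ¬ b ≡ + 0 → ℤ.∣ a ∣ < P → ℤ.∣ b ∣ < P → ∃ λ l →
        (∃ λ m → l * m ≈ 1) × a ℤ.* + l ≅ b
    ratio a b a≢0 b≢0 a<P b<P with inverse (residue a) (residue≉0 a a≢0 a<P) | inverse (residue b) (residue≉0 b b≢0 b<P)
    ... | m , inv | n , inv′ = rb * m , (n * ra , trans (cong (_% P) (eq rb m n ra)) (*-≈ inv inv′)) ,
      ≅-trans (≅-trans (≡⇒≅ (ℤₚ.*-comm a _)) (≅-trans (≅-* (+ (rb * m)) (residue-≅ a))
          (≡⇒≅ (sym (ℤₚ.pos-* (rb * m) ra)))))
        (≅-trans (≈⇒≅ {rb * m * ra} {rb} (trans (cong (_% P) (eq′ rb m ra))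
            (trans (*-≈ {rb} refl inv) (cong (_% P) (*-identityʳ rb))))) (≅-sym (residue-≅ b)))
      where
      ra = residue a
      rb = residue b
      eq : ∀ b m n a → b * m * (n * a) ≡ a * m * (b * n)
      eq = solve-∀
      eq′ : ∀ b m a → b * m * a ≡ b * (a * m)
      eq′ = solve-∀

-- Building a solution inside A

toℕ-mod : ∀ P {{_ : NonZero P}} x → toℕ (x mod P) ≡ x % P
toℕ-mod P x = toℕ-fromℕ< (m%n<n x P)

members : ∀ P {{_ : NonZero P}} → Subset P → ℕ → Bool
members P A x = lookup A (x mod P)

Periodic-members : ∀ P {{_ : NonZero P}} A → Mod.Periodic P (members P A)
Periodic-members P A {x} {y} h =
  cong (lookup A) (toℕ-injective (trans (toℕ-mod P x) (trans h (sym (toℕ-mod P y)))))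

module Endgame {k : ℕ} (c : Fin k → ℤ) (c≢0 : ∀ i → ¬ c i ≡ + 0) (P : ℕ) {{nz : NonZero P}} (A : Subset P)
               (free : SolutionFree c P A) where
  open Mod P
  open Congruence P
  open Recurrence P

  no-solution : ∀ (a : Fin k → ℕ) → (∀ i → members P A (a i) ≡ true) → (∀ i j → a i ≈ a j → i ≡ j) →
    sumFin (λ i → c i ℤ.* + a i) ≅ + 0 → ⊥
  no-solution a mem inj sol = free (λ i → a i mod P)
    (λ {i} {j} e → inj i j (trans (sym (toℕ-mod P (a i))) (trans (cong toℕ e) (toℕ-mod P (a j)))))
    (λ i → lookup⇒[]= (a i mod P) A (mem i))
    (≅0⇒∣ (≅-trans (sumFin-≅ (λ i → ≅-* (c i) (≅-trans (≡⇒≅ (cong +_ (toℕ-mod P (a i))))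
        (≅-sym (+%≅ (a i)))))) sol))

  module _ (σ : Fin k → Bool) (s₀ : Fin k) (σs₀ : σ s₀ ≡ true) (Σσ≡0 : sumFin (restrict σ c) ≡ + 0)
           (τ : Fin k → ℕ) (bal : Balanced (restrict σ c) τ) (τ<P : ∀ i → τ i < P) where

    no-translate : (∀ i → σ i ≡ true) → (∀ i j → τ i ≡ τ j → i ≡ j) → ∀ u →
        (∀ i → members P A (u + τ i) ≡ true) → ⊥
    no-translate all-σ inj u mem = no-solution ã (λ i → trans (cong (members P A) (ã≡ i)) (mem i))
      (λ i j h → inj i j (≈⇒≡ (τ<P i) (τ<P j)
          (+-cancelˡ-≈ u (trans (cong (_% P) (sym (ã≡ i))) (trans h (cong (_% P) (ã≡ j)))))))
      (solution-solves c σ s₀ u 0 τ (λ _ → 0) σs₀ Σσ≡0 bal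
        (≡⇒≅ (trans (ℤₚ.*-zeroʳ (c s₀))
            (cong ℤ.-_ (sym (sumFin-zero (λ i → ℤₚ.*-zeroʳ (restrict (not ∘ σ) c i))))))))
      where
      ã : Fin k → ℕ
      ã = solution σ s₀ u 0 τ (λ _ → 0)
      ã≡ : ∀ i → ã i ≡ u + τ i
      ã≡ i = trans (cong (λ b → if b then u + τ i + (if does (i ≟ s₀) then 0 else 0) else 0) (all-σ i))
          (by-cases (does (i ≟ s₀)))
        where
        by-cases : ∀ b → u + τ i + (if b then 0 else 0) ≡ u + τ i
        by-cases true  = +-identityʳ _
        by-cases false = +-identityʳ _

    -- The hypotheses make the entries distinct: `sep` handles the indices of σ other than s₀,
    -- `disjoint` keeps entries on σ apart from those outside, and the disjointness of `fam` keeps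
    -- the latter apart from each other. Only s₀ remains, and the choice of the last step takes care
    -- of it.
    module _ (l : Fin k → ℕ) (l-inverse : ∀ i → ∃ λ m → l i * m ≈ 1)
        (l-ratio : ∀ i → c s₀ ℤ.* + l i ≅ ℤ.- c i)
             (i₀ : Fin k) (σi₀ : σ i₀ ≡ false)
             (sep : ∀ i j → σ i ≡ true → σ j ≡ true → ¬ i ≡ s₀ → ¬ j ≡ s₀ → τ i ≡ τ j → i ≡ j)
             (A₀ R I : ℕ → Bool) (A₀⊆ : A₀ ⊆ members P A) (R⊆ : R ⊆ members P A) (perA₀ : Periodic A₀)
             (disjoint : ∀ x → A₀ x ≡ true → R x ≡ true → ⊥)
             (perI : Periodic I) (I-shifts : ∀ u → I u ≡ true → ∀ i → A₀ (u + τ i) ≡ true)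
             (fam : Fin (k * suc k) → ℕ → Bool) (dp : (∀ i → Periodic (fam i)) × (∀ i → fam i ⊆ R) ×
                (∀ i j x → fam i x ≡ true → fam j x ≡ true → i ≡ j))
             {N : ℕ} (recs : ∀ i → Rec N (fam i)) (large : suc k * P + k * (suc k * P) < N * count P I) where

      K = suc k

      part : Fin k → Fin K → ℕ → Bool
      part i j = fam (combine i j)

      -- The step for i₀ is postponed to the end of the walk, where all suc k of its parts offer a
      -- step into I and one of them can be chosen.
      act : Fin k → Bool
      act i = not (σ i) ∧ not (does (i ≟ i₀))

      base C : ℕ → Bool
      base = stage (l i₀) I K (part i₀)
      C = chain base k K act l part

      perBase : Periodic base
      perBase = Periodic-stage {l i₀} {I} K {part i₀} perI

      C-nonempty : 1 ≤ count P C
      C-nonempty = ≮⇒≥ λ empty → <⇒≱ large (begin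
        N * count P I                             ≤⟨ count-stage {N} {l i₀} {proj₁ (l-inverse i₀)} {I} K
            (part i₀) perI (λ j → proj₁ dp _) (λ j → recs _) (proj₂ (l-inverse i₀)) ⟩
        N * count P base + K * P                  ≤⟨ +-monoˡ-≤ (K * P)
            (count-chain {N} {base} k K act l part perBase (λ i j → proj₁ dp _) (λ i j → recs _) l-inverse)
            ⟩
        N * count P C + k * (K * P) + K * P       ≡⟨ cong (λ z → N * z + k * (K * P) + K * P)
            (n≤0⇒n≡0 (≤-pred empty)) ⟩
        N * 0 + k * (K * P) + K * P               ≡⟨ cong (λ z → z + k * (K * P) + K * P) (*-zeroʳ N) ⟩
        k * (K * P) + K * P                       ≡⟨ +-comm (k * (K * P)) (K * P) ⟩
        K * P + k * (K * P)                       ∎)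
        where open ≤-Reasoning

      module Walk (u : ℕ) (Iu : I u ≡ true) (x : Fin k → ℕ) (x∈ : ∀ i → act i ≡ true → part i zero
          (x i) ≡ true)
                  (steps : ∀ j → ∃ λ y → part i₀ j y ≡ true × I (u + displacement act l x + l i₀ * y) ≡ true) where
        D = displacement act l x
        y : Fin K → ℕ
        y j = proj₁ (steps j)
        v : Fin K → ℕ
        v j = u + D + l i₀ * y j

        -- v j + τ s₀ becomes the entry at s₀ if the walk ends with step j; the other entries on σ
        -- are of the form u + τ s.
        Good : Fin K → Set
        Good j = ∀ s → ¬ v j + τ s₀ ≈ u + τ s

        y-injective : ∀ i j → v i ≈ v j → i ≡ j
        y-injective i j h = proj₂ (combine-injective i₀ i i₀ j (proj₂ (proj₂ dp) (combine i₀ i)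
            (combine i₀ j) (y i) (proj₁ (proj₂ (steps i)))
          (trans (proj₁ dp (combine i₀ j) {y i} {y j} (*-cancelˡ-≈ {l i₀} {proj₁ inv}
              (trans (cong (_% P) (*-comm (proj₁ inv) (l i₀))) (proj₂ inv)) (+-cancelˡ-≈ (u + D) h)))
              (proj₁ (proj₂ (steps j))))))
          where inv = l-inverse i₀

        -- The K = k + 1 candidates for the last step outnumber the forbidden values.
        good : ∃ Good
        good with any? {P = Good} (λ j → all? (λ s → ¬? ((v j + τ s₀) % P ≟ℕ (u + τ s) % P)))
        ... | yes g = g
        ... | no ¬g = ⊥-elim (let i , j , i<j , e = pigeonhole (n<1+n k) (proj₁ ∘ bad) in
            <⇒≢ i<j (y-injective i j (cancel i j
                (trans (proj₂ (bad i)) (trans (cong (λ s → (u + τ s) % P) e) (sym (proj₂ (bad j))))))))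
          where
          bad : ∀ j → ∃ λ s → v j + τ s₀ ≈ u + τ s
          bad j with any? (λ s → (v j + τ s₀) % P ≟ℕ (u + τ s) % P)
          ... | yes b = b
          ... | no ¬b = ⊥-elim (¬g (j , λ s h → ¬b (s , h)))
          cancel : ∀ i j → v i + τ s₀ ≈ v j + τ s₀ → v i ≈ v j
          cancel i j h = +-cancelˡ-≈ (τ s₀) (trans (cong (_% P) (+-comm (τ s₀) (v i)))
              (trans h (cong (_% P) (+-comm (v j) (τ s₀)))))

        module _ (j₀ : Fin K) (good-j₀ : Good j₀) where
          w : ℕ
          w = D + l i₀ * y j₀
          x′ : Fin k → ℕ
          x′ i = if does (i ≟ i₀) then y j₀ else x i
          ã : Fin k → ℕ
          ã = solution σ s₀ u w τ x′

          w-equation : c s₀ ℤ.* + w ≅ ℤ.- sumFin (λ i → restrict (not ∘ σ) c i ℤ.* + x′ i)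
          w-equation = ≅-trans (≡⇒≅ (trans
              (cong (c s₀ ℤ.*_) (trans (ℤₚ.pos-+ D _) (cong (λ t → + D ℤ.+ t) (ℤₚ.pos-* (l i₀) (y j₀)))))
              (eq₁ (c s₀) (+ D) (+ l i₀) (+ y j₀))))
            (≅-trans (≅-+ (displacement-≅ (c s₀) c act l x l-ratio) (≅-* (+ y j₀) (l-ratio i₀)))
              (≡⇒≅ (trans (eq₂ (sumFin (λ i → restrict act c i ℤ.* + x i)) (c i₀) (+ y j₀))
                  (cong ℤ.-_ (sym sum≡)))))
            where
            eq₁ : ∀ c D l y → c ℤ.* (D ℤ.+ l ℤ.* y) ≡ c ℤ.* D ℤ.+ y ℤ.* (c ℤ.* l)
            eq₁ = ℤR.solve-∀
            eq₂ : ∀ S c y → ℤ.- S ℤ.+ y ℤ.* (ℤ.- c) ≡ ℤ.- (S ℤ.+ c ℤ.* y)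
            eq₂ = ℤR.solve-∀
            pointwise : ∀ i → restrict (not ∘ σ) c i ℤ.* + x′ i ≡ restrict act c i ℤ.* + x i
                ℤ.+ (if does (i ≟ i₀) then c i ℤ.* + y j₀ else + 0)
            pointwise i = by-cases (σ i) (i ≟ i₀) (λ { refl → σi₀ })
              where
              by-cases : ∀ b (d : Dec (i ≡ i₀)) → (i ≡ i₀ → b ≡ false) →
                (if not b then c i else + 0) ℤ.* + (if does d then y j₀ else x i) ≡
                (if not b ∧ not (does d) then c i else + 0) ℤ.* + x i ℤ.+ (if does d then c i ℤ.* + y j₀
                    else + 0)
              by-cases true  (yes e) f = ⊥-elim (false≢true (sym (f e)))
              by-cases true  (no _)  f = refl
              by-cases false (yes _) f = sym (ℤₚ.+-identityˡ _)
              by-cases false (no _)  f = sym (ℤₚ.+-identityʳ _)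
            sum≡ : sumFin (λ i → restrict (not ∘ σ) c i ℤ.* + x′ i) ≡ sumFin
                (λ i → restrict act c i ℤ.* + x i) ℤ.+ c i₀ ℤ.* + y j₀
            sum≡ = trans (sumFin-cong pointwise)
                (trans (sumFin-+ (λ i → restrict act c i ℤ.* + x i)
                (λ i → if does (i ≟ i₀) then c i ℤ.* + y j₀ else + 0))
              (cong (λ t → sumFin (λ i → restrict act c i ℤ.* + x i) ℤ.+ t)
                  (sumFin-delta (λ i → c i ℤ.* + y j₀) i₀)))

          Iv : I (u + w) ≡ true
          Iv = subst (λ z → I z ≡ true) (+-assoc u D _) (proj₂ (proj₂ (steps j₀)))

          ã-s₀ : ã s₀ ≡ u + w + τ s₀
          ã-s₀ = trans (cong₂ (λ a b → if a then u + τ s₀ + (if b then w else 0) else x′ s₀) σs₀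
              (dec-true (s₀ ≟ s₀) refl)) (eq u (τ s₀) w)
            where
            eq : ∀ a b c → a + b + c ≡ a + c + b
            eq = solve-∀

          ã-inside : ∀ i → σ i ≡ true → ¬ i ≡ s₀ → ã i ≡ u + τ i
          ã-inside i σi i≢s₀ = trans (cong₂ (λ a b → if a then u + τ i + (if b then w else 0) else x′ i) σi
              (dec-false (i ≟ s₀) i≢s₀)) (+-identityʳ _)

          ã∈A₀ : ∀ i → σ i ≡ true → A₀ (ã i) ≡ true
          ã∈A₀ i σi = by-cases (i ≟ s₀)
            where
            by-cases : Dec (i ≡ s₀) → A₀ (ã i) ≡ true
            by-cases (yes e) = subst (λ z → A₀ z ≡ true) (sym (trans (cong ã e) ã-s₀))
                (I-shifts (u + w) Iv s₀)
            by-cases (no ne) = subst (λ z → A₀ z ≡ true) (sym (ã-inside i σi ne)) (I-shifts u Iu i)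

          ã∈part : ∀ i → σ i ≡ false → ∃ λ j → part i j (ã i) ≡ true
          ã∈part i σi = by-cases (i ≟ i₀) refl
            where
            ã≡ : ∀ b → does (i ≟ i₀) ≡ b → ã i ≡ (if b then y j₀ else x i)
            ã≡ b e = cong₂ (λ a b → if a then u + τ i + (if does (i ≟ s₀) then w else 0) else
                (if b then y j₀ else x i)) σi e
            by-cases : (d : Dec (i ≡ i₀)) → does (i ≟ i₀) ≡ does d → ∃ λ j → part i j (ã i) ≡ true
            by-cases (yes i≡) e = j₀ , trans (cong (part i j₀) (ã≡ true e))
                (subst (λ i → part i j₀ (y j₀) ≡ true) (sym i≡) (proj₁ (proj₂ (steps j₀))))
            by-cases (no _)   e = zero , trans (cong (part i zero) (ã≡ false e))
                (x∈ i (cong₂ (λ a b → not a ∧ not b) σi e))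

          injective : ∀ i j → ã i ≈ ã j → i ≡ j
          injective i j h = by-cases (σ i) (σ j) refl refl
            where
            last : ∀ i j → i ≡ s₀ → σ j ≡ true → ¬ j ≡ s₀ → ã i ≈ ã j → ⊥
            last i j i≡ σj j≢ h = good-j₀ j
                (trans (cong (_% P) (trans (cong (_+ τ s₀) (+-assoc u D _)) (sym (trans (cong ã i≡) ã-s₀))))
                (trans h (cong (_% P) (ã-inside j σj j≢))))
            both : σ i ≡ true → σ j ≡ true → Dec (i ≡ s₀) → Dec (j ≡ s₀) → i ≡ j
            both σi σj (yes i≡) (yes j≡) = trans i≡ (sym j≡)
            both σi σj (yes i≡) (no j≢)  = ⊥-elim (last i j i≡ σj j≢ h)
            both σi σj (no i≢)  (yes j≡) = ⊥-elim (last j i j≡ σi i≢ (sym h))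
            both σi σj (no i≢)  (no j≢)  = sep i j σi σj i≢ j≢
                (≈⇒≡ (τ<P i) (τ<P j) (+-cancelˡ-≈ u (trans (cong (_% P) (sym (ã-inside i σi i≢)))
                (trans h (cong (_% P) (ã-inside j σj j≢))))))
            mixed : ∀ i j → ã i ≈ ã j → σ i ≡ true → σ j ≡ false → ⊥
            mixed i j h σi σj = let m , e = ã∈part j σj in
              disjoint (ã j) (trans (sym (perA₀ h)) (ã∈A₀ i σi)) (proj₁ (proj₂ dp) (combine j m) (ã j) e)
            outside : σ i ≡ false → σ j ≡ false → i ≡ j
            outside σi σj = let m , e = ã∈part i σi ; n , e′ = ã∈part j σj in
              proj₁ (combine-injective i m j n (proj₂ (proj₂ dp) (combine i m) (combine j n) (ã i) e
                  (trans (proj₁ dp (combine j n) h) e′)))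
            by-cases : ∀ a b → σ i ≡ a → σ j ≡ b → i ≡ j
            by-cases true  true  σi σj = both σi σj (i ≟ s₀) (j ≟ s₀)
            by-cases true  false σi σj = ⊥-elim (mixed i j h σi σj)
            by-cases false true  σi σj = ⊥-elim (mixed j i (sym h) σj σi)
            by-cases false false σi σj = outside σi σj

          ã∈A : ∀ i → members P A (ã i) ≡ true
          ã∈A i = by-cases (σ i) refl
            where
            by-cases : ∀ b → σ i ≡ b → members P A (ã i) ≡ true
            by-cases true  σi = A₀⊆ (ã i) (ã∈A₀ i σi)
            by-cases false σi = let m , e = ã∈part i σi in R⊆ (ã i) (proj₁ (proj₂ dp) (combine i m) (ã i) e)

          walk-contradiction : ⊥
          walk-contradiction = no-solution ã ã∈A injective (solution-solves c σ s₀ u w τ x′ σs₀ Σσ≡0 bal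
              w-equation)

      no-walk : ⊥
      no-walk =
        let u , _ , Cu = count-witness P C C-nonempty
            x , x∈ , Bv = chain-walk base k k act l part u Cu
            Iu = stage-⊆ (l i₀) I K (part i₀) u (chain-⊆ base k K act l part u Cu)
            steps = stage-step (l i₀) I K (part i₀) (u + displacement act l x) Bv
            j₀ , good-j₀ = Walk.good u Iu x x∈ steps
        in Walk.walk-contradiction u Iu x x∈ steps j₀ good-j₀

-- A zero-sum set forces sparseness

toℚᵘ-/ : ∀ n d → ℚ.toℚᵘ (n ℚ./ suc d) ℚᵘ.≃ ℚᵘ.mkℚᵘ n d
toℚᵘ-/ n d = ℚₚ.toℚᵘ-fromℚᵘ (ℚᵘ.mkℚᵘ n d)

toℚᵘ-fraction : ∀ m p → ℚ.toℚᵘ ((+ 1 ℚ./ suc m) ℚ.* (+ p ℚ./ 1)) ℚᵘ.≃ ℚᵘ.mkℚᵘ (+ 1) m ℚᵘ.* ℚᵘ.mkℚᵘ (+ p) 0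
toℚᵘ-fraction m p = ℚᵘₚ.≃-trans (ℚₚ.toℚᵘ-homo-* (+ 1 ℚ./ suc m) (+ p ℚ./ 1))
    (ℚᵘₚ.*-cong (toℚᵘ-/ (+ 1) m) (toℚᵘ-/ (+ p) 0))

fraction-lhs : ∀ n m → + n ℤ.* + suc (m * 1) ≡ + (suc m * n)
fraction-lhs n m = trans (sym (ℤₚ.pos-* n _)) (cong +_ (eq n m))
  where
  eq : ∀ n m → n * suc (m * 1) ≡ suc m * n
  eq = solve-∀

fraction-rhs : ∀ p → (+ 1 ℤ.* + p) ℤ.* + 1 ≡ + p
fraction-rhs p = trans (ℤₚ.*-identityʳ _) (ℤₚ.*-identityˡ (+ p))

≤-fraction⁻ : ∀ n m p → (+ n ℚ./ 1) ℚ.≤ (+ 1 ℚ./ suc m) ℚ.* (+ p ℚ./ 1) → suc m * n ≤ p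
≤-fraction⁻ n m p h with ℚᵘₚ.≤-respʳ-≃ (toℚᵘ-fraction m p) (ℚᵘₚ.≤-respˡ-≃ (toℚᵘ-/ (+ n) 0) (ℚₚ.toℚᵘ-mono-≤ h))
... | ℚᵘ.*≤* le = ℤₚ.drop‿+≤+ (subst₂ ℤ._≤_ (fraction-lhs n m) (fraction-rhs p) le)

≤-fraction⁺ : ∀ n m p → suc m * n ≤ p → (+ n ℚ./ 1) ℚ.≤ (+ 1 ℚ./ suc m) ℚ.* (+ p ℚ./ 1)
≤-fraction⁺ n m p h = ℚₚ.toℚᵘ-cancel-≤ (ℚᵘₚ.≤-respʳ-≃ (ℚᵘₚ.≃-sym (toℚᵘ-fraction m p))
    (ℚᵘₚ.≤-respˡ-≃ (ℚᵘₚ.≃-sym (toℚᵘ-/ (+ n) 0))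
  (ℚᵘ.*≤* (subst₂ ℤ._≤_ (sym (fraction-lhs n m)) (sym (fraction-rhs p)) (ℤ.+≤+ h)))))

positive-fraction : ∀ m → 0ℚ ℚ.< (+ 1 ℚ./ suc m)
positive-fraction m = ℚₚ.toℚᵘ-cancel-< (ℚᵘₚ.<-respʳ-≃ (ℚᵘₚ.≃-sym (toℚᵘ-/ (+ 1) m))
    (ℚᵘ.*<* (ℤ.+<+ (s≤s z≤n))))

smaller-fraction : ∀ δ → 0ℚ ℚ.< δ → ∃ λ m → (+ 1 ℚ./ suc m) ℚ.< δ
smaller-fraction (ℚ.mkℚ (+ zero)  d _) (ℚ.*<* (ℤ.+<+ ()))
-- The denominator of δ is d + 1 and its numerator at least 1, so 1 / (d + 2) lies below it.
smaller-fraction (ℚ.mkℚ (+ suc n) d _) _ = suc d ,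
    ℚₚ.toℚᵘ-cancel-< (ℚᵘₚ.<-respˡ-≃ (ℚᵘₚ.≃-sym (toℚᵘ-/ (+ 1) (suc d)))
  (ℚᵘ.*<* (subst₂ ℤ._<_ (ℤₚ.pos-* 1 (suc d)) (ℤₚ.pos-* (suc n) (suc (suc d)))
      (ℤ.+<+ (s≤s (≤-trans (≤-reflexive (cong suc (+-identityʳ d))) (m≤m+n (suc d) _)))))))

∣∣-count : ∀ n (v : Subset n) g → (∀ i → lookup v i ≡ g (toℕ i)) → ∣ v ∣ ≡ count n g
∣∣-count zero    []      g h = refl
∣∣-count (suc n) (b ∷ v) g h = trans (head b) (cong₂ _+_ (cong bit (h zero))
    (∣∣-count n v (g ∘ suc) (h ∘ suc)))
  where
  head : ∀ b → ∣ b ∷ v ∣ ≡ bit b + ∣ v ∣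
  head true  = refl
  head false = refl

module _ (P : ℕ) {{nz : NonZero P}} (A : Subset P) where
  open Mod P
  open Congruence P
  open Recurrence P

  -- No nonempty set avoids the difference 0, so the point 0 alone is recurrent and could not be
  -- discarded at a cut. In the Cayley graph it contributes only loops, which independence ignores.
  nonzeroMembers : ℕ → Bool
  nonzeroMembers x = members P A x ∧ not (x % P ≡ᵇ 0)

  lookup-members : ∀ i → lookup A i ≡ members P A (toℕ i)
  lookup-members i = cong (lookup A)
      (toℕ-injective (sym (trans (toℕ-fromℕ< (m%n<n (toℕ i) P)) (m<n⇒m%n≡m (toℕ<n i)))))

  card-members : ∣ A ∣ ≡ count P (members P A)
  card-members = ∣∣-count P A (members P A) lookup-members

  α⇒Rec : ∀ m → AlphaAtMost P A (+ 1 ℚ./ suc m) → Rec (suc m) nonzeroMembers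
  α⇒Rec m α g per avoid = ≤-trans (≤-reflexive (cong (suc m *_) (sym (∣∣-count P I g I≡))))
    (≤-fraction⁻ ∣ I ∣ m P (α I independent))
    where
    I : Subset P
    I = tabulate (g ∘ toℕ)
    I≡ : ∀ i → lookup I i ≡ g (toℕ i)
    I≡ = lookup∘tabulate (g ∘ toℕ)
    no-arc : ∀ u v → u ∈ I → v ∈ I → ¬ u ≡ v → ¬ Arc P A u v
    no-arc u v u∈ v∈ u≢v (a , a∈ , p∣) = by-cases (toℕ a % P ≡ᵇ 0) refl
      where
      v≈u+a : toℕ v ≈ toℕ u + toℕ a
      v≈u+a = ≅⇒≈ (≅-trans (≡⇒≅ (eq (+ toℕ v) (+ (toℕ u + toℕ a))))
          (≅-trans (≅-+ (∣⇒≅0 {+ toℕ v ℤ.- + (toℕ u + toℕ a)} p∣) (≡⇒≅ {+ (toℕ u + toℕ a)} refl))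
          (≡⇒≅ (ℤₚ.+-identityˡ _))))
        where
        eq : ∀ v t → v ≡ (v ℤ.- t) ℤ.+ t
        eq = ℤR.solve-∀
      by-cases : ∀ b → (toℕ a % P ≡ᵇ 0) ≡ b → ⊥
      by-cases true  e = u≢v (toℕ-injective (≈⇒≡ (toℕ<n u) (toℕ<n v) (sym (trans v≈u+a
        (trans (+-≈ {toℕ u} {toℕ u} {toℕ a} {0} refl (trans (≡ᵇ-true⇒≡ (toℕ a % P) 0 e)
            (sym (m<n⇒m%n≡m (>-nonZero⁻¹ P))))) (cong (_% P) (+-identityʳ (toℕ u))))))))
      by-cases false e = avoid (toℕ u) (toℕ a) (trans (sym (I≡ u)) ([]=⇒lookup u∈))
        (∧-intro (trans (sym (lookup-members a)) ([]=⇒lookup a∈)) (cong not e))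
        (trans (sym (per v≈u+a)) (trans (sym (I≡ v)) ([]=⇒lookup v∈)))
    independent : Independent P A I
    independent u v u∈ v∈ u≢v (inj₁ arc) = no-arc u v u∈ v∈ u≢v arc
    independent u v u∈ v∈ u≢v (inj₂ arc) = no-arc v u v∈ u∈ (u≢v ∘ sym) arc

  count-nonzero : count P (members P A) ≤ count P nonzeroMembers + 1
  count-nonzero = ≤-trans (≤-reflexive (count-split P (members P A) (λ x → not (x % P ≡ᵇ 0))))
      (+-monoʳ-≤ (count P nonzeroMembers)
    (≤-trans (count-mono P {_} {_≡ᵇ 0}
        (λ i i<P e → ≡⇒≡ᵇ-true (trans (sym (m<n⇒m%n≡m i<P))
        (≡ᵇ-true⇒≡ (i % P) 0 (not-not (proj₂ (∧-true {members P A i} e))))))) (only-zero P)))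
    where
    not-not : ∀ {b} → not (not b) ≡ true → b ≡ true
    not-not {true} _ = refl
    only-zero : ∀ n → count n (_≡ᵇ 0) ≤ 1
    only-zero zero    = z≤n
    only-zero (suc n) = ≤-reflexive
        (cong suc (trans (∑-cong n (λ _ _ → refl)) (trans (∑-const n 0) (*-zeroʳ n))))

  Periodic-nonzero : Periodic nonzeroMembers
  Periodic-nonzero h = cong₂ (λ a r → a ∧ not (r ≡ᵇ 0)) (Periodic-members P A h) h

  nonzero≉0 : ∀ x → nonzeroMembers x ≡ true → ¬ x ≈ 0
  nonzero≉0 x e h = not-true⇒¬ (proj₂ (∧-true {members P A x} e))
      (≡⇒≡ᵇ-true (trans h (m<n⇒m%n≡m (>-nonZero⁻¹ P))))

-- Placing the zero-sum part of a solution

Separated : ∀ {k} → (Fin k → Bool) → (Fin k → Set) → (Fin k → ℕ) → Set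
Separated σ S τ = ∀ i j → σ i ≡ true → σ j ≡ true → ¬ S i → ¬ S j → τ i ≡ τ j → i ≡ j

-- Indices in S are exempt from separation: the walk moves the entry at s₀ later, and a pair of
-- opposite coefficients allows no other way to tell its entries apart.
Placement : ∀ {k} → (Fin k → ℤ) → (Fin k → Bool) → (Fin k → Set) → ℕ → ℕ → ℕ → Set
Placement {k} a σ S e′ B E = ∀ P {{_ : NonZero P}} f → Mod.Periodic P f → P ≤ suc e′ * count P f →
  ∃ λ (τ : Fin k → ℕ) → ∃ λ I → (∀ i → τ i ≤ B) × Balanced a τ × Separated σ S τ ×
    Mod.Periodic P I × (∀ u → I u ≡ true → ∀ i → f (u + τ i) ≡ true) × P ≤ suc E * count P I

module _ {k : ℕ} (c : Fin k → ℤ) (c≢0 : ∀ i → ¬ c i ≡ + 0) (σ : Fin k → Bool) (Σσ≡0 : sumFin (restrict σ c) ≡ + 0) where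

  Partner : Fin k → Fin k → Set
  Partner r q = σ q ≡ true × ¬ q ≡ r × ¬ c r ℤ.+ c q ≡ + 0

  -- One separating vector per index of σ: equal offsets at i and j agree in the vector of i, which
  -- forces i = j.
  generic-placement : (∀ r → σ r ≡ true → ∃ (Partner r)) → ∀ e′ → ∃ λ B → ∃ λ E → Placement (restrict σ c) σ
      (λ _ → ⊥) e′ B E
  generic-placement partner e′ =
    let B , E , config = configuration (Balanced (restrict σ c)) (Balanced-zero (restrict σ c)) (λ {τ} {o} → Balanced-closed (restrict σ c) {τ} {o})
                           (tabulateL (λ r → proj₁ (offsets r)))
                               (tabulate⁺ (λ r → proj₁ (proj₂ (offsets r)) ,
                               proj₁ (proj₂ (proj₂ (offsets r))))) e′
    in B , E , λ P {{nz}} f per dense →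
      let τ , I , τ≤ , bal , sep , rest = config P {{nz}} f per dense
      in τ , I , τ≤ , bal , (λ i j σi σj _ _ τ≡ → proj₂ (proj₂ (proj₂ (offsets i))) σi j (tabulate⁻ (sep i j τ≡) i)) , rest
    where
    offsets : ∀ r → ∃ λ o → ThreeValued o × Balanced (restrict σ c) o × (σ r ≡ true → ∀ j → o r ≡ o j →
        r ≡ j)
    offsets r = by-cases (σ r) refl
      where
      by-cases : ∀ b → σ r ≡ b → ∃ λ o → ThreeValued o × Balanced (restrict σ c) o × (σ r ≡ true → ∀ j →
          o r ≡ o j → r ≡ j)
      by-cases true  e = let q , σq , q≢r , r+q≢0 = partner r e
                             o , three , bal , sep = separating-offset σ c c≢0 Σσ≡0 r q e σq q≢r r+q≢0
                         in o , three , bal , λ _ → sep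
      -- Indices outside σ get the zero vector, so that the list can be tabulated over all of Fin k.
      by-cases false e = (λ _ → 0) , (0 , 0 , λ _ → inj₁ refl) , Balanced-zero (restrict σ c) ,
          λ e′ → ⊥-elim (false≢true (trans (sym e) e′))

trivial-placement : ∀ {k} (a : Fin k → ℤ) σ S → (∀ i j → σ i ≡ true → σ j ≡ true → ¬ S i → ¬ S j → i ≡ j) →
    ∀ e′ → Placement a σ S e′ 0 e′
trivial-placement a σ S sep e′ P f per dense =
  (λ _ → 0) , f , (λ _ → z≤n) , Balanced-zero a , (λ i j σi σj ni nj _ → sep i j σi σj ni nj) , per ,
  (λ u fu i → subst (λ z → f z ≡ true) (sym (+-identityʳ u)) fu) , dense

Sparse : ∀ {k} → (Fin k → ℤ) → ℕ → ℕ → ℕ → Set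
Sparse c e′ m N = ∀ P {{nz : NonZero P}} → Prime P → N ≤ P → ∀ A → SolutionFree c P A →
  Recurrence.Rec P (suc m) (nonzeroMembers P A) → suc e′ * count P (members P A) ≤ P

dense⇒nonempty : ∀ {P E n} → 1 ≤ P → P ≤ E * n → 1 ≤ n
dense⇒nonempty {P} {E} {zero}  1≤P h = ≤-trans 1≤P (≤-trans h (≤-reflexive (*-zeroʳ E)))
dense⇒nonempty {n = suc n} 1≤P h = s≤s z≤n

sum-≥ : ∀ {n} (f : Fin n → ℕ) i → f i ≤ sum f
sum-≥ f zero    = m≤m+n (f zero) _
sum-≥ f (suc i) = ≤-trans (sum-≥ (f ∘ suc) i) (m≤n+m _ (f zero))

module _ {k : ℕ} (c : Fin k → ℤ) (c≢0 : ∀ i → ¬ c i ≡ + 0) (σ : Fin k → Bool) (s₀ : Fin k)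
         (σs₀ : σ s₀ ≡ true) (Σσ≡0 : sumFin (restrict σ c) ≡ + 0) where

  sparse-full : (∀ i → σ i ≡ true) → ∀ {e′ B E} → Placement (restrict σ c) σ (λ _ → ⊥) e′ B E →
      Sparse c e′ 0 (suc B)
  sparse-full all-σ {e′} {B} {E} place P isPrime B<P A free _ = ≮⇒≥ λ dense →
    let τ , I , τ≤ , bal , sep , perI , shifts , denseI = place P (members P A) (Periodic-members P A) (<⇒≤ dense)
        u , _ , Iu = count-witness P I (dense⇒nonempty {P} {suc E} (>-nonZero⁻¹ P) denseI)
    in Endgame.no-translate c c≢0 P A free σ s₀ σs₀ Σσ≡0 τ bal (λ i → ≤-<-trans (τ≤ i) B<P) all-σ
         (λ i j → sep i j (all-σ i) (all-σ j) (λ ()) (λ ())) u (shifts u Iu)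

  -- The placement is asked for density 1 / 4e with e = suc e′: dropping 0 from A costs a factor 2,
  -- and passing to the larger of two disjoint parts another.
  module Chain (i₀ : Fin k) (σi₀ : σ i₀ ≡ false) {e′ B E : ℕ} (place : Placement (restrict σ c) σ (_≡ s₀) (e′ + 3 * suc e′) B E) where

    K N : ℕ
    K = suc k
    -- The walk uses K parts for i₀ and at most K for each of the k indices, and each loses at most
    -- P / N points of a set of at least P / suc E.
    N = suc (K * K * suc E)

    M₀ M₁ : ℕ
    M₀ = size N (k * K)
    -- Doubled so that the first parameter of `split` is at least 2.
    M₁ = 2 * M₀

    1≤M₀ : 1 ≤ M₀
    1≤M₀ = 1≤size N (k * K) (s≤s (s≤s z≤n))

    module _ (P : ℕ) {{nz : NonZero P}} (isPrime : Prime P) (B<P : B < P) (c<P : ∀ i → ℤ.∣ c i ∣ < P)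
        (3≤P : 3 ≤ P)
             (A : Subset P) (free : SolutionFree c P A) where
      open Mod P
      open Congruence P
      open Recurrence P
      open Units isPrime
      open Splitting 3≤P inverse

      dense-and-recurrent : ∀ A₀ R → Periodic A₀ → Periodic R → A₀ ⊆ members P A → R ⊆ members P A →
        (∀ x → R x ≡ true → ¬ x ≈ 0) → (∀ x → A₀ x ≡ true → R x ≡ true → ⊥) →
        P ≤ suc (e′ + 3 * suc e′) * count P A₀ → Rec (size N (k * K)) R → ⊥
      dense-and-recurrent A₀ R perA₀ perR A₀⊆ R⊆ R≉0 disjoint dense rec =
        let τ , I , τ≤ , bal , sep , perI , shifts , denseI = place P A₀ perA₀ dense in
        parts N (k * K) R (s≤s (s≤s z≤n)) perR R≉0 rec λ fam dp recs →
          Endgame.no-walk c c≢0 P A free σ s₀ σs₀ Σσ≡0 τ bal (λ i → ≤-<-trans (τ≤ i) B<P)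
            (λ i → proj₁ (l i)) (λ i → proj₁ (proj₂ (l i))) (λ i → proj₂ (proj₂ (l i)))
            i₀ σi₀ (λ i j σi σj ni nj → sep i j σi σj ni nj)
            A₀ R I A₀⊆ R⊆ perA₀ disjoint perI shifts fam dp {N} recs
                (large (count P I) denseI (dense⇒nonempty {P} {suc E} (>-nonZero⁻¹ P) denseI))
        where
        -c≢0 : ∀ i → ¬ ℤ.- c i ≡ + 0
        -c≢0 i e = c≢0 i (trans (sym (ℤₚ.neg-involutive (c i))) (cong ℤ.-_ e))
        l : ∀ i → ∃ λ l → (∃ λ m → l * m ≈ 1) × c s₀ ℤ.* + l ≅ ℤ.- c i
        l i = ratio (c s₀) (ℤ.- c i) (c≢0 s₀) (-c≢0 i) (c<P s₀) (subst (_< P) (sym (ℤₚ.∣-i∣≡∣i∣ (c i)))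
            (c<P i))
        large : ∀ n → P ≤ suc E * n → 1 ≤ n → K * P + k * (K * P) < N * n
        large n dense 1≤n = lin (suc (K * P + k * (K * P))) (N * n) 0 ((K * K) ⊗ dense ⊕ 1≤n) (eq k P E n)
          where
          eq : ∀ k P E n → suc (suc k * P + k * (suc k * P)) + (suc k * suc k * (suc E * n) + n) + 0
            ≡ suc (suc k * suc k * suc E) * n + (suc k * suc k * P + 1)
          eq = solve-∀

      dense-members : 2 * suc e′ ≤ P → P < suc e′ * count P (members P A) → P ≤ 2 * suc e′ * count P
          (nonzeroMembers P A)
      dense-members big dense = lin P _ 2
        (dense ⊕ dense ⊕ (2 * suc e′) ⊗ count-nonzero P A ⊕ big) (eq P (suc e′) (count P (members P A))
            (count P (nonzeroMembers P A)))
        where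
        eq : ∀ P e f g → P + (e * f + (e * f + (2 * e * (g + 1) + P))) + 2 ≡ 2 * e * g
            + (suc P + (suc P + (2 * e * f + 2 * e)))
        eq = solve-∀

      -- One of two disjoint recurrent parts of A is dense; the other one provides the steps.
      chain-contradiction : 2 * suc e′ ≤ P → P < suc e′ * count P (members P A) → Rec (M₁ * (4 * M₀))
          (nonzeroMembers P A) → ⊥
      chain-contradiction big dense rec = split M₁ M₀ Z (2 ⊗ 1≤M₀) 1≤M₀ (Periodic-nonzero P A)
          (nonzero≉0 P A) rec λ j rec₁ rec₂ →
        either j (λ g per av → ≤-trans (*-monoˡ-≤ (count P g) (m≤n*m M₀ 2)) (rec₁ g per av)) rec₂
            (≤-total (count P (below j Z)) (count P (above j Z)))
        where
        Z : ℕ → Bool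
        Z = nonzeroMembers P A
        per-below : ∀ j → Periodic (below j Z)
        per-below j h = cong₂ (λ a r → a ∧ (r <ᵇ j)) (Periodic-nonzero P A h) h
        per-above : ∀ j → Periodic (above j Z)
        per-above j h = cong₂ (λ a r → a ∧ not (r <ᵇ j)) (Periodic-nonzero P A h) h
        below⊆ : ∀ j → below j Z ⊆ Z
        below⊆ j x e = proj₁ (∧-true {Z x} e)
        above⊆ : ∀ j → above j Z ⊆ Z
        above⊆ j x e = proj₁ (∧-true {Z x} e)
        Z⊆ : Z ⊆ members P A
        Z⊆ x e = proj₁ (∧-true {members P A x} e)
        half : ∀ j {n} → count P (below j Z) ≤ n → count P (above j Z) ≤ n → P ≤ suc (e′ + 3 * suc e′) * n
        half j {n} h₁ h₂ = lin P _ 0 (dense-members big dense ⊕ (2 * suc e′) ⊗ ≤-reflexive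
            (count-split P Z (λ x → x % P <ᵇ j)) ⊕ (2 * suc e′) ⊗ (h₁ ⊕ h₂))
          (eq P (suc e′) n (count P Z) (count P (below j Z)) (count P (above j Z)))
          where
          eq : ∀ P e n z a b → P + (2 * e * z + (2 * e * (a + b) + 2 * e * (n + n))) + 0 ≡ (e + 3 * e) * n
              + (P + (2 * e * z + 2 * e * (a + b)))
          eq = solve-∀
        apart : ∀ j x → below j Z x ≡ true → above j Z x ≡ true → ⊥
        apart j x b a = not-true⇒¬ (proj₂ (∧-true {Z x} a)) (proj₂ (∧-true {Z x} b))
        either : ∀ j → Rec M₀ (below j Z) → Rec M₀ (above j Z) →
          count P (below j Z) ≤ count P (above j Z) ⊎ count P (above j Z) ≤ count P (below j Z) → ⊥
        either j rec₁ rec₂ (inj₁ h) = dense-and-recurrent (above j Z) (below j Z) (per-above j)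
            (per-below j)
          (λ x e → Z⊆ x (above⊆ j x e)) (λ x e → Z⊆ x (below⊆ j x e))
              (λ x e → nonzero≉0 P A x (below⊆ j x e)) (λ x a b → apart j x b a) (half j h ≤-refl) rec₁
        either j rec₁ rec₂ (inj₂ h) = dense-and-recurrent (below j Z) (above j Z) (per-below j)
            (per-above j)
          (λ x e → Z⊆ x (below⊆ j x e)) (λ x e → Z⊆ x (above⊆ j x e))
              (λ x e → nonzero≉0 P A x (above⊆ j x e)) (λ x b a → apart j x b a) (half j ≤-refl h) rec₂

    C : ℕ
    C = sum (λ i → ℤ.∣ c i ∣)

    sparse-chain : ∃ λ m → ∃ λ n → Sparse c e′ m n
    sparse-chain = M₁ * (4 * M₀) ∸ 1 , suc B + (suc C + (3 + 2 * suc e′)) , λ P isPrime large A free rec →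
        ≮⇒≥ λ dense →
      let rest = ≤-trans (m≤n+m (3 + 2 * suc e′) (suc C)) (≤-trans (m≤n+m _ (suc B)) large) in
      chain-contradiction P isPrime (≤-trans (m≤m+n (suc B) _) large)
        (λ i → ≤-<-trans (sum-≥ (λ i → ℤ.∣ c i ∣) i)
            (≤-trans (m≤m+n (suc C) _) (≤-trans (m≤n+m _ (suc B)) large)))
        (≤-trans (m≤m+n 3 (2 * suc e′)) rest) A free (≤-trans (m≤n+m (2 * suc e′) 3) rest) dense
        (subst (λ m → Recurrence.Rec P m (nonzeroMembers P A)) (m+[n∸m]≡n 1≤M) rec)
      where
      1≤M : 1 ≤ M₁ * (4 * M₀)
      1≤M = *-mono-≤ {1} {M₁} {1} (≤-trans 1≤M₀ (m≤n*m M₀ 2)) (≤-trans 1≤M₀ (m≤n*m M₀ 4))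

sum-restrict-single : ∀ {k} (σ : Fin k → Bool) (c : Fin k → ℤ) r → σ r ≡ true → (∀ q → σ q ≡ true → q ≡ r) →
    sumFin (restrict σ c) ≡ c r
sum-restrict-single σ c r σr only = trans (sumFin-cong pointwise) (sumFin-delta c r)
  where
  pointwise : ∀ i → restrict σ c i ≡ (if does (i ≟ r) then c i else + 0)
  pointwise i = by-cases (σ i) (i ≟ r) refl
    where
    by-cases : ∀ b (d : Dec (i ≡ r)) → σ i ≡ b → (if b then c i else + 0) ≡ (if does d then c i else + 0)
    by-cases true  (yes _)   e = refl
    by-cases true  (no i≢r)  e = ⊥-elim (i≢r (only i e))
    by-cases false (yes i≡r) e = ⊥-elim (false≢true (trans (sym e) (trans (cong σ i≡r) σr)))
    by-cases false (no _)    e = refl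

outside-pair : ∀ {k} → 3 ≤ k → (r s : Fin k) → ∃ λ i → (does (i ≟ r) ∨ does (i ≟ s)) ≡ false
outside-pair {k} 3≤k r s with any? (λ i → (does (i ≟ r) ∨ does (i ≟ s)) Bool.≟ false)
... | yes found = found
... | no none = ⊥-elim (let i , j , i<j , e = pigeonhole 3≤k label in <⇒≢ i<j (label-injective i j (i ≟ r) (j ≟ r) refl refl e))
  where
  tag : Bool → Fin 2
  tag b = if b then zero else suc zero
  label : Fin k → Fin 2
  label i = tag (does (i ≟ r))
  is-s : ∀ i → ¬ i ≡ r → i ≡ s
  is-s i i≢r with i ≟ s
  ... | yes i≡s = i≡s
  ... | no i≢s  = ⊥-elim (none (i , cong₂ _∨_ (dec-false (i ≟ r) i≢r) (dec-false (i ≟ s) i≢s)))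
  label-injective : ∀ i j (d : Dec (i ≡ r)) (d′ : Dec (j ≡ r)) → does (i ≟ r) ≡ does d → does
      (j ≟ r) ≡ does d′ → label i ≡ label j → i ≡ j
  label-injective i j (yes i≡) (yes j≡) _ _ _ = trans i≡ (sym j≡)
  label-injective i j (no i≢)  (no j≢)  _ _ _ = trans (is-s i i≢) (sym (is-s j j≢))
  label-injective i j (yes _)  (no _)   p q e with trans (sym (cong tag p)) (trans e (cong tag q))
  ... | ()
  label-injective i j (no _)   (yes _)  p q e with trans (sym (cong tag p)) (trans e (cong tag q))
  ... | ()

module _ {k : ℕ} (3≤k : 3 ≤ k) (c : Fin k → ℤ) (c≢0 : ∀ i → ¬ c i ≡ + 0) where

  -- Both offsets are 0. With s₀ = r exempt, s is the only index left to separate, and the walk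
  -- moves the entry at r away from it.
  sparse-pair : ∀ r s → ¬ s ≡ r → c r ℤ.+ c s ≡ + 0 → ∀ e′ → ∃ λ m → ∃ λ N → Sparse c e′ m N
  sparse-pair r s s≢r r+s≡0 e′ =
    Chain.sparse-chain c c≢0 σ r σr Σσ≡0 i₀ (proj₂ (outside-pair 3≤k r s)) {e′} {0} {e′ + 3 * suc e′}
      (trivial-placement (restrict σ c) σ (_≡ r) only-s (e′ + 3 * suc e′))
    where
    σ : Fin k → Bool
    σ i = does (i ≟ r) ∨ does (i ≟ s)
    i₀ = proj₁ (outside-pair 3≤k r s)
    σr : σ r ≡ true
    σr = cong (_∨ does (r ≟ s)) (dec-true (r ≟ r) refl)
    is-s : ∀ i → σ i ≡ true → ¬ i ≡ r → i ≡ s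
    is-s i σi i≢r with i ≟ r | i ≟ s
    ... | yes i≡r | _       = ⊥-elim (i≢r i≡r)
    ... | no _    | yes i≡s = i≡s
    only-s : ∀ i j → σ i ≡ true → σ j ≡ true → ¬ i ≡ r → ¬ j ≡ r → i ≡ j
    only-s i j σi σj i≢ j≢ = trans (is-s i σi i≢) (sym (is-s j σj j≢))
    Σσ≡0 : sumFin (restrict σ c) ≡ + 0
    Σσ≡0 = trans (sumFin-cong pointwise)
        (trans (sumFin-+ (λ i → if does (i ≟ r) then c i else + 0)
        (λ i → if does (i ≟ s) then c i else + 0))
      (trans (cong₂ ℤ._+_ (sumFin-delta c r) (sumFin-delta c s)) r+s≡0))
      where
      pointwise : ∀ i → restrict σ c i ≡ (if does (i ≟ r) then c i else + 0) ℤ.+ (if does (i ≟ s) then c i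
          else + 0)
      pointwise i with i ≟ r | i ≟ s
      ... | yes i≡r | yes i≡s = ⊥-elim (s≢r (trans (sym i≡s) i≡r))
      ... | yes _   | no _    = sym (ℤₚ.+-identityʳ (c i))
      ... | no _    | yes _   = sym (ℤₚ.+-identityˡ (c i))
      ... | no _    | no _    = refl

  ZeroPair : Set
  ZeroPair = ∃ λ r → ∃ λ s → ¬ s ≡ r × c r ℤ.+ c s ≡ + 0

  -- If r were alone in σ, the sum over σ would be c r, which is nonzero. Any second index of σ is a
  -- partner when no two coefficients cancel.
  partner : ∀ σ (Σσ≡0 : sumFin (restrict σ c) ≡ + 0) → ¬ ZeroPair → ∀ r → σ r ≡ true →
      ∃ (Partner c c≢0 σ Σσ≡0 r)
  partner σ Σσ≡0 no-pair r σr with any? (λ q → (σ q Bool.≟ true) ×-dec ¬? (q ≟ r))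
  ... | yes (q , σq , q≢r) = q , σq , q≢r , λ r+q≡0 → no-pair (r , q , q≢r , r+q≡0)
  ... | no none = ⊥-elim (c≢0 r (trans (sym (sum-restrict-single σ c r σr only)) Σσ≡0))
    where
    only : ∀ q → σ q ≡ true → q ≡ r
    only q σq = decidable-stable (q ≟ r) (λ q≢r → none (q , σq , q≢r))

  sparse-generic : ∀ σ s₀ → σ s₀ ≡ true → sumFin (restrict σ c) ≡ + 0 → ¬ ZeroPair → ∀ e′ → ∃ λ m → ∃ λ N →
      Sparse c e′ m N
  sparse-generic σ s₀ σs₀ Σσ≡0 no-pair e′ = by-cases (any? (λ i → σ i Bool.≟ false))
    where
    place : ∀ e′ → ∃ λ B → ∃ λ E → Placement (restrict σ c) σ (λ _ → ⊥) e′ B E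
    place = generic-placement c c≢0 σ Σσ≡0 (partner σ Σσ≡0 no-pair)
    by-cases : Dec (∃ λ i → σ i ≡ false) → ∃ λ m → ∃ λ N → Sparse c e′ m N
    by-cases (yes (i₀ , σi₀)) =
      let B , E , pl = place (e′ + 3 * suc e′) in
      Chain.sparse-chain c c≢0 σ s₀ σs₀ Σσ≡0 i₀ σi₀ {e′} {B} {E}
        (λ P {{nz}} f per dense → let τ , I , τ≤ , bal , sep , rest = pl P {{nz}} f per dense
           in τ , I , τ≤ , bal , (λ i j σi σj _ _ → sep i j σi σj (λ ()) (λ ())) , rest)
    by-cases (no all) =
      let B , E , pl = place e′ in
      0 , suc B , sparse-full c c≢0 σ s₀ σs₀ Σσ≡0 (λ i → ¬-not (λ e → all (i , e))) {e′} {B} {E} pl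

  -- A pair of opposite coefficients anywhere, even outside σ, takes the place of σ; without such a
  -- pair every index of σ has a partner.
  sparse : ∀ σ s₀ → σ s₀ ≡ true → sumFin (restrict σ c) ≡ + 0 → ∀ e′ → ∃ λ m → ∃ λ N → Sparse c e′ m N
  sparse σ s₀ σs₀ Σσ≡0 e′ with any? (λ r → any? (λ s → ¬? (s ≟ r) ×-dec (c r ℤ.+ c s ℤ.≟ + 0)))
  ... | yes (r , s , s≢r , r+s≡0) = sparse-pair r s s≢r r+s≡0 e′
  ... | no no-pair = sparse-generic σ s₀ σs₀ Σσ≡0 no-pair e′

  B⇒A : ConditionB c → ConditionA c
  B⇒A (S , (s₀ , s₀∈S) , ΣS≡0) δ 0<δ =
    let e′ , small = smaller-fraction δ 0<δ
        m , N , h = sparse (lookup S) s₀ ([]=⇒lookup s₀∈S) ΣS≡0 e′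
    in + 1 ℚ./ suc m , positive-fraction m , + 1 ℚ./ suc e′ , small , N , λ p isPrime N≤p A free α →
      ≤-fraction⁺ ∣ A ∣ e′ p (≤-trans
          (≤-reflexive (cong (suc e′ *_) (card-members p {{prime⇒nonZero isPrime}} A)))
        (h p {{prime⇒nonZero isPrime}} isPrime N≤p A free (α⇒Rec p {{prime⇒nonZero isPrime}} A m α)))

-- The example without zero-sum sets

-- Euclid's argument: a prime up to N divides N!, hence cannot divide N! + 1.
prime-above : ∀ N → ∃ λ p → Prime p × N ≤ p
prime-above N = from-factors (factorise n)
  where
  n = suc (N !)
  1≤N! : 1 ≤ N !
  1≤N! = >-nonZero⁻¹ (N !) {{N !≢0}}
  from-factors : PrimeFactorisation n → ∃ λ p → Prime p × N ≤ p
  from-factors record { factors = [] ; isFactorisation = e } = ⊥-elim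
      (<⇒≱ 1≤N! (≤-reflexive (suc-injective e)))
  from-factors record { factors = p ∷ ps ; isFactorisation = e ; factorsPrime = pr ∷ _ } = p , pr ,
      ≮⇒≥ λ p<N →
    ¬prime[1] (subst Prime (∣1⇒≡1 (∣m+n∣m⇒∣n {m = N !} (subst (p ∣ℕ_) (trans (sym e) (+-comm 1 (N !)))
        (m∣m*n (product ps))) (p∣N! p pr (<⇒≤ p<N)))) pr)
    where
    p∣N! : ∀ p → Prime p → p ≤ N → p ∣ℕ N !
    p∣N! zero    pr _   = ⊥-elim (≢-nonZero⁻¹ 0 {{prime⇒nonZero pr}} refl)
    p∣N! (suc q) pr q<N = ∣-trans (m∣m*n (q !)) (m≤n⇒m!∣n! q<N)

at-most-one : ∀ n h → (∀ i j → i < j → j < n → h i ≡ true → h j ≡ true → ⊥) → count n h ≤ 1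
at-most-one zero    h _    = z≤n
at-most-one (suc n) h once with h 0 in eq
... | false = at-most-one n (h ∘ suc) (λ i j i<j j<n → once (suc i) (suc j) (s≤s i<j) (s≤s j<n))
... | true  = ≤-reflexive (cong suc (n≤0⇒n≡0 (≮⇒≥ λ some → let i , i<n , hi = count-witness n (h ∘ suc) some in once 0 (suc i) (s≤s z≤n) (s≤s i<n) eq hi)))

does-true : ∀ {A : Set} (d : Dec A) → does d ≡ true → A
does-true (yes a) _ = a

<-fraction⁻ : ∀ n m p → (+ n ℚ./ 1) ℚ.< (+ 1 ℚ./ suc m) ℚ.* (+ p ℚ./ 1) → suc m * n < p
<-fraction⁻ n m p h with ℚᵘₚ.<-respʳ-≃ (toℚᵘ-fraction m p) (ℚᵘₚ.<-respˡ-≃ (toℚᵘ-/ (+ n) 0) (ℚₚ.toℚᵘ-mono-< h))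
... | ℚᵘ.*<* lt = ℤₚ.drop‿+<+ (subst₂ ℤ._<_ (fraction-lhs n m) (fraction-rhs p) lt)

-- The multipliers x and y clear the denominators of termwise bounds such as |f i| ≤ |c i| p / 2C.
∣sumFin∣≤ : ∀ {k} (f c : Fin k → ℤ) x y → (∀ i → ℤ.∣ f i ∣ * x ≤ ℤ.∣ c i ∣ * y) → ℤ.∣ sumFin f ∣ * x ≤ sum
    (λ i → ℤ.∣ c i ∣) * y
∣sumFin∣≤ {zero}  f c x y h = z≤n
∣sumFin∣≤ {suc k} f c x y h = begin
  ℤ.∣ f zero ℤ.+ sumFin (f ∘ suc) ∣ * x               ≤⟨ *-monoˡ-≤ x (ℤₚ.∣i+j∣≤∣i∣+∣j∣ (f zero) _) ⟩
  (ℤ.∣ f zero ∣ + ℤ.∣ sumFin (f ∘ suc) ∣) * x         ≡⟨ *-distribʳ-+ x ℤ.∣ f zero ∣ _ ⟩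
  ℤ.∣ f zero ∣ * x + ℤ.∣ sumFin (f ∘ suc) ∣ * x       ≤⟨ h zero ⊕ ∣sumFin∣≤ (f ∘ suc) (c ∘ suc) x y
      (h ∘ suc) ⟩
  ℤ.∣ c zero ∣ * y + sum (λ i → ℤ.∣ c (suc i) ∣) * y  ≡⟨ sym (*-distribʳ-+ y ℤ.∣ c zero ∣ _) ⟩
  (ℤ.∣ c zero ∣ + sum (λ i → ℤ.∣ c (suc i) ∣)) * y    ∎
  where open ≤-Reasoning

multiple-small : ∀ q p z → q ℤ.* + p ≡ z → ℤ.∣ z ∣ < p → q ≡ + 0
multiple-small q p z refl small = ℤₚ.∣i∣≡0⇒i≡0 (n≤0⇒n≡0 (≮⇒≥ λ 0<q → <⇒≱ small (begin
  p                    ≡⟨ sym (*-identityˡ p) ⟩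
  1 * p                ≤⟨ *-monoˡ-≤ p 0<q ⟩
  ℤ.∣ q ∣ * p          ≡⟨ sym (ℤₚ.abs-* q (+ p)) ⟩
  ℤ.∣ q ℤ.* + p ∣      ∎)))
  where open ≤-Reasoning

-- Rounds each term to a multiple of P and collects the errors; P will be a power of M in one case
-- and p in the other.
split-error : ∀ {k} (r x : Fin k → ℤ) P → sumFin x ≡ sumFin r ℤ.* P ℤ.+ sumFin (λ i → x i ℤ.- r i ℤ.* P)
split-error r x P = begin
  sumFin x                                                          ≡⟨ sumFin-cong (λ i → eq (x i) (r i) P)
      ⟩
  sumFin (λ i → r i ℤ.* P ℤ.+ (x i ℤ.- r i ℤ.* P))                  ≡⟨ sumFin-+ (λ i → r i ℤ.* P)
      (λ i → x i ℤ.- r i ℤ.* P) ⟩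
  sumFin (λ i → r i ℤ.* P) ℤ.+ sumFin (λ i → x i ℤ.- r i ℤ.* P)     ≡⟨ cong (ℤ._+ sumFin
      (λ i → x i ℤ.- r i ℤ.* P)) (sumFin-* r P) ⟩
  sumFin r ℤ.* P ℤ.+ sumFin (λ i → x i ℤ.- r i ℤ.* P)               ∎
  where
  open ≡-Reasoning
  eq : ∀ x r P → x ≡ r ℤ.* P ℤ.+ (x ℤ.- r ℤ.* P)
  eq = ℤR.solve-∀

∣restrict∣≤ : ∀ {k} (σ : Fin k → Bool) (c : Fin k → ℤ) → ℤ.∣ sumFin (restrict σ c) ∣ ≤ sum (λ i → ℤ.∣ c i ∣)
∣restrict∣≤ σ c = subst₂ _≤_ (*-identityʳ _) (*-identityʳ _) (∣sumFin∣≤ (restrict σ c) c 1 1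
    (λ i → *-monoˡ-≤ 1 (pointwise i)))
  where
  pointwise : ∀ i → ℤ.∣ restrict σ c i ∣ ≤ ℤ.∣ c i ∣
  pointwise i with σ i
  ... | true  = ≤-refl
  ... | false = z≤n

module Construction {k : ℕ} (c : Fin k → ℤ) (i⋆ : Fin k)
                    (no-zero-sum : ∀ σ i → σ i ≡ true → ¬ sumFin (restrict σ c) ≡ + 0) where

  C M : ℕ
  C = sum (λ i → ℤ.∣ c i ∣)
  M = suc C

  -- A single index is a nonempty set too, so c i⋆ cannot vanish.
  1≤C : 1 ≤ C
  1≤C = ≤-trans (n≢0⇒n>0 (λ e → no-zero-sum (λ i → does (i ≟ i⋆)) i⋆ (dec-true (i⋆ ≟ i⋆) refl)
    (trans (sum-restrict-single (λ i → does (i ≟ i⋆)) c i⋆ (dec-true (i⋆ ≟ i⋆) refl)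
        (λ q → does-true (q ≟ i⋆))) (ℤₚ.∣i∣≡0⇒i≡0 e)))) (sum-≥ (λ i → ℤ.∣ c i ∣) i⋆)

  -- In a relation among differences of powers of C + 1 the coefficients of the
  -- largest power that occurs sum to zero.
  lacunary-top : ∀ t (a j l : Fin k → ℕ) → (∀ i → l i < j i) → (∀ i → j i ≤ suc t) →
      (∀ i → a i + M ^ l i ≡ M ^ j i) →
    ∀ i₀ → j i₀ ≡ suc t → ¬ sumFin (λ i → c i ℤ.* + a i) ≡ + 0
  lacunary-top t a j l l<j j≤ a≡ i₀ top sum≡0 =
    no-zero-sum σ i₀ (≡⇒≡ᵇ-true top) (multiple-small (sumFin r) (M ^ suc t) (ℤ.- err)
        (cancel (sumFin r ℤ.* T) err (trans (sym (split-error r (λ i → c i ℤ.* + a i) T)) sum≡0))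
      (subst (_< M ^ suc t) (sym (ℤₚ.∣-i∣≡∣i∣ err)) small))
    where
    σ : Fin k → Bool
    σ i = j i ≡ᵇ suc t
    r : Fin k → ℤ
    r = restrict σ c
    T = + (M ^ suc t)
    err = sumFin (λ i → c i ℤ.* + a i ℤ.- r i ℤ.* T)
    cancel : ∀ x y → x ℤ.+ y ≡ + 0 → x ≡ ℤ.- y
    cancel x y e = trans (eq x y) (trans (cong (ℤ._- y) e) (ℤₚ.+-identityˡ _))
      where
      eq : ∀ x y → x ≡ x ℤ.+ y ℤ.- y
      eq = ℤR.solve-∀
    term : ∀ i b → σ i ≡ b → ℤ.∣ c i ℤ.* + a i ℤ.- (if b then c i else + 0) ℤ.* T ∣ ≤ ℤ.∣ c i ∣ * M ^ t
    term i true e = begin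
      ℤ.∣ c i ℤ.* + a i ℤ.- c i ℤ.* T ∣         ≡⟨ cong (λ z → ℤ.∣ c i ℤ.* + a i ℤ.- c i ℤ.* + z ∣)
          (trans (cong (M ^_) (sym ji)) (sym (a≡ i))) ⟩
      ℤ.∣ c i ℤ.* + a i ℤ.- c i ℤ.* + (a i + M ^ l i) ∣ ≡⟨ cong ℤ.∣_∣
          (trans (cong (λ z → c i ℤ.* + a i ℤ.- c i ℤ.* z) (ℤₚ.pos-+ (a i) (M ^ l i)))
          (eq (c i) (+ a i) (+ (M ^ l i)))) ⟩
      ℤ.∣ c i ℤ.* (ℤ.- + (M ^ l i)) ∣            ≡⟨ trans (ℤₚ.abs-* (c i) _)
          (cong (ℤ.∣ c i ∣ *_) (ℤₚ.∣-i∣≡∣i∣ (+ (M ^ l i)))) ⟩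
      ℤ.∣ c i ∣ * M ^ l i                        ≤⟨ ℤ.∣ c i ∣ ⊗ ^-monoʳ-≤ M
          (≤-pred (subst (l i <_) ji (l<j i))) ⟩
      ℤ.∣ c i ∣ * M ^ t                          ∎
      where
      open ≤-Reasoning
      ji = ≡ᵇ-true⇒≡ (j i) (suc t) e
      eq : ∀ c a l → c ℤ.* a ℤ.- c ℤ.* (a ℤ.+ l) ≡ c ℤ.* (ℤ.- l)
      eq = ℤR.solve-∀
    term i false e = begin
      ℤ.∣ c i ℤ.* + a i ℤ.- + 0 ℤ.* T ∣          ≡⟨ cong ℤ.∣_∣ (eq (c i) (+ a i) T) ⟩
      ℤ.∣ c i ℤ.* + a i ∣                        ≡⟨ ℤₚ.abs-* (c i) (+ a i) ⟩
      ℤ.∣ c i ∣ * a i                            ≤⟨ ℤ.∣ c i ∣ ⊗ ≤-trans (m≤m+n (a i) _)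
          (≤-trans (≤-reflexive (a≡ i))
          (^-monoʳ-≤ M (≤-pred (≤∧≢⇒< (j≤ i) (λ ji → false≢true (trans (sym e) (≡⇒≡ᵇ-true ji))))))) ⟩
      ℤ.∣ c i ∣ * M ^ t                          ∎
      where
      open ≤-Reasoning
      eq : ∀ c a T → c ℤ.* a ℤ.- + 0 ℤ.* T ≡ c ℤ.* a
      eq = ℤR.solve-∀
    small : ℤ.∣ err ∣ < M ^ suc t
    small = ≤-<-trans (subst (_≤ C * M ^ t) (*-identityʳ ℤ.∣ err ∣)
        (∣sumFin∣≤ (λ i → c i ℤ.* + a i ℤ.- r i ℤ.* T) c 1 (M ^ t)
      (λ i → subst (_≤ ℤ.∣ c i ∣ * M ^ t) (sym (*-identityʳ _)) (term i (σ i) refl))))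
      (m<n+m (C * M ^ t) (m^n>0 M t))

  lacunary : ∀ n (a j l : Fin k → ℕ) → (∀ i → l i < j i) → (∀ i → j i ≤ n) →
      (∀ i → a i + M ^ l i ≡ M ^ j i) →
    ¬ sumFin (λ i → c i ℤ.* + a i) ≡ + 0
  lacunary zero    a j l l<j j≤n a≡ sum≡0 = <⇒≱ (l<j i⋆) (≤-trans (j≤n i⋆) z≤n)
  lacunary (suc t) a j l l<j j≤n a≡ sum≡0 with any? (λ i → j i ≟ℕ suc t)
  ... | yes (i₀ , top) = lacunary-top t a j l l<j j≤n a≡ i₀ top sum≡0
  ... | no none        = lacunary t a j l l<j (λ i → ≤-pred (≤∧≢⇒< (j≤n i) (λ e → none (i , e)))) a≡ sum≡0

  -- Of the two summands in `large`, the first makes M x at most p / 2C for differences x of powers,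
  -- and the second makes p at least 2 · 2CM, so that rounding p / 2CM down loses at most half of
  -- it.
  module Example (n p : ℕ) {{nz : NonZero p}} (large : 2 * C * M * M ^ n + 4 * C * M ≤ p) where
    open Mod p
    open Congruence p

    -- M x is within p / 2C of p for x in J, and within p / 2C of 0 for x in R. Weighted with the
    -- coefficients these errors add up to at most p / 2, so they cannot reach a nonzero multiple of
    -- p.
    InR InJ : ℕ → Set
    InR x = ∃ λ (i : Fin (suc n)) → ∃ λ (j : Fin (suc n)) → toℕ i < toℕ j × x + M ^ toℕ i ≡ M ^ toℕ j
    InJ x = p ≤ M * x × 2 * C * (M * x) ≤ suc (2 * C) * p

    R? : ∀ x → Dec (InR x)
    R? x = any? λ i → any? λ j → (toℕ i <? toℕ j) ×-dec (x + M ^ toℕ i ≟ℕ M ^ toℕ j)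

    J? : ∀ x → Dec (InJ x)
    J? x = (p ≤? M * x) ×-dec (2 * C * (M * x) ≤? suc (2 * C) * p)

    inA : ℕ → Bool
    inA x = does (R? x) ∨ does (J? x)

    A : Subset p
    A = tabulate (inA ∘ toℕ)

    lookup-A : ∀ i → lookup A i ≡ inA (toℕ i)
    lookup-A = lookup∘tabulate (inA ∘ toℕ)

    power≤ : ∀ (j : Fin (suc n)) → M ^ toℕ j ≤ M ^ n
    power≤ j = ^-monoʳ-≤ M (≤-pred (toℕ<n j))

    CM^n<p : C * M ^ n < p
    CM^n<p = lin (suc (C * M ^ n)) p (C * M ^ n + 2 * C * C * M ^ n + 4 * C * C + 3 * C) (large ⊕ 1≤C)
        (eq C (M ^ n) p)
      where
      eq : ∀ C X p → suc (C * X) + (p + C) + (C * X + 2 * C * C * X + 4 * C * C + 3 * C) ≡ p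
          + ((2 * C * suc C * X + 4 * C * suc C) + 1)
      eq = solve-∀

    M^n<p : M ^ n < p
    M^n<p = ≤-<-trans (m≤n*m (M ^ n) C {{>-nonZero 1≤C}}) CM^n<p

    R≤ : ∀ x → InR x → x ≤ M ^ n
    R≤ x (i , j , _ , e) = ≤-trans (m≤m+n x _) (≤-trans (≤-reflexive e) (power≤ j))

    module _ (a : Fin k → ℕ) (a∈A : ∀ i → inA (a i) ≡ true) (t : ℤ) (sum≡ : sumFin (λ i → c i ℤ.* + a i) ≡ t ℤ.* + p) where

      -- The sum is at most C * M ^ n < p in absolute value, so the congruence is an equation
      -- between integers.
      all-R : (∀ i → InR (a i)) → ⊥
      all-R inR = lacunary n a (λ i → toℕ (proj₁ (proj₂ (inR i)))) (λ i → toℕ (proj₁ (inR i)))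
        (λ i → proj₁ (proj₂ (proj₂ (inR i)))) (λ i → ≤-pred (toℕ<n (proj₁ (proj₂ (inR i)))))
            (λ i → proj₂ (proj₂ (proj₂ (inR i))))
        (trans sum≡ (cong (ℤ._* + p) (multiple-small t p _ (sym sum≡) small)))
        where
        small : ℤ.∣ sumFin (λ i → c i ℤ.* + a i) ∣ < p
        small = ≤-<-trans (subst (_≤ C * M ^ n) (*-identityʳ _) (∣sumFin∣≤ (λ i → c i ℤ.* + a i) c 1 (M ^ n)
          (λ i → ≤-trans (≤-reflexive (trans (*-identityʳ _) (ℤₚ.abs-* (c i) (+ a i))))
              (ℤ.∣ c i ∣ ⊗ R≤ (a i) (inR i))))) CM^n<p

      -- Up to an error smaller than p, M · Σ c a equals p · Σ c over the indices in J.
      some-J : ∀ i₀ → InJ (a i₀) → ⊥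
      -- t * M is a sum of coefficients, hence at most C < M in absolute value; so t = 0 and the
      -- coefficients over J sum to zero.
      some-J i₀ inJ = no-zero-sum σ i₀ (dec-true (J? (a i₀)) inJ)
        (trans (sym tM≡) (trans (cong (ℤ._* + M) (multiple-small t M _ tM≡ (s≤s (∣restrict∣≤ σ c)))) refl))
        where
        σ : Fin k → Bool
        σ i = does (J? (a i))
        r y : Fin k → ℤ
        r = restrict σ c
        y i = c i ℤ.* + a i ℤ.* + M
        err = sumFin (λ i → y i ℤ.- r i ℤ.* + p)
        term : ∀ i b → σ i ≡ b → ℤ.∣ y i ℤ.- (if b then c i else + 0) ℤ.* + p ∣ * (2 * C) ≤ ℤ.∣ c i ∣ * p
        term i true e with does-true (J? (a i)) e
        ... | p≤ , ≤p = begin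
          ℤ.∣ c i ℤ.* + a i ℤ.* + M ℤ.- c i ℤ.* + p ∣ * (2 * C)
            ≡⟨ cong (λ z → ℤ.∣ z ∣ * (2 * C))
                (trans (cong (λ z → z ℤ.- c i ℤ.* + p) (trans (ℤₚ.*-assoc (c i) (+ a i) (+ M))
                (cong (c i ℤ.*_) (trans (sym (ℤₚ.pos-* (a i) M)) (trans (cong +_ Ma≡) (ℤₚ.pos-+ p u))))))
                (eq (c i) (+ p) (+ u))) ⟩
          ℤ.∣ c i ℤ.* + u ∣ * (2 * C)            ≡⟨ trans (cong (_* (2 * C)) (ℤₚ.abs-* (c i) (+ u)))
              (*-assoc ℤ.∣ c i ∣ u (2 * C)) ⟩
          ℤ.∣ c i ∣ * (u * (2 * C))              ≤⟨ ℤ.∣ c i ∣ ⊗ u≤ ⟩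
          ℤ.∣ c i ∣ * p                          ∎
          where
          open ≤-Reasoning
          u = M * a i ∸ p
          Ma≡ : a i * M ≡ p + u
          Ma≡ = trans (*-comm (a i) M) (sym (m+[n∸m]≡n p≤))
          eq : ∀ c p u → c ℤ.* (p ℤ.+ u) ℤ.- c ℤ.* p ≡ c ℤ.* u
          eq = ℤR.solve-∀
          u≤ : u * (2 * C) ≤ p
          u≤ = lin (u * (2 * C)) p 0 (≤p ⊕ (2 * C) ⊗ ≤-reflexive (trans (sym Ma≡) (*-comm (a i) M)))
              (eq′ u C p (M * a i))
            where
            eq′ : ∀ u C p m → u * (2 * C) + (suc (2 * C) * p + 2 * C * m) + 0 ≡ p
                + (2 * C * m + 2 * C * (p + u))
            eq′ = solve-∀
        term i false e = begin
          ℤ.∣ c i ℤ.* + a i ℤ.* + M ℤ.- + 0 ℤ.* + p ∣ * (2 * C)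
            ≡⟨ cong (λ z → ℤ.∣ z ∣ * (2 * C)) (trans (eq (c i) (+ a i) (+ M) (+ p))
                (cong (c i ℤ.*_) (sym (ℤₚ.pos-* (a i) M)))) ⟩
          ℤ.∣ c i ℤ.* + (a i * M) ∣ * (2 * C)    ≡⟨ trans (cong (_* (2 * C)) (ℤₚ.abs-* (c i) (+ (a i * M))))
              (*-assoc ℤ.∣ c i ∣ (a i * M) (2 * C)) ⟩
          ℤ.∣ c i ∣ * (a i * M * (2 * C))        ≤⟨ ℤ.∣ c i ∣ ⊗ aM≤ ⟩
          ℤ.∣ c i ∣ * p                          ∎
          where
          open ≤-Reasoning
          eq : ∀ c a M p → c ℤ.* a ℤ.* M ℤ.- + 0 ℤ.* p ≡ c ℤ.* (a ℤ.* M)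
          eq = ℤR.solve-∀
          inR : InR (a i)
          inR with ∨-true (does (R? (a i))) (a∈A i)
          ... | inj₁ e′ = does-true (R? (a i)) e′
          ... | inj₂ e′ = ⊥-elim (false≢true (trans (sym e) e′))
          aM≤ : a i * M * (2 * C) ≤ p
          aM≤ = lin (a i * M * (2 * C)) p (4 * C * M) ((2 * C * M) ⊗ R≤ (a i) inR ⊕ large)
              (eq′ (a i) M C (M ^ n) p)
            where
            eq′ : ∀ a M C X p → a * M * (2 * C) + (2 * C * M * X + p) + 4 * C * M ≡ p
                + (2 * C * M * a + (2 * C * M * X + 4 * C * M))
            eq′ = solve-∀
        err-small : ℤ.∣ err ∣ < p
        err-small = *-cancelʳ-< (2 * C) ℤ.∣ err ∣ p
            (≤-<-trans (∣sumFin∣≤ (λ i → y i ℤ.- r i ℤ.* + p) c (2 * C) p (λ i → term i (σ i) refl))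
          (≤-trans (+-monoˡ-≤ (C * p) (*-mono-≤ 1≤C (>-nonZero⁻¹ p))) (≤-reflexive (eq C p))))
          where
          eq : ∀ C p → C * p + C * p ≡ p * (2 * C)
          eq = solve-∀
        total : t ℤ.* + p ℤ.* + M ≡ sumFin r ℤ.* + p ℤ.+ err
        total = trans (cong (ℤ._* + M) (sym sum≡)) (trans (sym (sumFin-* (λ i → c i ℤ.* + a i) (+ M)))
            (split-error r y (+ p)))
        tM≡ : t ℤ.* + M ≡ sumFin r
        tM≡ = ℤₚ.i-j≡0⇒i≡j _ _ (multiple-small (t ℤ.* + M ℤ.- sumFin r) p err
          (trans (eq₁ t (+ M) (sumFin r) (+ p)) (trans (cong (ℤ._- sumFin r ℤ.* + p) total)
              (eq₂ (sumFin r ℤ.* + p) err))) err-small)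
          where
          eq₁ : ∀ t M r p → (t ℤ.* M ℤ.- r) ℤ.* p ≡ t ℤ.* p ℤ.* M ℤ.- r ℤ.* p
          eq₁ = ℤR.solve-∀
          eq₂ : ∀ x e → (x ℤ.+ e) ℤ.- x ≡ e
          eq₂ = ℤR.solve-∀

      no-relation : ⊥
      no-relation with any? (λ i → J? (a i))
      ... | yes (i , inJ) = some-J i inJ
      ... | no none = all-R inR
        where
        inR : ∀ i → InR (a i)
        inR i with ∨-true (does (R? (a i))) (a∈A i)
        ... | inj₁ e = does-true (R? (a i)) e
        ... | inj₂ e = ⊥-elim (none (i , does-true (J? (a i)) e))

    solution-free : SolutionFree c p A
    solution-free a _ a∈A p∣ with ∣⇒≅0 {sumFin (λ i → c i ℤ.* + toℕ (a i))} p∣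
    ... | by t e = no-relation (toℕ ∘ a) (λ i → trans (sym (lookup-A (a i))) ([]=⇒lookup (a∈A i))) t
        (trans e (ℤₚ.+-identityˡ _))

    -- The translates of an independent set by −M⁰, …, −Mⁿ are disjoint.
    independent-small : ∀ I → Independent p A I → suc n * ∣ I ∣ ≤ p
    independent-small I indep = begin
      suc n * ∣ I ∣                                             ≡⟨ cong (suc n *_) (card-members p I) ⟩
      suc n * count p g                                         ≡⟨ sym (∑-const (suc n) (count p g)) ⟩
      ∑ (suc n) (λ _ → count p g)                               ≡⟨ ∑-cong (suc n)
          (λ i _ → sym (count-shift (Periodic-members p I) (M ^ i))) ⟩
      ∑ (suc n) (λ i → count p (λ u → g (u + M ^ i)))           ≡⟨ ∑-swap (suc n) p
          (λ i u → bit (g (u + M ^ i))) ⟩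
      ∑ p (λ u → count (suc n) (λ i → g (u + M ^ i)))           ≤⟨ ∑-≤-bound p
          (λ u _ → at-most-one (suc n) _ (once u)) ⟩
      p * 1                                                     ≡⟨ *-identityʳ p ⟩
      p                                                         ∎
      where
      open ≤-Reasoning
      g : ℕ → Bool
      g = members p I
      once : ∀ u i j → i < j → j < suc n → g (u + M ^ i) ≡ true → g (u + M ^ j) ≡ true → ⊥
      once u i j i<j j<n gi gj = indep (v i) (v j) (lookup⇒[]= _ I gi) (lookup⇒[]= _ I gj) distinct
          (inj₁ (d , d∈A , ≅0⇒∣ arc))
        where
        v : ℕ → Fin p
        v i = (u + M ^ i) mod p
        toℕ-v : ∀ i → toℕ (v i) ≡ (u + M ^ i) % p
        toℕ-v i = toℕ-fromℕ< (m%n<n (u + M ^ i) p)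
        Mi<Mj : M ^ i < M ^ j
        Mi<Mj = ^-monoʳ-< M (s≤s 1≤C) i<j
        x = M ^ j ∸ M ^ i
        x+ : x + M ^ i ≡ M ^ j
        x+ = m∸n+n≡m (<⇒≤ Mi<Mj)
        Mj<p : M ^ j < p
        Mj<p = ≤-<-trans (^-monoʳ-≤ M (≤-pred j<n)) M^n<p
        x<p : x < p
        x<p = ≤-<-trans (m∸n≤m (M ^ j) (M ^ i)) Mj<p
        d : Fin p
        d = fromℕ< x<p
        d∈A : d ∈ A
        d∈A = lookup⇒[]= d A (trans (lookup-A d) (cong (_∨ does (J? (toℕ d))) (dec-true (R? (toℕ d))
          (fromℕ< i<n , fromℕ< j<n , subst₂ _<_ (sym (toℕ-fromℕ< i<n)) (sym (toℕ-fromℕ< j<n)) i<j ,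
           trans (cong₂ (λ a b → a + M ^ b) (toℕ-fromℕ< x<p) (toℕ-fromℕ< i<n))
               (trans x+ (cong (M ^_) (sym (toℕ-fromℕ< j<n))))))))
          where i<n = <-trans i<j j<n
        vj≈ : toℕ (v j) ≈ toℕ (v i) + toℕ d
        vj≈ = trans (cong (_% p) (toℕ-v j))
            (trans (%-≈ (u + M ^ j)) (trans
            (cong (_% p) (trans (cong (λ z → u + z) (trans (sym x+) (+-comm x (M ^ i))))
            (sym (+-assoc u (M ^ i) x))))
          (+-≈ {u + M ^ i} {toℕ (v i)} {x} {toℕ d} (sym (trans (cong (_% p) (toℕ-v i)) (%-≈ (u + M ^ i))))
              (cong (_% p) (sym (toℕ-fromℕ< x<p))))))
        arc : + toℕ (v j) ℤ.- (+ toℕ (v i) ℤ.+ + toℕ d) ≅ + 0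
        arc = ≅-trans (≅-+ (≅-trans (≈⇒≅ vj≈) (≡⇒≅ (ℤₚ.pos-+ (toℕ (v i)) (toℕ d))))
            (≡⇒≅ {ℤ.- (+ toℕ (v i) ℤ.+ + toℕ d)} refl)) (≡⇒≅ (ℤₚ.+-inverseʳ (+ toℕ (v i) ℤ.+ + toℕ d)))
        distinct : v i ≢ v j
        distinct e = <-irrefl (≈⇒≡ (<-trans Mi<Mj Mj<p) Mj<p
            (+-cancelˡ-≈ u (trans (sym (toℕ-v i)) (trans (cong toℕ e) (toℕ-v j))))) Mi<Mj

    -- The q = ⌊p / 2CM⌋ integers following ⌊p / M⌋ all lie in J. The resulting density does not
    -- involve n.
    dense : p ≤ 4 * C * M * ∣ A ∣
    dense = begin
      p                      ≤⟨ p≤ ⟩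
      4 * C * M * q          ≤⟨ (4 * C * M) ⊗ q≤ ⟩
      4 * C * M * ∣ A ∣      ∎
      where
      open ≤-Reasoning
      D = 2 * C * M
      2≤D : 2 ≤ D
      2≤D = *-mono-≤ {2} {2 * C} {1} (2 ⊗ 1≤C) (s≤s z≤n)
      instance
        D≢0 : NonZero D
        D≢0 = >-nonZero (≤-trans (s≤s z≤n) 2≤D)
      x₀ = p / M
      q = p / D
      qD≤p : q * D ≤ p
      qD≤p = m/n*n≤m p D
      x₀M≤p : x₀ * M ≤ p
      x₀M≤p = m/n*n≤m p M
      p<x₀ : p < M * suc x₀
      p<x₀ = begin-strict
        p                 ≡⟨ m≡m%n+[m/n]*n p M ⟩
        p % M + x₀ * M    <⟨ +-monoˡ-< (x₀ * M) (m%n<n p M) ⟩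
        M + x₀ * M        ≡⟨ *-comm (suc x₀) M ⟩
        M * suc x₀        ∎
      p<q : p < D + q * D
      p<q = begin-strict
        p                 ≡⟨ m≡m%n+[m/n]*n p D ⟩
        p % D + q * D     <⟨ +-monoˡ-< (q * D) (m%n<n p D) ⟩
        D + q * D         ∎
      p≤ : p ≤ 4 * C * M * q
      p≤ = lin p (4 * C * M * q) (2 * C * M * M ^ n + 2) (p<q ⊕ p<q ⊕ large) (eq p C M q (M ^ n))
        where
        eq : ∀ p C M q X → p + ((2 * C * M + q * (2 * C * M)) + ((2 * C * M + q * (2 * C * M)) + p))
            + (2 * C * M * X + 2)
          ≡ 4 * C * M * q + (suc p + (suc p + (2 * C * M * X + 4 * C * M)))
        eq = solve-∀
      fits : suc x₀ + q ≤ p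
      fits = *-cancelˡ-≤ 4 (begin
        4 * (suc x₀ + q)                              ≡⟨ eq x₀ q ⟩
        4 + x₀ * 2 * 2 + q * 4                        ≤⟨ (4≤p ⊕ *-monoˡ-≤ 2 (≤-trans (x₀ ⊗ s≤s 1≤C) x₀M≤p))
            ⊕ ≤-trans (q ⊗ 4≤D) qD≤p ⟩
        p + p * 2 + p                                 ≡⟨ eq′ p ⟩
        4 * p                                         ∎)
        where
        4≤D : 4 ≤ D
        4≤D = *-mono-≤ {2} {2 * C} {2} (2 ⊗ 1≤C) (s≤s 1≤C)
        4≤p : 4 ≤ p
        4≤p = ≤-trans (*-mono-≤ {4} {4 * C} {1} (4 ⊗ 1≤C) (s≤s z≤n))
            (≤-trans (m≤n+m (4 * C * M) (2 * C * M * M ^ n)) large)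
        eq : ∀ x q → 4 * (suc x + q) ≡ 4 + x * 2 * 2 + q * 4
        eq = solve-∀
        eq′ : ∀ p → p + p * 2 + p ≡ 4 * p
        eq′ = solve-∀
      in-J : ∀ i → i < q → inA (suc x₀ + i) ≡ true
      in-J i i<q = trans (cong (does (R? (suc x₀ + i)) ∨_) (dec-true (J? (suc x₀ + i)) (≤-trans (<⇒≤ p<x₀) (M ⊗ m≤m+n (suc x₀) i) , upper))) (∨-zeroʳ _)
        where
        upper : 2 * C * (M * (suc x₀ + i)) ≤ suc (2 * C) * p
        upper = lin (2 * C * (M * (suc x₀ + i))) _ 0 ((2 * C) ⊗ x₀M≤p ⊕ (2 * C * M) ⊗ i<q ⊕ qD≤p)
            (eq C M x₀ i q p)
          where
          eq : ∀ C M x i q p → 2 * C * (M * (suc x + i)) + (2 * C * p + (2 * C * M * q + p)) + 0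
            ≡ suc (2 * C) * p + (2 * C * (x * M) + (2 * C * M * suc i + q * (2 * C * M)))
          eq = solve-∀
      q≤ : q ≤ ∣ A ∣
      q≤ = begin
        q                                                         ≡⟨ sym (trans (∑-const q 1)
            (*-identityʳ q)) ⟩
        ∑ q (λ _ → 1)                                             ≡⟨ ∑-cong q (λ i i<q → cong bit (sym (in-J i i<q))) ⟩
        count q (λ i → inA (suc x₀ + i))                          ≤⟨ m≤n+m _ (count (suc x₀) inA) ⟩
        count (suc x₀) inA + count q (λ i → inA (suc x₀ + i))     ≡⟨ sym (∑-append (suc x₀) q (bit ∘ inA)) ⟩
        count (suc x₀ + q) inA                                    ≤⟨ ∑-monoˡ (bit ∘ inA) fits ⟩
        count p inA                                               ≡⟨ sym (∣∣-count p A inA lookup-A) ⟩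
        ∣ A ∣                                                     ∎

    α-small : ∀ ε → (+ 1 ℚ./ suc n) ℚ.< ε → AlphaAtMost p A ε
    α-small ε small I indep = ℚₚ.≤-trans (≤-fraction⁺ ∣ I ∣ n p (independent-small I indep))
      (ℚₚ.*-monoʳ-≤-nonNeg (+ p ℚ./ 1) {{ℚₚ.normalize-nonNeg p 1}} (ℚₚ.<⇒≤ small))

  -- The density 1 / 4CM serves as δ before ε is known; then n is taken with 1 / (n + 1) < ε, and p
  -- beyond both N and the bound required by `Example`.
  contradiction-A : ConditionA c → ⊥
  contradiction-A cond =
    let ε , 0<ε , δ′ , δ′<δ , N , sparse = cond (+ 1 ℚ./ suc d) (positive-fraction d)
        n , small = smaller-fraction ε 0<ε
        p , isPrime , p≥ = prime-above (N + (2 * C * M * M ^ n + 4 * C * M))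
    in too-dense n p {{prime⇒nonZero isPrime}} (≤-trans (m≤n+m _ N) p≥) δ′ ε δ′<δ
         (λ A free α → sparse p isPrime (≤-trans (m≤m+n N _) p≥) A free α) small
    where
    d = 4 * C * M ∸ 1
    d≡ : suc d ≡ 4 * C * M
    d≡ = m+[n∸m]≡n (≤-trans (s≤s z≤n) (*-mono-≤ {4} {4 * C} {1} (4 ⊗ 1≤C) (s≤s z≤n)))
    too-dense : ∀ n p {{_ : NonZero p}} → 2 * C * M * M ^ n + 4 * C * M ≤ p → ∀ δ′ ε → δ′ ℚ.<
        (+ 1 ℚ./ suc d) →
      (∀ (A : Subset p) → SolutionFree c p A → AlphaAtMost p A ε → (+ ∣ A ∣ ℚ./ 1) ℚ.≤ δ′ ℚ.* (+ p ℚ./ 1)) →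
      (+ 1 ℚ./ suc n) ℚ.< ε → ⊥
    too-dense n p large δ′ ε δ′<δ sparse small = <⇒≱ (<-fraction⁻ ∣ A ∣ d p
        (ℚₚ.≤-<-trans (sparse A solution-free (α-small ε small))
            (ℚₚ.*-monoˡ-<-pos (+ p ℚ./ 1) {{ℚₚ.normalize-pos p 1}} δ′<δ)))
      (subst (λ m → p ≤ m * ∣ A ∣) (sym d≡) dense)
      where open Example n p large

A⇒B : ∀ {k} → 3 ≤ k → (c : Fin k → ℤ) → ConditionA c → ConditionB c
A⇒B {suc k} _ c cond with anySubset? (λ S → nonempty? S ×-dec (subsetSum S c ℤ.≟ + 0))
... | yes found = found
... | no none = ⊥-elim (Construction.contradiction-A c zero
      (λ σ i σi e → none (tabulate σ , (i , lookup⇒[]= i (tabulate σ) (trans (lookup∘tabulate σ i) σi)) ,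
        trans (sumFin-cong (λ i → cong (λ b → if b then c i else + 0) (lookup∘tabulate σ i))) e)) cond)

theorem1p2 : (k : ℕ) → 3 ≤ k → (c : Fin k → ℤ) → (∀ i → c i ≢ + 0) →
    (ConditionA c ⇔ ConditionB c)
theorem1p2 k 3≤k c c≢0 = mk⇔ (A⇒B 3≤k c) (B⇒A 3≤k c c≢0)
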